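{- Let $G$ be a finite group whose Sylow $2$-subgroups are extraspecial of order $2^{2m+1}$ ($m\geqslant 1$), and let $H\leqslant G$. Let $G_2$, $H_2$ and $N_G(H_2)_2$ denote Sylow $2$-subgroups of $G$, $H$ and $N_G(H_2)$, respectively. Then $H$ is a perfect code of $G$ if and only if either $|H|$ is odd or one of the following holds: (1) $H_2$ is non-abelian; (2) $H_2$ is abelian and $|N_G(H_2)_2|<|G_2|$; (3) $H_2$ is abelian, $|H_2|^2=2|G_2|$ and $G_2\cong G_{m,1}$.
   Context: All groups are finite; all graphs are finite, undirected and simple. For a group $G$ and an inverse-closed subset $S\subseteq G\setminus\{1\}$, the Cayley graph $\mathrm{Cay}(G,S)$ has vertex set $G$, with $x,y\in G$ adjacent if and only if $yx^{ -1}\in S$. A subset $C$ of the vertex set of a graph $\Gamma$ is a perfect code in $\Gamma$ if $C$ is an independent set and every vertex of $\Gamma$ is at distance at most $1$ from exactly one vertex of $C$. A subgroup $H$ of a group $G$ is called a perfect code of $G$ if there exists a Cayley graph $\mathrm{Cay}(G,S)$ of $G$ in which $H$ is a perfect code. A finite $2$-group $Q$ is extraspecial if its center $Z(Q)$ has order $2$ and $Q/Z(Q)$ is a (nontrivial) elementary abelian $2$-group; then $|Q|=2^{2m+1}$ for some positive integer $m$. For a positive integer $m$, $G_{m,1}$ denotes the central product $D_8\circ\cdots\circ D_8$ of $m$ copies of the dihedral group $D_8$ of order $8$, with all the centers (of order $2$) identified; it is extraspecial of order $2^{2m+1}$. -}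

module Defs where

open import Algebra.Bundles using (Group)
open import Algebra.Definitions using (Commutative)
import Algebra.Construct.Pointwise as Pointwise
open import Algebra.Morphism.Structures using (module GroupMorphisms)
import Algebra.Properties.Group as GroupProperties
import Algebra.Properties.Monoid.Sum as Sum
open import Data.Bool.Base using (Bool; true; false; _xor_)
open import Data.Bool.Properties using (xor-assoc)
open import Data.Fin.Base using (Fin; zero; suc; toℕ)
open import Data.Fin.Patterns using (0F)
import Data.Fin.Properties as Fin
open import Data.Fin.Subset using (Subset; inside; outside)
import Data.Fin.Subset as Subset
open import Data.Fin.Subset.Properties using (_∈?_; ∈⊤)
open import Data.Nat.Base using (ℕ; zero; suc; _+_; _∸_; _^_)
open import Data.Nat.Divisibility using (_∣_)
open import Data.Nat.DivMod using (_mod_)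
open import Data.Product using (Σ-syntax; ∃-syntax; ∃!; _×_; _,_; proj₁; proj₂)
open import Data.Sum.Base using (_⊎_)
open import Data.Vec.Base using (_∷_; tabulate; here; there)
open import Data.Vec.Properties using (lookup∘tabulate; lookup⇒[]=; []=⇒lookup)
open import Function.Base using (_∘_; _on_)
open import Function.Bundles using (Inverse; _⇔_; mk⇔; module Equivalence)
open import Level using (Level; _⊔_; 0ℓ) renaming (suc to lsuc)
open import Relation.Binary.Bundles using (Setoid)
open import Relation.Binary.Core using (Rel)
open import Relation.Binary.Definitions using (Symmetric; _Respects₂_)
open import Relation.Binary.PropositionalEquality as ≡ using (_≡_)
import Relation.Binary.Reasoning.Setoid as SetoidReasoning
open import Relation.Nullary.Decidable using (Dec; yes; no; does; _×-dec_; _→-dec_; from-yes; map′; dec-true)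
open import Relation.Nullary.Negation using (¬_)
open import Relation.Unary using (Pred; Decidable)

private
  variable
    c ℓ c₁ ℓ₁ c₂ ℓ₂ p : Level

IsAbelian : Group c ℓ → Set (c ⊔ ℓ)
IsAbelian G = Commutative _≈_ _∙_
  where open Group G

infix 4 _≅_

_≅_ : Group c₁ ℓ₁ → Group c₂ ℓ₂ → Set (c₁ ⊔ ℓ₁ ⊔ c₂ ⊔ ℓ₂)
G ≅ H = ∃[ f ] IsGroupIsomorphism f
  where open GroupMorphisms (Group.rawGroup G) (Group.rawGroup H)

record IsNormalSubgroup (G : Group c ℓ) (N : Pred (Group.Carrier G) p) : Set (c ⊔ ℓ ⊔ p) where
  open Group G
  field
    resp        : ∀ {x y} → x ≈ y → N x → N y
    ε-closed    : N ε
    ∙-closed    : ∀ {x y} → N x → N y → N (x ∙ y)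
    ⁻¹-closed   : ∀ {x} → N x → N (x ⁻¹)
    conj-closed : ∀ g {x} → N x → N (g ∙ x ∙ g ⁻¹)

module _ (G : Group c ℓ) where
  open Group G
  open GroupProperties G
  open SetoidReasoning setoid

  cancel-inner : ∀ x y z → (x ∙ y ⁻¹) ∙ (y ∙ z) ≈ x ∙ z
  cancel-inner x y z = begin
    (x ∙ y ⁻¹) ∙ (y ∙ z) ≈⟨ assoc x (y ⁻¹) (y ∙ z) ⟩
    x ∙ (y ⁻¹ ∙ (y ∙ z)) ≈⟨ ∙-congˡ (assoc (y ⁻¹) y z) ⟨
    x ∙ (y ⁻¹ ∙ y ∙ z)   ≈⟨ ∙-congˡ (∙-congʳ (inverseˡ y)) ⟩
    x ∙ (ε ∙ z)          ≈⟨ ∙-congˡ (identityˡ z) ⟩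
    x ∙ z                ∎

  flip-// : ∀ x y → (x ∙ y ⁻¹) ⁻¹ ≈ y ∙ x ⁻¹
  flip-// x y = begin
    (x ∙ y ⁻¹) ⁻¹    ≈⟨ ⁻¹-anti-homo-∙ x (y ⁻¹) ⟩
    y ⁻¹ ⁻¹ ∙ x ⁻¹   ≈⟨ ∙-congʳ (⁻¹-involutive y) ⟩
    y ∙ x ⁻¹         ∎

  conj-∙ : ∀ x y g → (x ∙ g ∙ x ⁻¹) ∙ (x ∙ y) ≈ x ∙ g ∙ y
  conj-∙ x y g = cancel-inner (x ∙ g) x y

  -- The quotient has the same carrier as G; only its equality is coarser.
  quotient : {N : Pred Carrier p} → IsNormalSubgroup G N → Group c p
  quotient {N = N} isNormal = record
    { Carrier = Carrier
    ; _≈_     = λ x y → N (x ∙ y ⁻¹)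
    ; _∙_     = _∙_
    ; ε       = ε
    ; _⁻¹     = _⁻¹
    ; isGroup = record
      { isMonoid = record
        { isSemigroup = record
          { isMagma = record
            { isEquivalence = record
              { refl  = λ {x} → lift (refl {x})
              ; sym   = λ {x} {y} n → resp (flip-// x y) (⁻¹-closed n)
              ; trans = λ {x} {y} {z} m n → resp (cancel-inner x y (z ⁻¹)) (∙-closed m n)
              }
            ; ∙-cong = λ {x} {y} {u} {v} m n → resp (eq x y u v) (∙-closed (conj-closed x n) m)
            }
          ; assoc = λ x y z → lift (assoc x y z)
          }
        ; identity = (λ x → lift (identityˡ x)) , (λ x → lift (identityʳ x))
        }
      ; inverse = (λ x → lift (inverseˡ x)) , (λ x → lift (inverseʳ x))
      ; ⁻¹-cong = λ {x} {y} n → resp (eq′ x y) (conj-closed (x ⁻¹) (⁻¹-closed n))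
      }
    }
    where
    open IsNormalSubgroup isNormal
    lift : ∀ {x y} → x ≈ y → N (x ∙ y ⁻¹)
    lift {x} {y} x≈y = resp (sym (trans (∙-congʳ x≈y) (inverseʳ y))) ε-closed
    eq : ∀ x y u v → (x ∙ (u ∙ v ⁻¹) ∙ x ⁻¹) ∙ (x ∙ y ⁻¹) ≈ (x ∙ u) ∙ (y ∙ v) ⁻¹
    eq x y u v = begin
      (x ∙ (u ∙ v ⁻¹) ∙ x ⁻¹) ∙ (x ∙ y ⁻¹) ≈⟨ conj-∙ x (y ⁻¹) (u ∙ v ⁻¹) ⟩
      x ∙ (u ∙ v ⁻¹) ∙ y ⁻¹                ≈⟨ ∙-congʳ (assoc x u (v ⁻¹)) ⟨
      x ∙ u ∙ v ⁻¹ ∙ y ⁻¹                  ≈⟨ assoc (x ∙ u) (v ⁻¹) (y ⁻¹) ⟩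
      x ∙ u ∙ (v ⁻¹ ∙ y ⁻¹)                ≈⟨ ∙-congˡ (⁻¹-anti-homo-∙ y v) ⟨
      x ∙ u ∙ (y ∙ v) ⁻¹                   ∎
    eq′ : ∀ x y → x ⁻¹ ∙ (x ∙ y ⁻¹) ⁻¹ ∙ x ⁻¹ ⁻¹ ≈ x ⁻¹ ∙ (y ⁻¹) ⁻¹
    eq′ x y = begin
      x ⁻¹ ∙ (x ∙ y ⁻¹) ⁻¹ ∙ x ⁻¹ ⁻¹   ≈⟨ assoc _ _ _ ⟩
      x ⁻¹ ∙ ((x ∙ y ⁻¹) ⁻¹ ∙ x ⁻¹ ⁻¹) ≈⟨ ∙-congˡ (⁻¹-anti-homo-∙ (x ⁻¹) (x ∙ y ⁻¹)) ⟨
      x ⁻¹ ∙ (x ⁻¹ ∙ (x ∙ y ⁻¹)) ⁻¹    ≈⟨ ∙-congˡ (⁻¹-cong (assoc _ _ _)) ⟨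
      x ⁻¹ ∙ (x ⁻¹ ∙ x ∙ y ⁻¹) ⁻¹      ≈⟨ ∙-congˡ (⁻¹-cong (∙-congʳ (inverseˡ x))) ⟩
      x ⁻¹ ∙ (ε ∙ y ⁻¹) ⁻¹             ≈⟨ ∙-congˡ (⁻¹-cong (identityˡ _)) ⟩
      x ⁻¹ ∙ (y ⁻¹) ⁻¹                 ∎

IsNontrivial : Group c ℓ → Set (c ⊔ ℓ)
IsNontrivial G = ∃[ x ] ¬ x ≈ ε
  where open Group G

IsElementaryAbelian2 : Group c ℓ → Set (c ⊔ ℓ)
IsElementaryAbelian2 G = IsAbelian G × (∀ x → x ∙ x ≈ ε)
  where open Group G

module _ (G : Group c ℓ) where
  open Group G
  open GroupProperties G
  open SetoidReasoning setoid

  IsCentral : Pred Carrier (c ⊔ ℓ)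
  IsCentral z = ∀ g → z ∙ g ≈ g ∙ z

  central-resp : ∀ {x y} → x ≈ y → IsCentral x → IsCentral y
  central-resp x≈y cx g = trans (∙-congʳ (sym x≈y)) (trans (cx g) (∙-congˡ x≈y))

  central-ε : IsCentral ε
  central-ε g = trans (identityˡ g) (sym (identityʳ g))

  central-∙ : ∀ {x y} → IsCentral x → IsCentral y → IsCentral (x ∙ y)
  central-∙ {x} {y} cx cy g = begin
    x ∙ y ∙ g   ≈⟨ assoc x y g ⟩
    x ∙ (y ∙ g) ≈⟨ ∙-congˡ (cy g) ⟩
    x ∙ (g ∙ y) ≈⟨ assoc x g y ⟨
    x ∙ g ∙ y   ≈⟨ ∙-congʳ (cx g) ⟩
    g ∙ x ∙ y   ≈⟨ assoc g x y ⟩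
    g ∙ (x ∙ y) ∎

  central-⁻¹ : ∀ {x} → IsCentral x → IsCentral (x ⁻¹)
  central-⁻¹ {x} cx g = begin
    x ⁻¹ ∙ g              ≈⟨ ∙-congˡ (⁻¹-involutive g) ⟨
    x ⁻¹ ∙ g ⁻¹ ⁻¹        ≈⟨ ⁻¹-anti-homo-∙ (g ⁻¹) x ⟨
    (g ⁻¹ ∙ x) ⁻¹         ≈⟨ ⁻¹-cong (cx (g ⁻¹)) ⟨
    (x ∙ g ⁻¹) ⁻¹         ≈⟨ ⁻¹-anti-homo-∙ x (g ⁻¹) ⟩
    g ⁻¹ ⁻¹ ∙ x ⁻¹        ≈⟨ ∙-congʳ (⁻¹-involutive g) ⟩
    g ∙ x ⁻¹              ∎

  central-conj : ∀ g {x} → IsCentral x → g ∙ x ∙ g ⁻¹ ≈ x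
  central-conj g {x} cx = begin
    g ∙ x ∙ g ⁻¹   ≈⟨ ∙-congʳ (cx g) ⟨
    x ∙ g ∙ g ⁻¹   ≈⟨ assoc x g (g ⁻¹) ⟩
    x ∙ (g ∙ g ⁻¹) ≈⟨ ∙-congˡ (inverseʳ g) ⟩
    x ∙ ε          ≈⟨ identityʳ x ⟩
    x              ∎

  open Sum monoid using (sum-cong-≋) renaming (sum to prod)

  prod-ε : ∀ m → prod {m} (λ _ → ε) ≈ ε
  prod-ε zero    = refl
  prod-ε (suc m) = trans (identityˡ _) (prod-ε m)

  prod-∙ : ∀ m (f g : Fin m → Carrier) → (∀ i → IsCentral (g i)) →
           prod (λ i → f i ∙ g i) ≈ prod f ∙ prod g
  prod-∙ zero    f g cg = sym (identityˡ ε)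
  prod-∙ (suc m) f g cg = begin
    f₀ ∙ g₀ ∙ prod (λ i → f (suc i) ∙ g (suc i)) ≈⟨ ∙-congˡ (prod-∙ m (f ∘ suc) (g ∘ suc) (cg ∘ suc)) ⟩
    f₀ ∙ g₀ ∙ (F ∙ H)                            ≈⟨ assoc f₀ g₀ (F ∙ H) ⟩
    f₀ ∙ (g₀ ∙ (F ∙ H))                          ≈⟨ ∙-congˡ (assoc g₀ F H) ⟨
    f₀ ∙ (g₀ ∙ F ∙ H)                            ≈⟨ ∙-congˡ (∙-congʳ (cg zero F)) ⟩
    f₀ ∙ (F ∙ g₀ ∙ H)                            ≈⟨ ∙-congˡ (assoc F g₀ H) ⟩
    f₀ ∙ (F ∙ (g₀ ∙ H))                          ≈⟨ assoc f₀ F (g₀ ∙ H) ⟨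
    f₀ ∙ F ∙ (g₀ ∙ H)                            ∎
    where
    f₀ = f zero
    g₀ = g zero
    F  = prod (f ∘ suc)
    H  = prod (g ∘ suc)

  -- The kernel of the multiplication Z(G) × ⋯ × Z(G) → Z(G).  It is generated
  -- by the elements having z in position i, z⁻¹ in position j and ε elsewhere
  -- (z central), so factoring it out of G × ⋯ × G identifies the centres.
  CentralKernel : ∀ m → Pred (Fin m → Carrier) (c ⊔ ℓ)
  CentralKernel m f = (∀ i → IsCentral (f i)) × prod f ≈ ε

  centralKernel-isNormal : ∀ m → IsNormalSubgroup (Pointwise.group (Fin m) G) (CentralKernel m)
  centralKernel-isNormal m = record
    { resp        = λ f≈g (cf , pf) →
        (λ i → central-resp (f≈g i) (cf i)) , trans (sym (sum-cong-≋ f≈g)) pf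
    ; ε-closed    = (λ _ → central-ε) , prod-ε m
    ; ∙-closed    = λ {f} {g} (cf , pf) (cg , pg) →
        (λ i → central-∙ (cf i) (cg i)) ,
        trans (prod-∙ m f g cg) (trans (∙-cong pf pg) (identityˡ ε))
    ; ⁻¹-closed   = λ {f} (cf , pf) →
        (λ i → central-⁻¹ (cf i)) , (begin
          prod (λ i → f i ⁻¹)               ≈⟨ identityˡ _ ⟨
          ε ∙ prod (λ i → f i ⁻¹)           ≈⟨ ∙-congʳ pf ⟨
          prod f ∙ prod (λ i → f i ⁻¹)      ≈⟨ prod-∙ m f (λ i → f i ⁻¹) (λ i → central-⁻¹ (cf i)) ⟨
          prod (λ i → f i ∙ f i ⁻¹)         ≈⟨ sum-cong-≋ (λ i → inverseʳ (f i)) ⟩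
          prod {m} (λ _ → ε)                ≈⟨ prod-ε m ⟩
          ε                                 ∎)
    ; conj-closed = λ g {f} (cf , pf) →
        (λ i → central-resp (sym (central-conj (g i) (cf i))) (cf i)) ,
        trans (sum-cong-≋ (λ i → central-conj (g i) (cf i))) pf
    }

  centralPower : ℕ → Group c (c ⊔ ℓ)
  centralPower m = quotient (Pointwise.group (Fin m) G) (centralKernel-isNormal m)

-- (k , b) stands for rᵏ sᵇ, where r⁴ = s² = 1 and s r s = r⁻¹.
module D₈ where

  Carrier : Set
  Carrier = Fin 4 × Bool

  infixl 6 _⊕_

  _⊕_ : Fin 4 → Fin 4 → Fin 4
  j ⊕ k = (toℕ j + toℕ k) mod 4

  ⊖_ : Fin 4 → Fin 4
  ⊖ k = (4 ∸ toℕ k) mod 4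

  -- sᵇ rᵏ = r^(act b k) sᵇ
  act : Bool → Fin 4 → Fin 4
  act false k = k
  act true  k = ⊖ k

  _∙_ : Carrier → Carrier → Carrier
  (j , a) ∙ (k , b) = j ⊕ act a k , a xor b

  ε : Carrier
  ε = 0F , false

  _⁻¹ : Carrier → Carrier
  (k , b) ⁻¹ = act b (⊖ k) , b

  _≟_ = Fin._≟_
  all? = Fin.all?

  ⊕-assoc : ∀ a b i j k → (i ⊕ act a j) ⊕ act (a xor b) k ≡ i ⊕ act a (j ⊕ act b k)
  ⊕-assoc false false = from-yes (all? λ i → all? λ j → all? λ k → ((i ⊕ j) ⊕ k) ≟ (i ⊕ (j ⊕ k)))
  ⊕-assoc false true  = from-yes (all? λ i → all? λ j → all? λ k → ((i ⊕ j) ⊕ (⊖ k)) ≟ (i ⊕ (j ⊕ (⊖ k))))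
  ⊕-assoc true  false = from-yes (all? λ i → all? λ j → all? λ k → ((i ⊕ (⊖ j)) ⊕ (⊖ k)) ≟ (i ⊕ (⊖ (j ⊕ k))))
  ⊕-assoc true  true  = from-yes (all? λ i → all? λ j → all? λ k → ((i ⊕ (⊖ j)) ⊕ k) ≟ (i ⊕ (⊖ (j ⊕ (⊖ k)))))

  idˡ : ∀ x → ε ∙ x ≡ x
  idˡ (k , b) = ≡.cong (_, b) (from-yes (all? λ k → (0F ⊕ k) ≟ k) k)

  idʳ : ∀ x → x ∙ ε ≡ x
  idʳ (k , false) = ≡.cong (_, false) (from-yes (all? λ k → (k ⊕ 0F) ≟ k) k)
  idʳ (k , true)  = ≡.cong (_, true)  (from-yes (all? λ k → (k ⊕ (⊖ 0F)) ≟ k) k)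

  invˡ : ∀ x → (x ⁻¹) ∙ x ≡ ε
  invˡ (k , false) = ≡.cong (_, false) (from-yes (all? λ k → ((⊖ k) ⊕ k) ≟ 0F) k)
  invˡ (k , true)  = ≡.cong (_, false) (from-yes (all? λ k → ((⊖ (⊖ k)) ⊕ (⊖ k)) ≟ 0F) k)

  invʳ : ∀ x → x ∙ (x ⁻¹) ≡ ε
  invʳ (k , false) = ≡.cong (_, false) (from-yes (all? λ k → (k ⊕ (⊖ k)) ≟ 0F) k)
  invʳ (k , true)  = ≡.cong (_, false) (from-yes (all? λ k → (k ⊕ (⊖ (⊖ (⊖ k)))) ≟ 0F) k)

  group : Group 0ℓ 0ℓ
  group = record
    { Carrier = Carrier
    ; _≈_     = _≡_
    ; _∙_     = _∙_
    ; ε       = ε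
    ; _⁻¹     = _⁻¹
    ; isGroup = record
      { isMonoid = record
        { isSemigroup = record
          { isMagma = record { isEquivalence = ≡.isEquivalence ; ∙-cong = ≡.cong₂ _∙_ }
          ; assoc   = λ (i , a) (j , b) (k , d) →
              ≡.cong₂ _,_ (⊕-assoc a b i j k) (xor-assoc a b d)
          }
        ; identity = idˡ , idʳ
        }
      ; inverse = invˡ , invʳ
      ; ⁻¹-cong = ≡.cong _⁻¹
      }
    }

G[_,1] : ℕ → Group 0ℓ 0ℓ
G[ m ,1] = centralPower D₈.group m

record FiniteGroup c ℓ : Set (lsuc (c ⊔ ℓ)) where
  field
    group : Group c ℓ
    order : ℕ
    enum  : Inverse (Group.setoid group) (≡.setoid (Fin order))

  open Group group public

  private module E = Inverse enum

  index : Carrier → Fin order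
  index = E.to

  element : Fin order → Carrier
  element = E.from

  -- A set of elements of the group is a set of indices; membership is thus
  -- decidable and respects the equality of the group.
  infix 4 _∈_

  _∈_ : Carrier → Subset order → Set
  x ∈ A = index x Subset.∈ A

  ∈-resp : ∀ {A x y} → x ≈ y → x ∈ A → y ∈ A
  ∈-resp {A} x≈y = ≡.subst (Subset._∈ A) (E.to-cong x≈y)

  element-index : ∀ x → element (index x) ≈ x
  element-index = E.strictlyInverseʳ

  index-element : ∀ i → index (element i) ≡ i
  index-element = E.strictlyInverseˡ

  index-injective : ∀ {x y} → index x ≡ index y → x ≈ y
  index-injective {x} {y} eq =
    trans (sym (element-index x)) (trans (E.from-cong eq) (element-index y))

  infix 4 _≈?_

  _≈?_ : ∀ x y → Dec (x ≈ y)
  x ≈? y = map′ index-injective E.to-cong (index x Fin.≟ index y)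

  all? : {P : Pred Carrier p} → (∀ {x y} → x ≈ y → P x → P y) → Decidable P → Dec (∀ x → P x)
  all? resp P? = map′
    (λ h x → resp (element-index x) (h (index x)))
    (λ h i → h (element i))
    (Fin.all? (P? ∘ element))

  comprehension : {P : Pred Carrier p} → Decidable P → Subset order
  comprehension P? = tabulate (does ∘ P? ∘ element)

  ∈-comprehension⁺ : {P : Pred Carrier p} (P? : Decidable P) → (∀ {x y} → x ≈ y → P x → P y) →
                     ∀ {x} → P x → x ∈ comprehension P?
  ∈-comprehension⁺ P? resp {x} px = lookup⇒[]= (index x) _
    (≡.trans (lookup∘tabulate (does ∘ P? ∘ element) (index x))
             (dec-true (P? _) (resp (sym (element-index x)) px)))

  ∈-comprehension⁻ : {P : Pred Carrier p} (P? : Decidable P) → (∀ {x y} → x ≈ y → P x → P y) →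
                     ∀ {x} → x ∈ comprehension P? → P x
  ∈-comprehension⁻ P? resp {x} x∈
    with P? (element (index x))
       | ≡.trans (≡.sym (lookup∘tabulate (does ∘ P? ∘ element) (index x))) ([]=⇒lookup x∈)
  ... | yes px | _ = resp (element-index x) px
  ... | no  _  | ()

record Subgroup (G : FiniteGroup c ℓ) : Set (c ⊔ ℓ) where
  open FiniteGroup G
  field
    members   : Subset order
    ε-closed  : ε ∈ members
    ∙-closed  : ∀ {x y} → x ∈ members → y ∈ members → x ∙ y ∈ members
    ⁻¹-closed : ∀ {x} → x ∈ members → x ⁻¹ ∈ members

open Subgroup public using (members)

module Enumerate where
  rank : ∀ {n} (A : Subset n) {x} → x Subset.∈ A → Fin Subset.∣ A ∣
  rank (inside  ∷ A) here       = zero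
  rank (inside  ∷ A) (there x∈) = suc (rank A x∈)
  rank (outside ∷ A) (there x∈) = rank A x∈

  nth : ∀ {n} (A : Subset n) → Fin Subset.∣ A ∣ → Fin n
  nth (inside  ∷ A) zero    = zero
  nth (inside  ∷ A) (suc k) = suc (nth A k)
  nth (outside ∷ A) k       = suc (nth A k)

  nth∈ : ∀ {n} (A : Subset n) k → nth A k Subset.∈ A
  nth∈ (inside  ∷ A) zero    = here
  nth∈ (inside  ∷ A) (suc k) = there (nth∈ A k)
  nth∈ (outside ∷ A) k       = there (nth∈ A k)

  nth-rank : ∀ {n} (A : Subset n) {x} (x∈ : x Subset.∈ A) → nth A (rank A x∈) ≡ x
  nth-rank (inside  ∷ A) here       = ≡.refl
  nth-rank (inside  ∷ A) (there x∈) = ≡.cong suc (nth-rank A x∈)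
  nth-rank (outside ∷ A) (there x∈) = ≡.cong suc (nth-rank A x∈)

  rank-nth : ∀ {n} (A : Subset n) {x} (x∈ : x Subset.∈ A) k → x ≡ nth A k → rank A x∈ ≡ k
  rank-nth (inside  ∷ A) here       zero    eq = ≡.refl
  rank-nth (inside  ∷ A) (there x∈) (suc k) eq = ≡.cong suc (rank-nth A x∈ k (Fin.suc-injective eq))
  rank-nth (outside ∷ A) (there x∈) k       eq = rank-nth A x∈ k (Fin.suc-injective eq)

  rank-cong : ∀ {n} (A : Subset n) {x y} (x∈ : x Subset.∈ A) (y∈ : y Subset.∈ A) →
              x ≡ y → rank A x∈ ≡ rank A y∈
  rank-cong A x∈ y∈ eq = rank-nth A x∈ (rank A y∈) (≡.trans eq (≡.sym (nth-rank A y∈)))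

module _ {G : FiniteGroup c ℓ} where
  open FiniteGroup G

  ⟨_⟩ : Subgroup G → FiniteGroup c ℓ
  ⟨ H ⟩ = record
    { group = record
      { Carrier = Σ[ x ∈ Carrier ] x ∈ A
      ; _≈_     = _≈_ on proj₁
      ; _∙_     = λ (x , x∈) (y , y∈) → x ∙ y , H.∙-closed x∈ y∈
      ; ε       = ε , H.ε-closed
      ; _⁻¹     = λ (x , x∈) → x ⁻¹ , H.⁻¹-closed x∈
      ; isGroup = record
        { isMonoid = record
          { isSemigroup = record
            { isMagma = record
              { isEquivalence = record { refl = refl ; sym = sym ; trans = trans }
              ; ∙-cong        = ∙-cong
              }
            ; assoc = λ (x , _) (y , _) (z , _) → assoc x y z
            }
          ; identity = (λ (x , _) → identityˡ x) , (λ (x , _) → identityʳ x)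
          }
        ; inverse = (λ (x , _) → inverseˡ x) , (λ (x , _) → inverseʳ x)
        ; ⁻¹-cong = ⁻¹-cong
        }
      }
    ; order = Subset.∣ A ∣
    ; enum  = record
      { to        = λ (_ , x∈) → rank A x∈
      ; from      = λ k → element (nth A k) , ≡.subst (Subset._∈ A) (≡.sym (index-element _)) (nth∈ A k)
      ; to-cong   = λ { {_ , x∈} {_ , y∈} x≈y → rank-cong A x∈ y∈ (Inverse.to-cong enum x≈y) }
      ; from-cong = λ { ≡.refl → refl }
      ; inverse   =
          (λ { {k} {_ , x∈} x≈ →
               rank-nth A x∈ k (≡.trans (Inverse.to-cong enum x≈) (index-element _)) }) ,
          (λ { {_ , x∈} ≡.refl →
               trans (Inverse.from-cong enum (nth-rank A x∈)) (element-index _) })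
      }
    }
    where
    open Enumerate
    module H = Subgroup H
    A = H.members

  ∥_∥ : Subgroup G → ℕ
  ∥ H ∥ = FiniteGroup.order ⟨ H ⟩

  infix 4 _≤_

  _≤_ : Subgroup G → Subgroup G → Set
  H ≤ K = members H Subset.⊆ members K

  module Normalizer (H : Subgroup G) where
    open GroupProperties group
    open SetoidReasoning setoid
    A = members H

    -- g A g⁻¹ = A
    Normalizes : Pred Carrier c
    Normalizes g = ∀ x → (g ∙ x ∙ g ⁻¹ ∈ A) ⇔ (x ∈ A)

    conj-cong : ∀ {g h x y} → g ≈ h → x ≈ y → g ∙ x ∙ g ⁻¹ ≈ h ∙ y ∙ h ⁻¹
    conj-cong g≈h x≈y = ∙-cong (∙-cong g≈h x≈y) (⁻¹-cong g≈h)

    normalizes-resp : ∀ {g h} → g ≈ h → Normalizes g → Normalizes h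
    normalizes-resp g≈h n x = mk⇔
      (λ m → Equivalence.to (n x) (∈-resp (conj-cong (sym g≈h) refl) m))
      (λ m → ∈-resp (conj-cong g≈h refl) (Equivalence.from (n x) m))

    normalizes? : Decidable Normalizes
    normalizes? g = all?
      (λ x≈y n → mk⇔
        (λ m → ∈-resp x≈y (Equivalence.to n (∈-resp (conj-cong refl (sym x≈y)) m)))
        (λ m → ∈-resp (conj-cong refl x≈y) (Equivalence.from n (∈-resp (sym x≈y) m))))
      (λ x → map′ (λ (f , g) → mk⇔ f g) (λ n → Equivalence.to n , Equivalence.from n)
        (((index (g ∙ x ∙ g ⁻¹) ∈? A) →-dec (index x ∈? A)) ×-dec
         ((index x ∈? A) →-dec (index (g ∙ x ∙ g ⁻¹) ∈? A))))

    ∈⁺ : ∀ {g} → Normalizes g → g ∈ comprehension normalizes?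
    ∈⁺ = ∈-comprehension⁺ normalizes? normalizes-resp
    ∈⁻ : ∀ {g} → g ∈ comprehension normalizes? → Normalizes g
    ∈⁻ = ∈-comprehension⁻ normalizes? normalizes-resp

    ε-conj : ∀ x → ε ∙ x ∙ ε ⁻¹ ≈ x
    ε-conj x = trans (∙-cong (identityˡ x) ε⁻¹≈ε) (identityʳ x)

    ∙-conj : ∀ g h x → (g ∙ h) ∙ x ∙ (g ∙ h) ⁻¹ ≈ g ∙ (h ∙ x ∙ h ⁻¹) ∙ g ⁻¹
    ∙-conj g h x = begin
      (g ∙ h) ∙ x ∙ (g ∙ h) ⁻¹     ≈⟨ ∙-cong (assoc g h x) (⁻¹-anti-homo-∙ g h) ⟩
      g ∙ (h ∙ x) ∙ (h ⁻¹ ∙ g ⁻¹)  ≈⟨ assoc _ _ _ ⟨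
      g ∙ (h ∙ x) ∙ h ⁻¹ ∙ g ⁻¹    ≈⟨ ∙-congʳ (assoc _ _ _) ⟩
      g ∙ (h ∙ x ∙ h ⁻¹) ∙ g ⁻¹    ∎

    ⁻¹-conj : ∀ g x → g ∙ (g ⁻¹ ∙ x ∙ g ⁻¹ ⁻¹) ∙ g ⁻¹ ≈ x
    ⁻¹-conj g x = begin
      g ∙ (g ⁻¹ ∙ x ∙ g ⁻¹ ⁻¹) ∙ g ⁻¹       ≈⟨ ∙-conj g (g ⁻¹) x ⟨
      (g ∙ g ⁻¹) ∙ x ∙ (g ∙ g ⁻¹) ⁻¹        ≈⟨ conj-cong (inverseʳ g) refl ⟩
      ε ∙ x ∙ ε ⁻¹                          ≈⟨ ε-conj x ⟩
      x                                     ∎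

    normalizer : Subgroup G
    normalizer = record
      { members   = comprehension normalizes?
      ; ε-closed  = ∈⁺ λ x → mk⇔ (∈-resp (ε-conj x)) (∈-resp (sym (ε-conj x)))
      ; ∙-closed  = λ {g} {h} g∈ h∈ → ∈⁺ λ x →
          let module Gx = Equivalence (∈⁻ g∈ (h ∙ x ∙ h ⁻¹))
              module Hx = Equivalence (∈⁻ h∈ x)
          in mk⇔ (λ m → Hx.to (Gx.to (∈-resp (∙-conj g h x) m)))
                 (λ m → ∈-resp (sym (∙-conj g h x)) (Gx.from (Hx.from m)))
      ; ⁻¹-closed = λ {g} g∈ → ∈⁺ λ x →
          let module Gx = Equivalence (∈⁻ g∈ (g ⁻¹ ∙ x ∙ g ⁻¹ ⁻¹))
          in mk⇔ (λ m → ∈-resp (⁻¹-conj g x) (Gx.from m))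
                 (λ m → Gx.to (∈-resp (sym (⁻¹-conj g x)) m))
      }

  open Normalizer public using (normalizer)

module _ (G : FiniteGroup c ℓ) where
  open FiniteGroup G

  whole : Subgroup G
  whole = record
    { members   = Subset.⊤
    ; ε-closed  = ∈⊤
    ; ∙-closed  = λ _ _ → ∈⊤
    ; ⁻¹-closed = λ _ → ∈⊤
    }

  central? : Decidable (IsCentral group)
  central? z = all?
    (λ x≈y e → trans (∙-congˡ (sym x≈y)) (trans e (∙-congʳ x≈y)))
    (λ g → (z ∙ g) ≈? (g ∙ z))

  ∈⁺ : ∀ {z} → IsCentral group z → z ∈ comprehension central?
  ∈⁺ = ∈-comprehension⁺ central? (central-resp group)
  ∈⁻ : ∀ {z} → z ∈ comprehension central? → IsCentral group z
  ∈⁻ = ∈-comprehension⁻ central? (central-resp group)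

  centre : Subgroup G
  centre = record
    { members   = comprehension central?
    ; ε-closed  = ∈⁺ (central-ε group)
    ; ∙-closed  = λ x∈ y∈ → ∈⁺ (central-∙ group (∈⁻ x∈) (∈⁻ y∈))
    ; ⁻¹-closed = λ x∈ → ∈⁺ (central-⁻¹ group (∈⁻ x∈))
    }

  centre-isNormal : IsNormalSubgroup group (_∈ members centre)
  centre-isNormal = record
    { resp        = ∈-resp
    ; ε-closed    = Subgroup.ε-closed centre
    ; ∙-closed    = Subgroup.∙-closed centre
    ; ⁻¹-closed   = Subgroup.⁻¹-closed centre
    ; conj-closed = λ g x∈ → ∈-resp (sym (central-conj group g (∈⁻ x∈))) x∈
    }

  IsExtraspecial : Set c
  IsExtraspecial =
    (∃[ k ] order ≡ 2 ^ k) ×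
    ∥ centre ∥ ≡ 2 ×
    IsElementaryAbelian2 G/Z × IsNontrivial G/Z
    where G/Z = quotient group centre-isNormal

IsSylow : ℕ → {G : FiniteGroup c ℓ} → (P K : Subgroup G) → Set
IsSylow q P K = P ≤ K × (∃[ k ] ∥ P ∥ ≡ q ^ k × q ^ k ∣ ∥ K ∥ × ¬ q ^ suc k ∣ ∥ K ∥)

record Graph v ℓ e : Set (lsuc (v ⊔ ℓ ⊔ e)) where
  infix 4 _~_
  field
    vertices    : Setoid v ℓ
  open Setoid vertices public using (_≈_) renaming (Carrier to Vertex)
  field
    _~_         : Rel Vertex e
    ~-resp-≈    : _~_ Respects₂ _≈_
    symmetric   : Symmetric _~_
    irreflexive : ∀ {x} → ¬ x ~ x

module _ {v ℓ e} (Γ : Graph v ℓ e) where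
  open Graph Γ

  IsIndependent : Pred Vertex p → Set (v ⊔ e ⊔ p)
  IsIndependent C = ∀ {x y} → C x → C y → ¬ x ~ y

  DistanceAtMost1 : Vertex → Vertex → Set (ℓ ⊔ e)
  DistanceAtMost1 x y = x ≈ y ⊎ x ~ y

  IsPerfectCodeIn : Pred Vertex p → Set (v ⊔ ℓ ⊔ e ⊔ p)
  IsPerfectCodeIn C =
    IsIndependent C × (∀ x → ∃! _≈_ λ y → C y × DistanceAtMost1 x y)

module _ (G : FiniteGroup c ℓ) where
  open FiniteGroup G
  open GroupProperties group

  record ConnectionSet : Set c where
    field
      S         : Subset order
      ε∉S       : ¬ ε ∈ S
      ⁻¹-closed : ∀ {x} → x ∈ S → x ⁻¹ ∈ S

  Cay : ConnectionSet → Graph c ℓ 0ℓ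
  Cay conn = record
    { vertices    = setoid
    ; _~_         = λ x y → y ∙ x ⁻¹ ∈ S
    ; ~-resp-≈    = (λ y≈z → ∈-resp (∙-congʳ y≈z)) , (λ x≈z → ∈-resp (∙-congˡ (⁻¹-cong x≈z)))
    ; symmetric   = λ {x} {y} s → ∈-resp (flip-// group y x) (⁻¹-closed s)
    ; irreflexive = λ {x} s → ε∉S (∈-resp (inverseʳ x) s)
    }
    where open ConnectionSet conn

  IsPerfectCodeOf : Subgroup G → Set (c ⊔ ℓ)
  IsPerfectCodeOf H = ∃[ conn ] IsPerfectCodeIn (Cay conn) (_∈ members H)

{-# OPTIONS --safe #-}
module Submission where

-- H is a perfect code exactly when G has an inverse-closed transversal of the left cosets of H.
-- Let Q be a Sylow 2-subgroup of H and R ≥ N₂ a Sylow 2-subgroup of G.  Such a transversal exists iff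
--   (★)  every x ∈ N₂ with x² ∈ Q has some q ∈ Q with (xq)² = 1.
-- Given the transversal, an involution on the odd set H/Q yields q.  Conversely (★) puts an
-- involution into every double coset HxH = Hx⁻¹H with an odd number of left cosets, and then the left
-- cosets outside H can be matched: aH with bH for some b ∈ Ha⁻¹H, or aH with itself if it
-- contains an involution.
-- In the extraspecial group R with centre ⟨z⟩ squares and commutators give a quadratic form s and its
-- polar form c.  Condition (★) holds if Q is nonabelian or z ∉ Q; and z ∈ Q iff Q is normal in R, for
-- Q ≠ 1.  If Q is abelian and normal, (★) says that every x with c(x,q) = s(q) on Q has s(x) = 0.
-- Such x exist by counting characters; the condition forces C(Q) = Q, that is |Q|² = 2|R|, and
-- produces a maximal totally singular subgroup, from which one splits off copies of D₈.
--
-- Groups are transported to Fin n with propositional equality, and sets to decidable predicates.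

open import Defs hiding (module Enumerate)
open import Algebra.Bundles using (Group)
open import Algebra.Morphism.Construct.Composition using (isGroupIsomorphism)
open import Algebra.Morphism.Structures using (module GroupMorphisms)
import Algebra.Properties.Group as GroupProperties
import Algebra.Properties.Monoid.Sum as MonoidSum
open import Algebra.Structures using (IsGroup)
open import Data.Bool.Base using (Bool; true; false; _xor_; _∧_; not)
open import Data.Bool.Properties using (not-¬; ¬-not; not-injective; ∧-zeroʳ; ∧-identityʳ; xor-same; xor-comm; xor-assoc;
  xor-identityʳ; xor-annihilates-not; not-distribˡ-xor; not-distribʳ-xor) renaming (_≟_ to _≟ᵇ_)
open import Data.Empty using (⊥)
open import Data.Fin.Base using (Fin; zero; suc)
open import Data.Fin.Properties using (_≟_; any?; all?; suc-injective)
open import Data.Fin.Subset using (Subset; inside; outside) renaming (_∈_ to _∈ˢ_)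
import Data.Fin.Subset as Subset
open import Data.Fin.Subset.Properties using (_∈?_; drop-there; ∈⊤)
open import Data.List.Base using (List; []; _∷_)
open import Data.Nat.Base using (ℕ; zero; suc; _+_; _*_; _^_; _<_; z≤n; s≤s; NonZero; >-nonZero; >-nonZero⁻¹)
  renaming (_≤_ to _≤ⁿ_)
open import Data.Nat.Divisibility using (_∣_; _∣?_; divides; _∣0; ∣-refl; ∣-trans; ∣⇒≤; ∣m∣n⇒∣m+n; ∣m+n∣m⇒∣n; m∣m*n;
  *-monoʳ-∣; *-monoˡ-∣; *-cancelʳ-∣)
open import Data.Nat.Induction using (<-wellFounded)
open import Data.Nat.Primality using (euclidsLemma; prime[2])
import Data.Nat.Properties as ℕ
open import Data.Product using (∃; ∃-syntax; ∃!; _×_; _,_; proj₁; proj₂)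
open import Data.Product.Properties using (≡-dec)
open import Data.Sum.Base as Sum using (_⊎_; inj₁; inj₂; [_,_]; [_,_]′)
open import Data.Unit.Base using (⊤; tt)
open import Data.Vec.Base using (Vec; []; _∷_; lookup; tabulate; there)
open import Data.Vec.Properties using (lookup∘tabulate; lookup⇒[]=; []=⇒lookup)
open import Function.Base using (_∘_; id)
open import Function.Bundles using (_⇔_; mk⇔; Inverse; module Equivalence)
open import Induction.WellFounded using (Acc; acc)
open import Level using (0ℓ; _⊔_)
open import Relation.Binary.Definitions using (tri<; tri≈; tri>)
open import Relation.Binary.PropositionalEquality
  using (_≡_; refl; sym; trans; cong; cong₂; subst; subst₂; isEquivalence; module ≡-Reasoning)
import Relation.Binary.Reasoning.Setoid as SetoidReasoning
import Relation.Binary.Reflection as Reflection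
open import Relation.Nullary.Decidable
  using (Dec; yes; no; does; from-yes; dec-true; ¬?; _×-dec_; _⊎-dec_; _→-dec_; decidable-stable)
open import Relation.Nullary.Negation using (¬_; contradiction)
open import Relation.Unary using (Pred; Decidable)
open import Algebra.Properties.CommutativeMonoid.Sum ℕ.+-0-commutativeMonoid using (sum; sum-cong-≗; ∑-distrib-+; ∑-comm)

-- Inversion exchanges left and right cosets, so left cosets cannot simply be paired with their
-- inverses. But aH and bH have representatives t and t⁻¹ exactly when b ∈ Ha⁻¹H. Only the numbers
-- of left cosets in double cosets therefore matter: HaH and Ha⁻¹H contain equally many, and trouble
-- arises only when HaH = Ha⁻¹H contains an odd number. No quotient is formed. That a number of
-- cosets of U is odd is stated as: 2|U| does not divide the number of elements. On R, the identity
-- s(xq) = s(x) + s(q) + c(x,q) makes failure of (★) a linear condition: s(x) = 1 and c(x,·) = s on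
-- Q. For abelian Q containing z, the solutions of c(x,·) = s form one coset x₀C(Q). If s vanishes
-- on this coset, then s is additive on C(Q), so C(Q) is abelian and lies in CC(Q) = Q. The singular
-- subgroup is built from x₀ and the kernel of s on Q. The constant 2 in |Q|² = 2|R| comes from
-- |Q||C(Q)| = 2|R|, which holds because both factors count z.

private
  variable
    n n′ : ℕ
    P Q : Pred (Fin n) 0ℓ
    P′ : Pred (Fin n′) 0ℓ

-- Counting on Fin n

𝟙 : ∀ {a} {A : Set a} → Dec A → ℕ
𝟙 (yes _) = 1
𝟙 (no  _) = 0

𝟙-yes : ∀ {a} {A : Set a} (A? : Dec A) → A → 𝟙 A? ≡ 1
𝟙-yes (yes _) _ = refl
𝟙-yes (no ¬a) a = contradiction a ¬a

𝟙-no : ∀ {a} {A : Set a} (A? : Dec A) → ¬ A → 𝟙 A? ≡ 0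
𝟙-no (yes a) ¬a = contradiction a ¬a
𝟙-no (no _)  _  = refl

𝟙-cong : ∀ {a b} {A : Set a} {B : Set b} (A? : Dec A) (B? : Dec B) → (A → B) → (B → A) → 𝟙 A? ≡ 𝟙 B?
𝟙-cong (yes a) B? f g = sym (𝟙-yes B? (f a))
𝟙-cong (no ¬a) B? f g = sym (𝟙-no B? (¬a ∘ g))

count : {P : Pred (Fin n) 0ℓ} → Decidable P → ℕ
count {zero}  P? = 0
count {suc n} P? = 𝟙 (P? zero) + count (P? ∘ suc)

count≡sum : (P? : Decidable P) → count P? ≡ sum (𝟙 ∘ P?)
count≡sum {zero}  P? = refl
count≡sum {suc n} P? = cong (𝟙 (P? zero) +_) (count≡sum (P? ∘ suc))

sum-* : ∀ a (f : Fin n → ℕ) → sum (λ i → a * f i) ≡ a * sum f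
sum-* {zero}  a f = sym (ℕ.*-zeroʳ a)
sum-* {suc n} a f = trans (cong (a * f zero +_) (sum-* a (f ∘ suc))) (sym (ℕ.*-distribˡ-+ a (f zero) _))

sum-const : ∀ n a → sum {n} (λ _ → a) ≡ n * a
sum-const zero    a = refl
sum-const (suc n) a = cong (a +_) (sum-const n a)

count-cong : (P? : Decidable P) (Q? : Decidable Q) → (∀ i → P i → Q i) → (∀ i → Q i → P i) → count P? ≡ count Q?
count-cong {zero}  P? Q? f g = refl
count-cong {suc n} P? Q? f g =
  cong₂ _+_ (𝟙-cong (P? zero) (Q? zero) (f zero) (g zero)) (count-cong (P? ∘ suc) (Q? ∘ suc) (f ∘ suc) (g ∘ suc))

count-none : ∀ {n} {P : Pred (Fin n) 0ℓ} (P? : Decidable P) → (∀ i → ¬ P i) → count P? ≡ 0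
count-none {n} P? ¬p = trans (count≡sum P?)
  (trans (sum-cong-≗ λ i → 𝟙-no (P? i) (¬p i)) (trans (sum-const n 0) (ℕ.*-zeroʳ n)))

count-all : ∀ {n} {P : Pred (Fin n) 0ℓ} (P? : Decidable P) → (∀ i → P i) → count P? ≡ n
count-all {n} P? p = trans (count≡sum P?)
  (trans (sum-cong-≗ λ i → 𝟙-yes (P? i) (p i)) (trans (sum-const n 1) (ℕ.*-identityʳ n)))

count-⊎ : {A B : Pred (Fin n) 0ℓ} (P? : Decidable P) (A? : Decidable A) (B? : Decidable B) →
          (∀ i → P i → A i ⊎ B i) → (∀ i → A i → P i) → (∀ i → B i → P i) → (∀ i → A i → ¬ B i) →
          count P? ≡ count A? + count B?
count-⊎ P? A? B? split a b disj = begin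
  count P?                          ≡⟨ count≡sum P? ⟩
  sum (𝟙 ∘ P?)                      ≡⟨ sum-cong-≗ pointwise ⟩
  sum (λ i → 𝟙 (A? i) + 𝟙 (B? i))   ≡⟨ ∑-distrib-+ (𝟙 ∘ A?) (𝟙 ∘ B?) ⟩
  sum (𝟙 ∘ A?) + sum (𝟙 ∘ B?)       ≡⟨ cong₂ _+_ (count≡sum A?) (count≡sum B?) ⟨
  count A? + count B?               ∎
  where
  open ≡-Reasoning
  pointwise : ∀ i → 𝟙 (P? i) ≡ 𝟙 (A? i) + 𝟙 (B? i)
  pointwise i with A? i | B? i
  ... | yes x | yes y = contradiction y (disj i x)
  ... | yes x | no  _ = 𝟙-yes (P? i) (a i x)
  ... | no  _ | yes y = 𝟙-yes (P? i) (b i y)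
  ... | no ¬x | no ¬y = 𝟙-no (P? i) ([ ¬x , ¬y ] ∘ split i)

count-split : (P? : Decidable P) (Q? : Decidable Q) →
              count P? ≡ count (λ i → P? i ×-dec Q? i) + count (λ i → P? i ×-dec ¬? (Q? i))
count-split {Q = Q} P? Q? = count-⊎ P? _ _ split (λ _ → proj₁) (λ _ → proj₁) (λ _ (_ , q) (_ , ¬q) → ¬q q)
  where
  split : ∀ i → _ → _
  split i p with Q? i
  ... | yes q = inj₁ (p , q)
  ... | no ¬q = inj₂ (p , ¬q)

count-mono : (P? : Decidable P) (Q? : Decidable Q) → (∀ i → P i → Q i) → count P? ≤ⁿ count Q?
count-mono P? Q? f = subst (count P? ≤ⁿ_) (sym (count-split Q? P?))
  (subst (_≤ⁿ count Q∩P? + count Q∖P?) (count-cong Q∩P? P? (λ _ → proj₂) (λ i p → f i p , p))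
    (ℕ.m≤m+n (count Q∩P?) (count Q∖P?)))
  where
  Q∩P? = λ i → Q? i ×-dec P? i
  Q∖P? = λ i → Q? i ×-dec ¬? (P? i)

count-≟ : (a : Fin n) → count (_≟ a) ≡ 1
count-≟ {suc n} zero    = cong suc (count-none {n} (λ i → suc i ≟ zero) (λ _ ()))
count-≟ {suc n} (suc a) = trans (count-cong (λ i → suc i ≟ suc a) (_≟ a) (λ _ → suc-injective) (λ _ → cong suc))
  (count-≟ a)

count-unique : (P? : Decidable P) (a : Fin n) → P a → (∀ b → P b → b ≡ a) → count P? ≡ 1
count-unique P? a p u = trans (count-cong P? (_≟ a) u (λ { _ refl → p })) (count-≟ a)

count-pos : (P? : Decidable P) {a : Fin n} → P a → 1 ≤ⁿ count P?
count-pos P? {a} p = subst (_≤ⁿ count P?) (count-≟ a) (count-mono (_≟ a) P? (λ { _ refl → p }))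

count-witness : (P? : Decidable P) → ¬ count P? ≡ 0 → ∃ P
count-witness P? ≢0 with any? P?
... | yes w = w
... | no ¬w = contradiction (count-none P? (λ i p → ¬w (i , p))) ≢0

count-⊆-≥ : (P? : Decidable P) (Q? : Decidable Q) → (∀ i → P i → Q i) → count Q? ≤ⁿ count P? → ∀ i → Q i → P i
count-⊆-≥ P? Q? f le i q with P? i
... | yes p = p
... | no ¬p = contradiction le (ℕ.<⇒≱ (begin-strict
  count P?                    ≡⟨ count-cong P? Q∩P? (λ i p → f i p , p) (λ _ → proj₂) ⟩
  count Q∩P?                  <⟨ ℕ.m<m+n (count Q∩P?) (count-pos Q∖P? (q , ¬p)) ⟩
  count Q∩P? + count Q∖P?     ≡⟨ count-split Q? P? ⟨
  count Q?                    ∎))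
  where
  open ℕ.≤-Reasoning
  Q∩P? = λ i → Q? i ×-dec P? i
  Q∖P? = λ i → Q? i ×-dec ¬? (P? i)

sum-𝟙 : ∀ a (f : Fin n → ℕ) (P? : Decidable P) → (∀ i → P i → f i ≡ a) → (∀ i → ¬ P i → f i ≡ 0) → sum f ≡ a * count P?
sum-𝟙 a f P? p ¬p = trans (sum-cong-≗ pointwise) (trans (sum-* a (𝟙 ∘ P?)) (cong (a *_) (sym (count≡sum P?))))
  where
  pointwise : ∀ i → f i ≡ a * 𝟙 (P? i)
  pointwise i with P? i
  ... | yes x = trans (p i x) (sym (ℕ.*-identityʳ a))
  ... | no ¬x = trans (¬p i ¬x) (sym (ℕ.*-zeroʳ a))

count-swap : {R : Fin n → Fin n′ → Set} (R? : ∀ i j → Dec (R i j)) →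
             sum (λ i → count (R? i)) ≡ sum (λ j → count (λ i → R? i j))
count-swap R? = trans (sum-cong-≗ (λ i → count≡sum (R? i)))
  (trans (∑-comm (λ i j → 𝟙 (R? i j))) (sum-cong-≗ (λ j → sym (count≡sum (λ i → R? i j)))))

double-count : {R : Fin n → Fin n′ → Set} (R? : ∀ i j → Dec (R i j)) (P? : Decidable P) (Q? : Decidable P′) → ∀ a b →
               (∀ i j → R i j → P i × P′ j) →
               (∀ i → P i → count (R? i) ≡ a) → (∀ j → P′ j → count (λ i → R? i j) ≡ b) →
               a * count P? ≡ b * count Q?
double-count R? P? Q? a b dom rows cols = trans
  (sym (sum-𝟙 a _ P? rows (λ i ¬p → count-none (R? i) (λ j r → ¬p (proj₁ (dom i j r))))))
  (trans (count-swap R?)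
         (sum-𝟙 b _ Q? cols (λ j ¬q → count-none (λ i → R? i j) (λ i r → ¬q (proj₂ (dom i j r))))))

count-bij : (P? : Decidable P) (Q? : Decidable P′) (f : Fin n → Fin n′) (g : Fin n′ → Fin n) →
            (∀ i → P i → P′ (f i)) → (∀ j → P′ j → P (g j)) →
            (∀ i → P i → g (f i) ≡ i) → (∀ j → P′ j → f (g j) ≡ j) → count P? ≡ count Q?
count-bij P? Q? f g pq qp gf fg = trans (sym (ℕ.*-identityˡ _)) (trans
  (double-count (λ i j → (P? i ×-dec Q? j) ×-dec (j ≟ f i)) P? Q? 1 1 (λ _ _ → proj₁)
    (λ i p → count-unique _ (f i) ((p , pq i p) , refl) (λ _ → proj₂))
    (λ j q → count-unique _ (g j) ((qp j q , q) , sym (fg j q))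
      (λ i ((p , _) , e) → trans (sym (gf i p)) (cong g (sym e)))))
  (ℕ.*-identityˡ _))

-- A set closed under `E` is exhausted by removing one class at a time. Below, `d` is |U| or 2|U|.
module Partition {E : Fin n → Fin n → Set} (E? : ∀ a b → Dec (E a b))
                 (E-refl : ∀ {a} → E a a) (E-sym : ∀ {a b} → E a b → E b a)
                 (E-trans : ∀ {a b c} → E a b → E b c → E a c) (d : ℕ) where

  private
    go : {P : Pred (Fin n) 0ℓ} (P? : Decidable P) → (∀ {a b} → P a → E a b → P b) →
         (∀ a → P a → d ∣ count (E? a)) → Acc _<_ (count P?) → d ∣ count P?
    go {P} P? closed classes (acc rs) with any? P?
    ... | no  ∄p      = subst (d ∣_) (sym (count-none P? (λ i p → ∄p (i , p)))) (d ∣0)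
    ... | yes (a , p) = subst (d ∣_) (sym split) (∣m∣n⇒∣m+n (classes a p)
            (go P∖a? closed′ (λ b (q , _) → classes b q)
              (rs (subst (count P∖a? <_) (sym split) (ℕ.m<n+m _ (count-pos (E? a) E-refl))))))
      where
      P∖a? : Decidable (λ b → P b × ¬ E a b)
      P∖a? b = P? b ×-dec ¬? (E? a b)
      split : count P? ≡ count (E? a) + count P∖a?
      split = trans (count-split P? (E? a))
        (cong (_+ count P∖a?) (count-cong _ (E? a) (λ _ → proj₂) (λ _ e → closed p e , e)))
      closed′ : ∀ {b c} → P b × ¬ E a b → E b c → P c × ¬ E a c
      closed′ (q , ¬e) e = closed q e , (λ e′ → ¬e (E-trans e′ (E-sym e)))

  ∣-classes⇒∣ : {P : Pred (Fin n) 0ℓ} (P? : Decidable P) → (∀ {a b} → P a → E a b → P b) →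
                (∀ a → P a → d ∣ count (E? a)) → d ∣ count P?
  ∣-classes⇒∣ P? closed classes = go P? closed classes (<-wellFounded _)

-- Groups on Fin n

-- Words in free groups: expressions with the same reduced word agree in every group.
module GroupSolver {c ℓ} (G : Group c ℓ) where
  open Group G using (Carrier; _≈_; _∙_; ε; _⁻¹; assoc; ∙-congˡ; ∙-congʳ; identityˡ; inverseˡ; inverseʳ)
    renaming (refl to ≈-refl; sym to ≈-sym; trans to ≈-trans; setoid to ≈-setoid)
  open GroupProperties G using (⁻¹-anti-homo-∙; ε⁻¹≈ε; ⁻¹-involutive)

  infixl 6 _⊕_
  infix 8 _⁻

  data Expr (k : ℕ) : Set where
    var  : Fin k → Expr k
    _⊕_  : Expr k → Expr k → Expr k
    e    : Expr k
    _⁻   : Expr k → Expr k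

  Word : ℕ → Set
  Word k = List (Fin k × Bool)

  Env : ℕ → Set c
  Env k = Vec Carrier k

  private
    variable
      k : ℕ

  ⟦_⟧ : Expr k → Env k → Carrier
  ⟦ var i ⟧ ρ = lookup ρ i
  ⟦ s ⊕ t ⟧ ρ = ⟦ s ⟧ ρ ∙ ⟦ t ⟧ ρ
  ⟦ e ⟧     ρ = ε
  ⟦ s ⁻ ⟧   ρ = ⟦ s ⟧ ρ ⁻¹

  signed : Bool → Carrier → Carrier
  signed false x = x
  signed true  x = x ⁻¹

  ⟦_⟧ʷ : Word k → Env k → Carrier
  ⟦ [] ⟧ʷ          ρ = ε
  ⟦ (i , b) ∷ w ⟧ʷ ρ = signed b (lookup ρ i) ∙ ⟦ w ⟧ʷ ρ

  push : Fin k → Bool → Word k → Word k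
  push i b [] = (i , b) ∷ []
  push i b ((j , b′) ∷ w) with i ≟ j | b | b′
  ... | yes _ | false | true  = w
  ... | yes _ | true  | false = w
  ... | _     | _     | _     = (i , b) ∷ (j , b′) ∷ w

  reduce : Bool → Expr k → Word k → Word k
  reduce b     (var i) w = push i b w
  reduce false (s ⊕ t) w = reduce false s (reduce false t w)
  reduce true  (s ⊕ t) w = reduce true t (reduce true s w)
  reduce b     e       w = w
  reduce b     (s ⁻)   w = reduce (not b) s w

  cancelˡ : ∀ {x y} z → x ∙ y ≈ ε → z ≈ x ∙ (y ∙ z)
  cancelˡ z xy≈ε = ≈-trans (≈-sym (identityˡ z)) (≈-trans (∙-congʳ (≈-sym xy≈ε)) (assoc _ _ z))

  push-correct : ∀ i b (w : Word k) ρ → ⟦ push i b w ⟧ʷ ρ ≈ signed b (lookup ρ i) ∙ ⟦ w ⟧ʷ ρ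
  push-correct i b [] ρ = ≈-refl
  push-correct i b ((j , b′) ∷ w) ρ with i ≟ j | b | b′
  ... | yes refl | false | true  = cancelˡ _ (inverseʳ _)
  ... | yes refl | true  | false = cancelˡ _ (inverseˡ _)
  ... | yes refl | false | false = ≈-refl
  ... | yes refl | true  | true  = ≈-refl
  ... | no  _    | _     | _     = ≈-refl

  reduce-correct : ∀ b (s : Expr k) w ρ → ⟦ reduce b s w ⟧ʷ ρ ≈ signed b (⟦ s ⟧ ρ) ∙ ⟦ w ⟧ʷ ρ
  reduce-correct b     (var i) w ρ = push-correct i b w ρ
  reduce-correct false (s ⊕ t) w ρ = ≈-trans (reduce-correct false s _ ρ)
    (≈-trans (∙-congˡ (reduce-correct false t w ρ)) (≈-sym (assoc _ _ _)))
  reduce-correct true  (s ⊕ t) w ρ = ≈-trans (reduce-correct true t _ ρ)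
    (≈-trans (∙-congˡ (reduce-correct true s w ρ))
             (≈-trans (≈-sym (assoc _ _ _)) (∙-congʳ (≈-sym (⁻¹-anti-homo-∙ _ _)))))
  reduce-correct false e       w ρ = ≈-sym (identityˡ _)
  reduce-correct true  e       w ρ = ≈-trans (≈-sym (identityˡ _)) (∙-congʳ (≈-sym ε⁻¹≈ε))
  reduce-correct false (s ⁻)   w ρ = reduce-correct true s w ρ
  reduce-correct true  (s ⁻)   w ρ = ≈-trans (reduce-correct false s w ρ) (∙-congʳ (≈-sym (⁻¹-involutive _)))

  ⟦_⇓⟧ : Expr k → Env k → Carrier
  ⟦ s ⇓⟧ ρ = ⟦ reduce false s [] ⟧ʷ ρ

  correct : ∀ (s : Expr k) ρ → ⟦ s ⇓⟧ ρ ≈ ⟦ s ⟧ ρ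
  correct s ρ = ≈-trans (reduce-correct false s [] ρ) (Group.identityʳ G _)

  open Reflection ≈-setoid var ⟦_⟧ ⟦_⇓⟧ correct public using (solve; _⊜_)

record FinGroup (n : ℕ) : Set where
  infixl 7 _∙_
  infix 8 _⁻¹
  field
    _∙_     : Fin n → Fin n → Fin n
    ε       : Fin n
    _⁻¹     : Fin n → Fin n
    isGroup : IsGroup _≡_ _∙_ ε _⁻¹

  group : Group 0ℓ 0ℓ
  group = record { isGroup = isGroup }

  open Group group public using (assoc; identityˡ; identityʳ; inverseˡ; inverseʳ)

odd-factor-of-2^ : ∀ k c s → c * s ≡ 2 ^ k → ¬ 2 ∣ c → c ≡ 1
odd-factor-of-2^ zero    c s eq odd = ℕ.m*n≡1⇒m≡1 c s eq
odd-factor-of-2^ (suc k) c s eq odd with euclidsLemma c s prime[2] (divides (2 ^ k) (trans eq (ℕ.*-comm 2 (2 ^ k))))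
... | inj₁ 2∣c = contradiction 2∣c odd
... | inj₂ (divides s′ refl) = odd-factor-of-2^ k c s′
  (ℕ.*-cancelʳ-≡ (c * s′) (2 ^ k) 2 (trans (ℕ.*-assoc c s′ 2) (trans eq (ℕ.*-comm 2 (2 ^ k))))) odd

record Sub (𝔾 : FinGroup n) : Set₁ where
  open FinGroup 𝔾
  field
    mem  : Pred (Fin n) 0ℓ
    mem? : Decidable mem
    ε∈   : mem ε
    ∙∈   : ∀ {x y} → mem x → mem y → mem (x ∙ y)
    ⁻¹∈  : ∀ {x} → mem x → mem (x ⁻¹)
  size : ℕ
  size = count mem?

-- Cosets and double cosets

module Theory {n : ℕ} (𝔾 : FinGroup n) where
  open FinGroup 𝔾
  open GroupSolver group using (solve; _⊜_; _⊕_; _⁻; e)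
  open GroupProperties group using (⁻¹-involutive)
  open Sub using (size; mem?)

  _∋_ : Sub 𝔾 → Pred (Fin n) 0ℓ
  U ∋ x = Sub.mem U x

  x⁻¹∙xy : ∀ x y → x ⁻¹ ∙ (x ∙ y) ≡ y
  x⁻¹∙xy = solve 2 (λ x y → x ⁻ ⊕ (x ⊕ y) ⊜ y) refl

  x∙x⁻¹y : ∀ x y → x ∙ (x ⁻¹ ∙ y) ≡ y
  x∙x⁻¹y = solve 2 (λ x y → x ⊕ (x ⁻ ⊕ y) ⊜ y) refl

  count-∙ˡ : (P? : Decidable P) (g : Fin n) → count (λ b → P? (g ∙ b)) ≡ count P?
  count-∙ˡ {P = P} P? g = count-bij (λ b → P? (g ∙ b)) P? (g ∙_) (g ⁻¹ ∙_) (λ _ p → p)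
    (λ b p → subst P (sym (x∙x⁻¹y g b)) p) (λ b _ → x⁻¹∙xy g b) (λ b _ → x∙x⁻¹y g b)

  count-∙ʳ : (P? : Decidable P) (g : Fin n) → count (λ b → P? (b ∙ g)) ≡ count P?
  count-∙ʳ {P = P} P? g = count-bij (λ b → P? (b ∙ g)) P? (_∙ g) (_∙ g ⁻¹) (λ _ p → p)
    (λ b p → subst P (sym (eq₁ b g)) p) (λ b _ → eq₂ b g) (λ b _ → eq₁ b g)
    where
    eq₁ : ∀ x y → x ∙ y ⁻¹ ∙ y ≡ x
    eq₁ = solve 2 (λ x y → x ⊕ y ⁻ ⊕ y ⊜ x) refl
    eq₂ : ∀ x y → x ∙ y ∙ y ⁻¹ ≡ x
    eq₂ = solve 2 (λ x y → x ⊕ y ⊕ y ⁻ ⊜ x) refl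

  count-⁻¹ : (P? : Decidable P) → count (λ b → P? (b ⁻¹)) ≡ count P?
  count-⁻¹ {P = P} P? = count-bij (λ b → P? (b ⁻¹)) P? _⁻¹ _⁻¹ (λ _ p → p)
    (λ b p → subst P (sym (⁻¹-involutive b)) p) (λ b _ → ⁻¹-involutive b) (λ b _ → ⁻¹-involutive b)

  size-pos : (U : Sub 𝔾) → NonZero (size U)
  size-pos U = >-nonZero (count-pos (mem? U) (Sub.ε∈ U))

  module Cosets (U : Sub 𝔾) where
    open Sub U hiding (size; mem?)

    infix 4 _∼_ _∼?_
    _∼_ : Fin n → Fin n → Set
    a ∼ b = U ∋ (a ⁻¹ ∙ b)

    _∼?_ : ∀ a b → Dec (a ∼ b)
    a ∼? b = mem? U (a ⁻¹ ∙ b)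

    ∼-refl : ∀ {a} → a ∼ a
    ∼-refl {a} = subst (U ∋_) (sym (inverseˡ a)) ε∈

    ∼-sym : ∀ {a b} → a ∼ b → b ∼ a
    ∼-sym {a} {b} u = subst (U ∋_) (solve 2 (λ a b → (a ⁻ ⊕ b) ⁻ ⊜ b ⁻ ⊕ a) refl a b) (⁻¹∈ u)

    ∼-trans : ∀ {a b c} → a ∼ b → b ∼ c → a ∼ c
    ∼-trans {a} {b} {c} u v =
      subst (U ∋_) (solve 3 (λ a b c → (a ⁻ ⊕ b) ⊕ (b ⁻ ⊕ c) ⊜ a ⁻ ⊕ c) refl a b c) (∙∈ u v)

    ∼-∙ˡ : ∀ g {a b} → a ∼ b → g ∙ a ∼ g ∙ b
    ∼-∙ˡ g {a} {b} = subst (U ∋_) (solve 3 (λ g a b → a ⁻ ⊕ b ⊜ (g ⊕ a) ⁻ ⊕ (g ⊕ b)) refl g a b)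

    ∼-∙ʳ : ∀ a {u} → U ∋ u → a ∼ a ∙ u
    ∼-∙ʳ a {u} = subst (U ∋_) (sym (x⁻¹∙xy a u))

    ∼-⊆ : ∀ {a b} → U ∋ a → a ∼ b → U ∋ b
    ∼-⊆ {a} {b} u v = subst (U ∋_) (x∙x⁻¹y a b) (∙∈ u v)

    count-coset : ∀ a → count (a ∼?_) ≡ size U
    count-coset a = count-∙ˡ (mem? U) (a ⁻¹)

    module _ (d : ℕ) where
      open Partition _∼?_ ∼-refl ∼-sym ∼-trans d public

    lagrange : (P? : Decidable P) → (∀ {a b} → P a → a ∼ b → P b) → size U ∣ count P?
    lagrange P? closed = ∣-classes⇒∣ (size U) P? closed (λ a _ → subst (size U ∣_) (sym (count-coset a)) ∣-refl)

    -- If no coset were fixed, the cosets in `P` would pair off as aU and σ(a)U, each pair having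
    -- 2|U| elements. It suffices that `σ` is an involution modulo U.
    involution-fixes-coset :
      (P? : Decidable P) → (∀ {a b} → P a → a ∼ b → P b) →
      (σ : Fin n → Fin n) → (∀ {a} → P a → P (σ a)) → (∀ {a b} → P a → a ∼ b → σ a ∼ σ b) →
      (∀ {a} → P a → a ∼ σ (σ a)) → ¬ 2 * size U ∣ count P? → ∃[ a ] P a × a ∼ σ a
    involution-fixes-coset {P} P? closed σ σ-closed σ-cong σ-inv odd with any? (λ a → P? a ×-dec a ∼? σ a)
    ... | yes w = w
    ... | no ¬w = contradiction
      (Partition.∣-classes⇒∣ E? (inj₁ ∼-refl) E-sym E-trans (2 * size U) P? E-closed class) odd
      where
      E : Fin n → Fin n → Set
      E a b = a ∼ b ⊎ (P a × P b × σ a ∼ b)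
      E? : ∀ a b → Dec (E a b)
      E? a b = a ∼? b ⊎-dec (P? a ×-dec P? b ×-dec σ a ∼? b)
      E-sym : ∀ {a b} → E a b → E b a
      E-sym (inj₁ u) = inj₁ (∼-sym u)
      E-sym (inj₂ (p , q , u)) = inj₂ (q , p , ∼-sym (∼-trans (σ-inv p) (σ-cong (σ-closed p) u)))
      E-trans : ∀ {a b c} → E a b → E b c → E a c
      E-trans (inj₁ u) (inj₁ v) = inj₁ (∼-trans u v)
      E-trans (inj₁ u) (inj₂ (p , q , v)) = inj₂ (closed p (∼-sym u) , q , ∼-trans (σ-cong (closed p (∼-sym u)) u) v)
      E-trans (inj₂ (p , q , u)) (inj₁ v) = inj₂ (p , closed q v , ∼-trans u v)
      E-trans (inj₂ (p , _ , u)) (inj₂ (_ , _ , v)) = inj₁ (∼-trans (∼-trans (σ-inv p) (σ-cong (σ-closed p) u)) v)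
      E-closed : ∀ {a b} → P a → E a b → P b
      E-closed p (inj₁ u) = closed p u
      E-closed p (inj₂ (_ , q , _)) = q
      class : ∀ a → P a → 2 * size U ∣ count (E? a)
      class a p = subst (2 * size U ∣_) (sym (begin
        count (E? a)                          ≡⟨ count-⊎ (E? a) (a ∼?_) (σ a ∼?_) (λ { _ (inj₁ u) → inj₁ u ; _ (inj₂ (_ , _ , u)) → inj₂ u })
                                                   (λ _ → inj₁) (λ b u → inj₂ (p , closed (σ-closed p) u , u))
                                                   (λ b u v → ¬w (a , p , ∼-trans u (∼-sym v))) ⟩
        count (a ∼?_) + count (σ a ∼?_)       ≡⟨ cong₂ _+_ (count-coset a) (count-coset (σ a)) ⟩
        size U + size U                       ≡⟨ cong (size U +_) (ℕ.+-identityʳ (size U)) ⟨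
        2 * size U                            ∎)) ∣-refl
        where open ≡-Reasoning

  module DoubleCosets (S U : Sub 𝔾) where
    private
      module S = Sub S
      module U = Sub U

    -- a U is fixed by left multiplication by S
    Fixed : Fin n → Set
    Fixed a = ∀ s → S ∋ s → U ∋ (a ⁻¹ ∙ (s ∙ a))

    fixed? : Decidable Fixed
    fixed? a = all? (λ s → mem? S s →-dec mem? U (a ⁻¹ ∙ (s ∙ a)))

    infix 4 _≋_ _≋?_
    -- Equality of the double cosets SaU and SbU: some s in S carries bU to aU.
    _≋_ : Fin n → Fin n → Set
    a ≋ b = ∃[ s ] S ∋ s × U ∋ (a ⁻¹ ∙ (s ∙ b))

    _≋?_ : ∀ a b → Dec (a ≋ b)
    a ≋? b = any? (λ s → mem? S s ×-dec mem? U (a ⁻¹ ∙ (s ∙ b)))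

    ≋-refl : ∀ {a} → a ≋ a
    ≋-refl {a} = ε , S.ε∈ , subst (U ∋_) (sym (trans (cong (a ⁻¹ ∙_) (identityˡ a)) (inverseˡ a))) U.ε∈

    ≋-sym : ∀ {a b} → a ≋ b → b ≋ a
    ≋-sym {a} {b} (s , s∈ , u) = s ⁻¹ , S.⁻¹∈ s∈ ,
      subst (U ∋_) (solve 3 (λ a b s → (a ⁻ ⊕ (s ⊕ b)) ⁻ ⊜ b ⁻ ⊕ (s ⁻ ⊕ a)) refl a b s) (U.⁻¹∈ u)

    ≋-trans : ∀ {a b c} → a ≋ b → b ≋ c → a ≋ c
    ≋-trans {a} {b} {c} (s , s∈ , u) (t , t∈ , v) = s ∙ t , S.∙∈ s∈ t∈ ,
      subst (U ∋_) (solve 5 (λ a b c s t → (a ⁻ ⊕ (s ⊕ b)) ⊕ (b ⁻ ⊕ (t ⊕ c)) ⊜ a ⁻ ⊕ (s ⊕ t ⊕ c)) refl a b c s t)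
        (U.∙∈ u v)

    fixed-resp : ∀ {a b} → Fixed a → a ≋ b → Fixed b
    fixed-resp {a} {b} fix (s , s∈ , u) t t∈ =
      subst (U ∋_) (solve 4 (λ a b s t → (a ⁻ ⊕ (s ⊕ b)) ⁻ ⊕ (a ⁻ ⊕ (s ⊕ t ⊕ s ⁻ ⊕ a)) ⊕ (a ⁻ ⊕ (s ⊕ b)) ⊜ b ⁻ ⊕
        (t ⊕ b)) refl a b s t)
        (U.∙∈ (U.∙∈ (U.⁻¹∈ u) (fix (s ∙ t ∙ s ⁻¹) (S.∙∈ (S.∙∈ s∈ t∈) (S.⁻¹∈ s∈)))) u)

    stabilizer : Fin n → Sub 𝔾
    stabilizer a = record
      { mem  = λ s → S ∋ s × U ∋ (a ⁻¹ ∙ (s ∙ a))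
      ; mem? = λ s → mem? S s ×-dec mem? U (a ⁻¹ ∙ (s ∙ a))
      ; ε∈   = S.ε∈ , subst (U ∋_) (solve 1 (λ a → e ⊜ a ⁻ ⊕ (e ⊕ a)) refl a) U.ε∈
      ; ∙∈   = λ {s} {t} (s∈ , u) (t∈ , v) → S.∙∈ s∈ t∈ ,
          subst (U ∋_) (solve 3 (λ a s t → (a ⁻ ⊕ (s ⊕ a)) ⊕ (a ⁻ ⊕ (t ⊕ a)) ⊜ a ⁻ ⊕ (s ⊕ t ⊕ a)) refl a s t) (U.∙∈ u v)
      ; ⁻¹∈  = λ {s} (s∈ , u) → S.⁻¹∈ s∈ ,
          subst (U ∋_) (solve 2 (λ a s → (a ⁻ ⊕ (s ⊕ a)) ⁻ ⊜ a ⁻ ⊕ (s ⁻ ⊕ a)) refl a s) (U.⁻¹∈ u)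
      }

    -- Both sides count the pairs (s , b) with s in S and sb in aU: each s admits |U| elements b,
    -- and for b in SaU the admissible s form a coset of the stabiliser.
    orbit-stabilizer : ∀ a → size U * size S ≡ size (stabilizer a) * count (a ≋?_)
    orbit-stabilizer a = double-count (λ s b → mem? S s ×-dec mem? U (a ⁻¹ ∙ (s ∙ b))) (mem? S) (a ≋?_) _ _
      (λ s b (s∈ , u) → s∈ , s , s∈ , u) row column
      where
      row : ∀ s → S ∋ s → count (λ b → mem? S s ×-dec mem? U (a ⁻¹ ∙ (s ∙ b))) ≡ size U
      row s s∈ = begin
        count (λ b → mem? S s ×-dec mem? U (a ⁻¹ ∙ (s ∙ b)))
          ≡⟨ count-cong (λ b → mem? S s ×-dec mem? U (a ⁻¹ ∙ (s ∙ b))) (λ b → mem? U (a ⁻¹ ∙ (s ∙ b))) (λ _ → proj₂)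
            (λ _ u → s∈ , u) ⟩
        count (λ b → mem? U (a ⁻¹ ∙ (s ∙ b)))                ≡⟨ count-∙ˡ (λ b → mem? U (a ⁻¹ ∙ b)) s ⟩
        count (λ b → mem? U (a ⁻¹ ∙ b))                      ≡⟨ count-∙ˡ (mem? U) (a ⁻¹) ⟩
        size U                                               ∎
        where open ≡-Reasoning
      column : ∀ b → a ≋ b → count (λ s → mem? S s ×-dec mem? U (a ⁻¹ ∙ (s ∙ b))) ≡ size (stabilizer a)
      column b (t , t∈ , u) = trans (count-cong _ (λ s → mem? (stabilizer a) (s ∙ t ⁻¹))
        (λ s (s∈ , v) → S.∙∈ s∈ (S.⁻¹∈ t∈) ,
          subst (U ∋_) (solve 4 (λ a b s t → (a ⁻ ⊕ (s ⊕ b)) ⊕ (a ⁻ ⊕ (t ⊕ b)) ⁻ ⊜ a ⁻ ⊕ (s ⊕ t ⁻ ⊕ a)) refl a b s t)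
            (U.∙∈ v (U.⁻¹∈ u)))
        (λ s (st∈ , v) → subst (S ∋_) (solve 2 (λ s t → s ⊕ t ⁻ ⊕ t ⊜ s) refl s t) (S.∙∈ st∈ t∈) ,
          subst (U ∋_) (solve 4 (λ a b s t → (a ⁻ ⊕ (s ⊕ t ⁻ ⊕ a)) ⊕ (a ⁻ ⊕ (t ⊕ b)) ⊜ a ⁻ ⊕ (s ⊕ b)) refl a b s t)
            (U.∙∈ v u)))
        (count-∙ʳ (mem? (stabilizer a)) (t ⁻¹))

    -- |SaU| is |U| times the index of the stabiliser in the 2-group S, and that index is even
    -- unless S fixes aU.
    moved-orbit : ∀ {k} → size S ≡ 2 ^ k → ∀ a → ¬ Fixed a → 2 * size U ∣ count (a ≋?_)
    moved-orbit {k} |S|≡2^k a ¬fix with Cosets.lagrange (stabilizer a) (mem? S)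
        (λ {x} {y} x∈ (z∈ , _) → subst (S ∋_) (x∙x⁻¹y x y) (S.∙∈ x∈ z∈))
    ... | divides c |S|≡cs = subst (_∣ count (a ≋?_)) (ℕ.*-comm (size U) 2)
      (subst (size U * 2 ∣_) (sym orbit≡) (*-monoʳ-∣ (size U) 2∣c))
      where
      s = size (stabilizer a)
      instance _ = size-pos (stabilizer a)
      orbit≡ : count (a ≋?_) ≡ size U * c
      orbit≡ = ℕ.*-cancelˡ-≡ (count (a ≋?_)) (size U * c) s (begin
        s * count (a ≋?_)   ≡⟨ orbit-stabilizer a ⟨
        size U * size S     ≡⟨ cong (size U *_) |S|≡cs ⟩
        size U * (c * s)    ≡⟨ ℕ.*-assoc (size U) c s ⟨
        size U * c * s      ≡⟨ ℕ.*-comm _ s ⟩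
        s * (size U * c)    ∎)
        where open ≡-Reasoning
      c≢1 : ¬ c ≡ 1
      c≢1 refl = ¬fix λ t t∈ → proj₂ (count-⊆-≥ (mem? (stabilizer a)) (mem? S) (λ _ → proj₁)
        (ℕ.≤-reflexive (trans |S|≡cs (ℕ.*-identityˡ s))) t t∈)
      2∣c : 2 ∣ c
      2∣c = decidable-stable (2 ∣? c) λ odd → c≢1 (odd-factor-of-2^ k c s (trans (sym |S|≡cs) |S|≡2^k) odd)

    -- Fixed-point congruence for a 2-group: moved cosets fall into double cosets with an even
    -- number of them. It serves three times: for Q ≤ N₂, for the cosets in HxH that normalise Q,
    -- and for Sylow conjugacy.
    fixed-odd : ∀ {k} → size S ≡ 2 ^ k → (P? : Decidable P) → (∀ {a b} → P a → a ≋ b → P b) →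
                ¬ 2 * size U ∣ count P? → ¬ 2 * size U ∣ count (λ a → P? a ×-dec fixed? a)
    fixed-odd {k = k} |S|≡2^k P? closed odd fix-even = odd
      (subst (2 * size U ∣_) (sym (count-split P? fixed?)) (∣m∣n⇒∣m+n fix-even
      (Partition.∣-classes⇒∣ _≋?_ ≋-refl ≋-sym ≋-trans (2 * size U) (λ a → P? a ×-dec ¬? (fixed? a))
        (λ (p , ¬fix) r → closed p r , λ fix → ¬fix (fixed-resp fix (≋-sym r)))
        (λ a (_ , ¬fix) → moved-orbit {k} |S|≡2^k a ¬fix))))

    ∼⇒≋ : ∀ {a b} → Cosets._∼_ U a b → a ≋ b
    ∼⇒≋ {a} {b} u = ε , S.ε∈ , subst (λ x → U ∋ (a ⁻¹ ∙ x)) (sym (identityˡ b)) u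

  module Inversion (H : Sub 𝔾) where
    open DoubleCosets H H using (_≋_)

    ≋-⁻¹ : ∀ {a b} → a ≋ b → a ⁻¹ ≋ b ⁻¹
    ≋-⁻¹ {a} {b} (h , h∈ , u) = a ⁻¹ ∙ (h ∙ b) , u ,
      subst (H ∋_) (solve 3 (λ a b h → h ⊜ a ⁻ ⁻ ⊕ (a ⁻ ⊕ (h ⊕ b) ⊕ b ⁻)) refl a b h) h∈

    ≋-flip : ∀ {a b} → a ⁻¹ ≋ b → a ≋ b ⁻¹
    ≋-flip {a} {b} r = subst (_≋ b ⁻¹) (⁻¹-involutive a) (≋-⁻¹ r)

-- Perfect codes and involutions

-- Indices multiply and 2 is prime. This turns an odd number of H-cosets in HxH into an odd number
-- of Q-cosets.
even-multiple : ∀ {q h d} .{{_ : NonZero q}} → q ∣ h → ¬ 2 * q ∣ h → h ∣ d → ¬ 2 * h ∣ d → ¬ 2 * q ∣ d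
even-multiple {q} (divides o refl) odd₁ (divides c refl) odd₂ 2q∣d
  with euclidsLemma c o prime[2] (*-cancelʳ-∣ q (subst (2 * q ∣_) (sym (ℕ.*-assoc c o q)) 2q∣d))
... | inj₁ 2∣c = odd₂ (*-monoˡ-∣ (o * q) 2∣c)
... | inj₂ 2∣o = odd₁ (*-monoˡ-∣ q 2∣o)

module Codes {n : ℕ} (𝔾 : FinGroup n) where
  open FinGroup 𝔾
  open Theory 𝔾
  open GroupSolver group using (solve; _⊜_; _⊕_; _⁻; e)
  open GroupProperties group using (⁻¹-involutive)
  open Sub using (size; mem?)

  record Transversal (H : Sub 𝔾) : Set₁ where
    open Cosets H
    field
      T         : Pred (Fin n) 0ℓ
      ⁻¹-closed : ∀ {t} → T t → T (t ⁻¹)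
      rep       : Fin n → Fin n
      rep∈      : ∀ g → T (rep g)
      ∼rep      : ∀ g → g ∼ rep g
      unique    : ∀ {g t} → T t → g ∼ t → t ≡ rep g

  module Normalising (Q : Sub 𝔾) where
    Normalises : Fin n → Set
    Normalises g = ∀ b → (Q ∋ (g ∙ b ∙ g ⁻¹) → Q ∋ b) × (Q ∋ b → Q ∋ (g ∙ b ∙ g ⁻¹))

    normalises-⁻¹ : ∀ {g} → Normalises g → Normalises (g ⁻¹)
    normalises-⁻¹ {g} N b =
      (λ q → subst (Q ∋_) (eq g b) (proj₂ (N _) q)) ,
      (λ q → proj₁ (N _) (subst (Q ∋_) (sym (eq g b)) q))
      where
      eq : ∀ g b → g ∙ (g ⁻¹ ∙ b ∙ g ⁻¹ ⁻¹) ∙ g ⁻¹ ≡ b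
      eq = solve 2 (λ g b → g ⊕ (g ⁻ ⊕ b ⊕ g ⁻ ⁻) ⊕ g ⁻ ⊜ b) refl

    conj⁻¹∈ : ∀ {g q} → Normalises g → Q ∋ q → Q ∋ (g ⁻¹ ∙ q ∙ g)
    conj⁻¹∈ {g} {q} N q∈ = subst (λ x → Q ∋ (g ⁻¹ ∙ q ∙ x)) (⁻¹-involutive g) (proj₂ (normalises-⁻¹ N q) q∈)

    member-normalises : ∀ {q} → Q ∋ q → Normalises q
    member-normalises {q} q∈ b =
      (λ u → subst (Q ∋_) (solve 2 (λ q b → q ⁻ ⊕ (q ⊕ b ⊕ q ⁻) ⊕ q ⊜ b) refl q b) (∙∈ (∙∈ (⁻¹∈ q∈) u) q∈)) ,
      (λ u → ∙∈ (∙∈ q∈ u) (⁻¹∈ q∈))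
      where open Sub Q using (∙∈; ⁻¹∈)

    open DoubleCosets Q Q using (Fixed)

    -- Fixing aQ only gives a⁻¹Qa ⊆ Q; the reverse inclusion is finiteness, since conjugation
    -- preserves size.
    fixed⇒normalises : ∀ {a} → Fixed a → Normalises a
    fixed⇒normalises {a} fix b =
      (λ q → subst (Q ∋_) (solve 2 (λ a b → a ⁻ ⊕ (a ⊕ b ⊕ a ⁻ ⊕ a) ⊜ b) refl a b) (fix _ q)) ,
      (λ q → count-⊆-≥ (mem? Q) (λ b → mem? Q (a ⁻¹ ∙ (b ∙ a))) fix
        (ℕ.≤-reflexive (trans (count-∙ʳ (λ b → mem? Q (a ⁻¹ ∙ b)) a) (count-∙ˡ (mem? Q) (a ⁻¹)))) _
        (subst (Q ∋_) (solve 2 (λ a b → b ⊜ a ⁻ ⊕ (a ⊕ b ⊕ a ⁻ ⊕ a)) refl a b) q))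

    normalises⇒fixed : ∀ {a} → Normalises a → Fixed a
    normalises⇒fixed {a} N s s∈ = subst (Q ∋_) (assoc _ _ _) (conj⁻¹∈ N s∈)

  module _ (H Q N₂ : Sub 𝔾) (Q⊆H : ∀ {x} → Q ∋ x → H ∋ x)
           (|Q|∣|H| : size Q ∣ size H) (odd-index : ¬ 2 * size Q ∣ size H) where
    open Normalising Q

    LiftsInvolutions : Set
    LiftsInvolutions = ∀ x → N₂ ∋ x → Q ∋ (x ∙ x) → ∃[ q ] Q ∋ q × (x ∙ q) ∙ (x ∙ q) ≡ ε

    private
      module H = Sub H
      module Q = Sub Q
      module ~H = Cosets H
      module ~Q = Cosets Q

    -- For g in H write the representative of gxH as gxh; then gQ ↦ h⁻¹Q is an
    -- involution of the odd set H/Q, and a fixed coset makes the representative an involution.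
    transversal⇒lifts : (∀ {x} → N₂ ∋ x → Normalises x) → Transversal H → LiftsInvolutions
    transversal⇒lifts N₂⊆N tr x x∈N₂ x²∈Q
      with ~Q.involution-fixes-coset (mem? H) (λ {a} {b} a∈ u → ~H.∼-⊆ {a} {b} a∈ (Q⊆H u)) σ (λ {g} → σ-closed g) σ-cong σ-inv odd-index
      where
      open Transversal tr
      σ : Fin n → Fin n
      σ g = rep (g ∙ x) ⁻¹ ∙ (g ∙ x)
      σ-closed : ∀ g → H ∋ g → H ∋ σ g
      σ-closed g _ = ~H.∼-sym (∼rep (g ∙ x))
      σ-cong : ∀ {g g′} → H ∋ g → g ~Q.∼ g′ → σ g ~Q.∼ σ g′
      σ-cong {g} {g′} g∈ u = subst (λ t → Q ∋ ((rep (g ∙ x) ⁻¹ ∙ (g ∙ x)) ⁻¹ ∙ (t ⁻¹ ∙ (g′ ∙ x))))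
        (sym (unique (rep∈ (g′ ∙ x)) (~H.∼-trans (Q⊆H gx∼g′x) (∼rep (g′ ∙ x)))))
        (subst (Q ∋_) (solve 4 (λ g g′ x t → (g ⊕ x) ⁻ ⊕ (g′ ⊕ x) ⊜ (t ⁻ ⊕ (g ⊕ x)) ⁻ ⊕ (t ⁻ ⊕ (g′ ⊕ x))) refl g g′ x
          (rep (g ∙ x))) gx∼g′x)
        where
        gx∼g′x : g ∙ x ~Q.∼ g′ ∙ x
        gx∼g′x = subst (Q ∋_) (solve 3 (λ g g′ x → x ⁻ ⊕ (g ⁻ ⊕ g′) ⊕ x ⊜ (g ⊕ x) ⁻ ⊕ (g′ ⊕ x)) refl g g′ x)
          (conj⁻¹∈ (N₂⊆N x∈N₂) u)
      -- Let t represent gxH. As gx² ∈ H and `T` is inverse-closed, t⁻¹ represents the coset of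
      -- σ(g)x = t⁻¹gx². Hence σ(σ(g)) = gx², which lies in gQ.
      σ-inv : ∀ {g} → H ∋ g → g ~Q.∼ σ (σ g)
      σ-inv {g} g∈ = subst (λ t → Q ∋ (g ⁻¹ ∙ (t ⁻¹ ∙ (σ g ∙ x))))
        (unique (⁻¹-closed (rep∈ (g ∙ x))) (subst (H ∋_)
          (solve 3 (λ g x t → (g ⊕ (x ⊕ x)) ⁻ ⊜ (t ⁻ ⊕ (g ⊕ x) ⊕ x) ⁻ ⊕ t ⁻) refl g x (rep (g ∙ x)))
          (H.⁻¹∈ (H.∙∈ g∈ (Q⊆H x²∈Q)))))
        (subst (Q ∋_) (solve 3 (λ g x t → x ⊕ x ⊜ g ⁻ ⊕ (t ⁻ ⁻ ⊕ (t ⁻ ⊕ (g ⊕ x) ⊕ x))) refl g x (rep (g ∙ x))) x²∈Q)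
    ... | g , g∈ , u = q ⁻¹ , Q.⁻¹∈ u , (begin
        (x ∙ q ⁻¹) ∙ (x ∙ q ⁻¹)
          ≡⟨ solve 3 (λ g x t → (x ⊕ (g ⁻ ⊕ (t ⁻ ⊕ (g ⊕ x))) ⁻) ⊕ (x ⊕ (g ⁻ ⊕ (t ⁻ ⊕ (g ⊕ x))) ⁻) ⊜ g ⁻ ⊕
            (t ⊕ t) ⊕ g) refl g x t ⟩
        g ⁻¹ ∙ (t ∙ t) ∙ g            ≡⟨ cong (λ s → g ⁻¹ ∙ (t ∙ s) ∙ g) (sym t⁻¹≡t) ⟩
        g ⁻¹ ∙ (t ∙ t ⁻¹) ∙ g         ≡⟨ solve 2 (λ g t → g ⁻ ⊕ (t ⊕ t ⁻) ⊕ g ⊜ e) refl g t ⟩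
        ε                             ∎)
      where
      open ≡-Reasoning
      open Transversal tr
      t = rep (g ∙ x)
      q = g ⁻¹ ∙ (t ⁻¹ ∙ (g ∙ x))
      -- For σ(g) = gq the element t⁻¹ = gqx⁻¹g⁻¹ lies in gxH, because x normalises Q and x² ∈ Q. So
      -- t⁻¹ and t represent the same coset, and xq⁻¹ = g⁻¹tg squares to 1.
      t⁻¹≡t : t ⁻¹ ≡ t
      t⁻¹≡t = unique (⁻¹-closed (rep∈ (g ∙ x))) (subst (H ∋_)
        (solve 3 (λ g x t → (x ⁻ ⊕ (g ⁻ ⊕ (t ⁻ ⊕ (g ⊕ x))) ⊕ x) ⊕ (x ⊕ x) ⁻ ⊕ g ⁻ ⊜ (g ⊕ x) ⁻ ⊕ t ⁻) refl g x t)
        (H.∙∈ (Q⊆H (Q.∙∈ (conj⁻¹∈ (N₂⊆N x∈N₂) u) (Q.⁻¹∈ x²∈Q))) (H.⁻¹∈ g∈)))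

    open DoubleCosets H H using (_≋_; _≋?_; ≋-trans; ∼⇒≋)
    open Inversion H using (≋-⁻¹)
    private
      module DQ = DoubleCosets Q Q

    module _ {k} (|Q|≡2^k : size Q ≡ 2 ^ k) (N : Sub 𝔾)
             (N⇒ : ∀ {x} → N ∋ x → Normalises x) (⇒N : ∀ {x} → Normalises x → N ∋ x)
             (N₂⊆N : ∀ {x} → N₂ ∋ x → N ∋ x) (odd-index-N : ¬ 2 * size N₂ ∣ size N) where

      -- Q is a normal 2-subgroup of its normaliser, so it lies in every Sylow 2-subgroup of it:
      -- among the odd number of cosets of N₂ in N, Q fixes some aN₂, whence Q = a⁻¹Qa ≤ N₂.
      Q⊆N₂ : ∀ {q} → Q ∋ q → N₂ ∋ q
      Q⊆N₂ {q} q∈ with any? (λ a → mem? N a ×-dec fixed? a)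
        where open DoubleCosets Q N₂
      ... | no ∄a = contradiction (subst (2 * size N₂ ∣_) (sym (count-none _ (λ a p → ∄a (a , p)))) (_ ∣0))
          (fixed-odd {k = k} |Q|≡2^k (mem? N) closed odd-index-N)
        where
        open DoubleCosets Q N₂ using (fixed-odd) renaming (_≋_ to _≋′_)
        closed : ∀ {a b} → N ∋ a → a ≋′ b → N ∋ b
        closed {a} {b} a∈ (s , s∈ , u) = subst (N ∋_) (solve 3 (λ a b s → s ⁻ ⊕ a ⊕ (a ⁻ ⊕ (s ⊕ b)) ⊜ b) refl a b s)
          (Sub.∙∈ N (Sub.∙∈ N (Sub.⁻¹∈ N (⇒N (member-normalises s∈))) a∈) (N₂⊆N u))
      ... | yes (a , a∈ , fix) = subst (N₂ ∋_) (solve 2 (λ a q → a ⁻ ⊕ (a ⊕ q ⊕ a ⁻ ⊕ a) ⊜ q) refl a q)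
        (fix _ (proj₂ (N⇒ a∈ q) q∈))

      -- Inversion permutes the odd number of cosets aQ in HxH with a normalising Q;
      -- a fixed one contains an element whose square lies in Q, and this is conjugate into N₂.
      lifts⇒involution : LiftsInvolutions → ∀ {x} → x ≋ x ⁻¹ → ¬ 2 * size H ∣ count (x ≋?_) →
                         ∃[ t ] x ≋ t × t ∙ t ≡ ε
      lifts⇒involution lifts {x} x≋x⁻¹ odd
        with ~Q.involution-fixes-coset (λ a → x ≋? a ×-dec DQ.fixed? a)
               (λ (r , fix) u → ≋-trans r (Q≋⇒≋ (DQ.∼⇒≋ u)) , DQ.fixed-resp fix (DQ.∼⇒≋ u))
               _⁻¹ (λ {a} (r , fix) → ≋-trans x≋x⁻¹ (≋-⁻¹ r) , normalises⇒fixed (normalises-⁻¹ (fixed⇒normalises fix)))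
               (λ {a} {b} (_ , fix) u → Q-resp (solve 2 (λ a b → (a ⊕ (a ⁻ ⊕ b) ⊕ a ⁻) ⁻ ⊜ a ⁻ ⁻ ⊕ b ⁻) refl a b) (Q.⁻¹∈ (proj₂ (fixed⇒normalises fix _) u)))
               (λ {a} _ → Q-resp (solve 1 (λ a → e ⊜ a ⁻ ⊕ a ⁻ ⁻) refl a) Q.ε∈)
               (DQ.fixed-odd {k = k} |Q|≡2^k (x ≋?_) (λ r s → ≋-trans r (Q≋⇒≋ s)) odd′)
        where
        Q-resp : ∀ {a b} → a ≡ b → Q ∋ a → Q ∋ b
        Q-resp = subst (Q ∋_)
        Q≋⇒≋ : ∀ {a b} → a DQ.≋ b → a ≋ b
        Q≋⇒≋ (s , s∈ , u) = s , Q⊆H s∈ , Q⊆H u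
        instance _ = size-pos Q
        odd′ : ¬ 2 * size Q ∣ count (x ≋?_)
        odd′ = even-multiple |Q|∣|H| odd-index (~H.lagrange (x ≋?_) (λ r u → ≋-trans r (∼⇒≋ u))) odd
      ... | a , (x≋a , fix) , a⁻²∈Q
        -- Since a² ∈ Q ≤ N₂ and Q is normal in N, multiplication by `a` is an involution on the odd
        -- set N/N₂. A fixed coset bN₂ gives b⁻¹ab ∈ N₂, to which the lifting hypothesis applies.
        with Cosets.involution-fixes-coset N₂ (mem? N) (λ {b} {c} b∈ u → Cosets.∼-⊆ N {b} {c} b∈ (N₂⊆N u)) (a ∙_)
               (λ b∈ → Sub.∙∈ N (⇒N (fixed⇒normalises fix)) b∈) (λ {b} {c} _ u → Cosets.∼-∙ˡ N₂ a {b} {c} u)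
               (λ {b} b∈ → Q⊆N₂ (subst (Q ∋_) (solve 2 (λ a b → b ⁻ ⊕ (a ⁻ ⊕ a ⁻) ⁻ ⊕ b ⊜ b ⁻ ⊕ (a ⊕ (a ⊕ b))) refl a b)
                  (conj⁻¹∈ (N⇒ b∈) (Q.⁻¹∈ a⁻²∈Q))))
               odd-index-N
      ... | b , b∈ , a′∈
        with lifts _ a′∈ (subst (Q ∋_)
          (solve 2 (λ a b → b ⁻ ⊕ (a ⁻ ⊕ a ⁻) ⁻ ⊕ b ⊜ (b ⁻ ⊕ (a ⊕ b)) ⊕ (b ⁻ ⊕ (a ⊕ b))) refl a b)
            (conj⁻¹∈ (N⇒ b∈) (Q.⁻¹∈ a⁻²∈Q)))
      -- Conjugating b⁻¹abq back by b gives a(bqb⁻¹), which stays in aQ and so in HxH because b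
      -- normalises Q.
      ... | q , q∈ , sq = a ∙ (b ∙ q ∙ b ⁻¹) , ≋-trans x≋a (∼⇒≋ (~H.∼-∙ʳ a (Q⊆H (proj₂ (N⇒ b∈ q) q∈)))) ,
        trans (solve 3 (λ a b q → a ⊕ (b ⊕ q ⊕ b ⁻) ⊕ (a ⊕ (b ⊕ q ⊕ b ⁻)) ⊜ b ⊕
          (b ⁻ ⊕ (a ⊕ b) ⊕ q ⊕ (b ⁻ ⊕ (a ⊕ b) ⊕ q)) ⊕ b ⁻) refl a b q)
          (trans (cong (λ y → b ∙ y ∙ b ⁻¹) sq) (solve 1 (λ b → b ⊕ e ⊕ b ⁻ ⊜ e) refl b))

-- Matching the left cosets

module Matchings {n : ℕ} (𝔾 : FinGroup n) (H : Sub 𝔾) where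
  open FinGroup 𝔾
  open Theory 𝔾
  open GroupSolver group using (solve; _⊜_; _⊕_; _⁻; e)
  open GroupProperties group using (⁻¹-involutive; inverseʳ-unique)
  open Sub using (size; mem?)
  open Cosets H
  open DoubleCosets H H using (_≋_; _≋?_; ≋-refl; ≋-sym; ≋-trans; ∼⇒≋)
  open Inversion H
  private
    module H = Sub H

  -- An inverse-closed system of representatives of the left cosets inside `P`. For `P` the
  -- complement of H, `S` becomes the connection set, hence the decidability.
  record Matching (P : Pred (Fin n) 0ℓ) : Set₁ where
    field
      S         : Pred (Fin n) 0ℓ
      S?        : Decidable S
      S⊆P       : ∀ {s} → S s → P s
      ⁻¹-closed : ∀ {s} → S s → S (s ⁻¹)
      rep       : ∀ {a} → P a → ∃[ s ] S s × a ∼ s × (∀ {s′} → S s′ → a ∼ s′ → s′ ≡ s)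

  Closed : Pred (Fin n) 0ℓ → Set
  Closed P = ∀ {a b} → P a → a ∼ b → P b

  _∖_ : {P : Pred (Fin n) 0ℓ} (P? : Decidable P) (a : Fin n) → Decidable (λ x → P x × ¬ a ∼ x)
  (P? ∖ a) x = P? x ×-dec ¬? (a ∼? x)

  ∖-closed : ∀ {P a} → Closed P → Closed (λ x → P x × ¬ a ∼ x)
  ∖-closed closed (p , ¬u) v = closed p v , λ u → ¬u (∼-trans u (∼-sym v))

  count-∖ : (P? : Decidable P) (D? : Decidable Q) → Closed P → Closed Q → ∀ {a} → P a →
            count (λ x → P? x ×-dec D? x) ≡ count (λ x → (P? ∖ a) x ×-dec D? x) + size H * 𝟙 (D? a)
  count-∖ {P = P} {Q = D} P? D? P-closed D-closed {a} p with D? a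
  ... | yes d = trans (count-⊎ PD? P∖D? (a ∼?_) split (λ _ ((p , _) , d) → p , d) (λ _ u → P-closed p u , D-closed d u)
                        (λ _ ((_ , ¬u) , _) → ¬u))
                      (cong (count P∖D? +_) (trans (count-coset a) (sym (ℕ.*-identityʳ (size H)))))
    where
    PD? = λ x → P? x ×-dec D? x
    P∖D? = λ x → (P? ∖ a) x ×-dec D? x
    split : ∀ x → P x × D x → ((P x × ¬ a ∼ x) × D x) ⊎ a ∼ x
    split x (p , d) with a ∼? x
    ... | yes u = inj₂ u
    ... | no ¬u = inj₁ ((p , ¬u) , d)
  ... | no ¬d = trans (count-cong (λ x → P? x ×-dec D? x) P∖D?
                        (λ _ (p , d) → (p , (λ u → ¬d (D-closed d (∼-sym u)))) , d) (λ _ ((p , _) , d) → p , d))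
                      (sym (trans (cong (count P∖D? +_) (ℕ.*-zeroʳ (size H))) (ℕ.+-identityʳ _)))
    where
    P∖D? = λ x → (P? ∖ a) x ×-dec D? x

  ∣_∩_∣ : {P : Pred (Fin n) 0ℓ} → Decidable P → Fin n → ℕ
  ∣ P? ∩ a ∣ = count (λ b → P? b ×-dec a ≋? b)

  -- Invariant of the greedy matching: HaH and Ha⁻¹H keep equally many unmatched left cosets.
  Balanced : {P : Pred (Fin n) 0ℓ} → Decidable P → Set
  Balanced {P} P? = ∀ {a} → P a → ∣ P? ∩ a ∣ ≡ ∣ P? ∩ a ⁻¹ ∣

  -- A double coset HaH = Ha⁻¹H without involutions must contain an even number of left cosets.
  EvenIfNoInvolution : {P : Pred (Fin n) 0ℓ} → Decidable P → Set
  EvenIfNoInvolution {P} P? = ∀ {a} → P a → a ≋ a ⁻¹ → (∀ t → a ≋ t → ¬ t ∙ t ≡ ε) → 2 * size H ∣ ∣ P? ∩ a ∣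

  ≋-∼-closed : ∀ c → Closed (c ≋_)
  ≋-∼-closed c r u = ≋-trans r (∼⇒≋ u)

  -- Covers both moves: two cosets represented by t and t⁻¹, or a single coset (b = a) represented
  -- by a self-inverse t. The assumption a ∼ b → t ≡ t⁻¹ keeps a coset from receiving two
  -- representatives.
  extend : ∀ {P′ : Pred (Fin n) 0ℓ} → Closed P → ∀ {a b t} → P a → P b → a ∼ t → b ∼ t ⁻¹ → (a ∼ b → t ≡ t ⁻¹) →
           (∀ {x} → P′ x → P x × ¬ a ∼ x × ¬ b ∼ x) → (∀ {x} → P x → a ∼ x ⊎ b ∼ x ⊎ P′ x) →
           Matching P′ → Matching P
  extend {P} {P′} closed {a} {b} {t} pa pb a∼t b∼t⁻¹ loop P′⇒ P⇒ M = record
    { S         = λ s → M.S s ⊎ s ≡ t ⊎ s ≡ t ⁻¹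
    ; S?        = λ s → M.S? s ⊎-dec (s ≟ t ⊎-dec s ≟ t ⁻¹)
    ; S⊆P       = λ { (inj₁ s) → proj₁ (P′⇒ (M.S⊆P s)) ; (inj₂ (inj₁ refl)) → closed pa a∼t ; (inj₂ (inj₂ refl)) → closed pb b∼t⁻¹ }
    ; ⁻¹-closed = λ { (inj₁ s) → inj₁ (M.⁻¹-closed s) ; (inj₂ (inj₁ refl)) → inj₂ (inj₂ refl)
                    ; (inj₂ (inj₂ refl)) → inj₂ (inj₁ (⁻¹-involutive t)) }
    ; rep       = λ p → rep (P⇒ p)
    }
    where
    module M = Matching M
    S = λ s → M.S s ⊎ s ≡ t ⊎ s ≡ t ⁻¹
    rep : ∀ {x} → a ∼ x ⊎ b ∼ x ⊎ P′ x → ∃[ s ] S s × x ∼ s × (∀ {s′} → S s′ → x ∼ s′ → s′ ≡ s)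
    rep (inj₁ u) = t , inj₂ (inj₁ refl) , ∼-trans (∼-sym u) a∼t , λ
      { (inj₁ s) v → contradiction (∼-trans u v) (proj₁ (proj₂ (P′⇒ (M.S⊆P s))))
      ; (inj₂ (inj₁ refl)) v → refl
      ; (inj₂ (inj₂ refl)) v → sym (loop (∼-trans (∼-trans u v) (∼-sym b∼t⁻¹))) }
    rep (inj₂ (inj₁ u)) = t ⁻¹ , inj₂ (inj₂ refl) , ∼-trans (∼-sym u) b∼t⁻¹ , λ
      { (inj₁ s) v → contradiction (∼-trans u v) (proj₂ (proj₂ (P′⇒ (M.S⊆P s))))
      ; (inj₂ (inj₁ refl)) v → loop (∼-sym (∼-trans (∼-trans u v) (∼-sym a∼t)))
      ; (inj₂ (inj₂ refl)) v → refl }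
    rep (inj₂ (inj₂ p′)) with M.rep p′ | P′⇒ p′
    ... | s , s∈ , u , uniq | _ , ¬a , ¬b = s , inj₁ s∈ , u , λ
      { (inj₁ s′) v → uniq s′ v
      ; (inj₂ (inj₁ refl)) v → contradiction (∼-trans a∼t (∼-sym v)) ¬a
      ; (inj₂ (inj₂ refl)) v → contradiction (∼-trans b∼t⁻¹ (∼-sym v)) ¬b }

  private
    -- Greedy induction on the number of unmatched elements: aH is paired with any other unmatched
    -- coset in Ha⁻¹H, and if there is none, aH is matched with itself.
    match-acc : (P? : Decidable P) → Closed P → Balanced P? → EvenIfNoInvolution P? → Acc _<_ (count P?) → Matching P
    match-acc {P} P? closed balanced even (acc rs) with any? P?
    ... | no ∄p = record { S = λ _ → ⊥ ; S? = λ _ → no λ () ; S⊆P = λ () ; ⁻¹-closed = λ ()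
                         ; rep = λ p → contradiction (_ , p) ∄p }
    ... | yes (a , p) with any? (λ b → (P? b ×-dec a ⁻¹ ≋? b) ×-dec ¬? (a ∼? b))
    ... | yes (b , (q , (h , h∈ , u)) , ¬a∼b) = extend closed {t = t} p q a∼t b∼t⁻¹ (λ v → contradiction v ¬a∼b)
            (λ ((p , ¬a) , ¬b) → p , ¬a , ¬b) split
            (match-acc P″? closed″ balanced″ even″ (rs (count-decreases)))
      where
      P′? = P? ∖ a
      P″? = P′? ∖ b
      -- `h` comes with ahb ∈ H, which puts t⁻¹ = (ah)⁻¹ into bH.
      t = a ∙ h
      a∼t : a ∼ t
      a∼t = ∼-∙ʳ a h∈
      b∼t⁻¹ : b ∼ t ⁻¹
      b∼t⁻¹ = subst (H ∋_) (solve 3 (λ a b h → (a ⁻ ⁻ ⊕ (h ⊕ b)) ⁻ ⊜ b ⁻ ⊕ (a ⊕ h) ⁻) refl a b h) (H.⁻¹∈ u)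
      split : ∀ {x} → P x → a ∼ x ⊎ b ∼ x ⊎ ((P x × ¬ a ∼ x) × ¬ b ∼ x)
      split {x} p with a ∼? x | b ∼? x
      ... | yes u | _     = inj₁ u
      ... | no  _ | yes v = inj₂ (inj₁ v)
      ... | no ¬u | no ¬v = inj₂ (inj₂ ((p , ¬u) , ¬v))
      closed′ = ∖-closed {a = a} closed
      closed″ = ∖-closed {a = b} closed′
      a⁻¹≋b : a ⁻¹ ≋ b
      a⁻¹≋b = h , h∈ , u
      count-P : ∀ c → ∣ P? ∩ c ∣ ≡ ∣ P″? ∩ c ∣ + (size H * 𝟙 (c ≋? b) + size H * 𝟙 (c ≋? a))
      count-P c = trans (count-∖ P? (c ≋?_) closed (≋-∼-closed c) p)
        (trans (cong (_+ size H * 𝟙 (c ≋? a)) (count-∖ P′? (c ≋?_) closed′ (≋-∼-closed c) (q , ¬a∼b)))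
               (ℕ.+-assoc ∣ P″? ∩ c ∣ _ _))
      count-decreases : count P″? < count P?
      count-decreases = ℕ.≤-<-trans (count-mono P″? P′? (λ _ → proj₁))
        (subst (count P′? <_) (sym (count-split P? (a ∼?_)))
        (ℕ.m<n+m (count P′?) (count-pos (λ x → P? x ×-dec a ∼? x) (p , ∼-refl))))
      b⇔a : ∀ c → 𝟙 (c ≋? b) ≡ 𝟙 (c ⁻¹ ≋? a)
      b⇔a c = 𝟙-cong _ _
        (λ r → ≋-trans (≋-⁻¹ r) (≋-sym (≋-flip a⁻¹≋b)))
        (λ r → ≋-trans (≋-flip r) a⁻¹≋b)
      a⇔b : ∀ c → 𝟙 (c ≋? a) ≡ 𝟙 (c ⁻¹ ≋? b)
      a⇔b c = 𝟙-cong _ _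
        (λ r → ≋-trans (≋-⁻¹ r) a⁻¹≋b)
        (λ r → ≋-trans (≋-flip r) (≋-sym (≋-flip a⁻¹≋b)))
      balanced″ : Balanced P″?
      balanced″ {c} ((pc , _) , _) = ℕ.+-cancelʳ-≡ (size H * 𝟙 (c ≋? b) + size H * 𝟙 (c ≋? a)) _ _ (begin
        ∣ P″? ∩ c ∣ + (size H * 𝟙 (c ≋? b) + size H * 𝟙 (c ≋? a))            ≡⟨ count-P c ⟨
        ∣ P? ∩ c ∣                                                           ≡⟨ balanced pc ⟩
        ∣ P? ∩ c ⁻¹ ∣                                                        ≡⟨ count-P (c ⁻¹) ⟩
        ∣ P″? ∩ c ⁻¹ ∣ + (size H * 𝟙 (c ⁻¹ ≋? b) + size H * 𝟙 (c ⁻¹ ≋? a))   ≡⟨ cong (∣ P″? ∩ c ⁻¹ ∣ +_) (trans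
                (cong₂ (λ i j → size H * i + size H * j) (sym (a⇔b c)) (sym (b⇔a c)))
                  (ℕ.+-comm (size H * 𝟙 (c ≋? a)) _)) ⟩
        ∣ P″? ∩ c ⁻¹ ∣ + (size H * 𝟙 (c ≋? b) + size H * 𝟙 (c ≋? a))         ∎)
        where open ≡-Reasoning
      -- As b ∈ Ha⁻¹H, a self-inverse HcH contains both of aH and bH or neither, so it loses two
      -- cosets or none.
      even″ : EvenIfNoInvolution P″?
      even″ {c} ((pc , _) , _) r noInv = ∣m+n∣m⇒∣n (subst (2 * size H ∣_)
        (trans (count-P c) (ℕ.+-comm ∣ P″? ∩ c ∣ _)) (even pc r noInv))
        (subst (2 * size H ∣_) (sym (begin
          size H * 𝟙 (c ≋? b) + size H * 𝟙 (c ≋? a)     ≡⟨ cong (λ i → size H * i + size H * 𝟙 (c ≋? a)) b≡a ⟩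
          size H * 𝟙 (c ≋? a) + size H * 𝟙 (c ≋? a)     ≡⟨ cong (size H * 𝟙 (c ≋? a) +_) (ℕ.+-identityʳ _) ⟨
          2 * (size H * 𝟙 (c ≋? a))                     ≡⟨ ℕ.*-assoc 2 (size H) _ ⟨
          2 * size H * 𝟙 (c ≋? a)                       ∎)) (m∣m*n (𝟙 (c ≋? a))))
        where
        open ≡-Reasoning
        b≡a : 𝟙 (c ≋? b) ≡ 𝟙 (c ≋? a)
        b≡a = trans (b⇔a c) (𝟙-cong _ _ (≋-trans r) (≋-trans (≋-sym r)))
    ... | no ¬b = extend closed {t = t} p p a∼t (subst (a ∼_) (sym t⁻¹≡t) a∼t) (λ _ → sym t⁻¹≡t)
      (λ (p , ¬a) → p , ¬a , ¬a) split
            (match-acc P′? (∖-closed {a = a} closed) balanced′ even′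
              (rs (subst (count P′? <_) (sym (count-split P? (a ∼?_)))
                (ℕ.m<n+m (count P′?) (count-pos (λ x → P? x ×-dec a ∼? x) (p , ∼-refl))))))
      where
      P′? = P? ∖ a
      -- No coset of Ha⁻¹H other than aH is unmatched, while balance leaves at least one. Hence HaH
      -- = Ha⁻¹H has aH as its only unmatched coset; one is odd, so the evenness assumption yields
      -- an involution.
      single : ∀ {b} → P b → a ⁻¹ ≋ b → a ∼ b
      single {b} q r = decidable-stable (a ∼? b) λ ¬u → ¬b (b , (q , r) , ¬u)
      partner : ∃[ b ] P b × a ⁻¹ ≋ b
      partner = count-witness (λ b → P? b ×-dec a ⁻¹ ≋? b) λ eq → ℕ.1+n≰n {0}
        (subst (1 ≤ⁿ_) (trans (balanced p) eq) (count-pos (λ b → P? b ×-dec a ≋? b) (p , ≋-refl)))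
      a≋a⁻¹ : a ≋ a ⁻¹
      a≋a⁻¹ with partner
      ... | b , q , r = ≋-trans (∼⇒≋ (single q r)) (≋-sym r)
      class : ∣ P? ∩ a ∣ ≡ size H
      class = trans (count-cong _ (a ∼?_) (λ b (q , r) → single q (≋-trans (≋-sym a≋a⁻¹) r))
        (λ b u → closed p u , ∼⇒≋ u)) (count-coset a)
      involution : ∃[ t ] a ≋ t × t ∙ t ≡ ε
      involution with any? (λ t → a ≋? t ×-dec (t ∙ t) ≟ ε)
      ... | yes w = w
      ... | no ∄t = contradiction (∣⇒≤ (subst (2 * size H ∣_) class (even p a≋a⁻¹ λ t r sq → ∄t (t , r , sq))))
          (ℕ.<⇒≱ (ℕ.m<m+n (size H) (subst (0 <_) (sym (ℕ.+-identityʳ (size H))) (>-nonZero⁻¹ (size H)))))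
        where instance _ = size-pos H
      -- For an involution t in HaH some s in H has st ∈ aH; the conjugate sts⁻¹ then lies in aH
      -- itself.
      in-coset : ∃[ t ] a ∼ t × t ∙ t ≡ ε
      in-coset with involution
      ... | t , (s , s∈ , u) , sq = s ∙ t ∙ s ⁻¹ ,
        subst (H ∋_) (solve 3 (λ a s t → a ⁻ ⊕ (s ⊕ t) ⊕ s ⁻ ⊜ a ⁻ ⊕ (s ⊕ t ⊕ s ⁻)) refl a s t) (H.∙∈ u (H.⁻¹∈ s∈)) ,
        trans (solve 2 (λ s t → s ⊕ t ⊕ s ⁻ ⊕ (s ⊕ t ⊕ s ⁻) ⊜ s ⊕ (t ⊕ t) ⊕ s ⁻) refl s t)
          (trans (cong (λ y → s ∙ y ∙ s ⁻¹) sq) (solve 1 (λ s → s ⊕ e ⊕ s ⁻ ⊜ e) refl s))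
      t = proj₁ in-coset
      a∼t = proj₁ (proj₂ in-coset)
      t⁻¹≡t : t ⁻¹ ≡ t
      t⁻¹≡t = sym (inverseʳ-unique t t (proj₂ (proj₂ in-coset)))
      split : ∀ {x} → P x → a ∼ x ⊎ a ∼ x ⊎ (P x × ¬ a ∼ x)
      split {x} p with a ∼? x
      ... | yes u = inj₁ u
      ... | no ¬u = inj₂ (inj₂ (p , ¬u))
      far : ∀ {c} → P c → ¬ a ∼ c → ¬ c ≋ a
      far pc ¬u r = ¬u (single pc (≋-trans (≋-sym a≋a⁻¹) (≋-sym r)))
      far⁻¹ : ∀ {c} → P c → ¬ a ∼ c → ¬ c ⁻¹ ≋ a
      far⁻¹ pc ¬u r = ¬u (single pc (≋-sym (≋-flip r)))
      unchanged : ∀ {c} → ¬ c ≋ a → ∣ P? ∩ c ∣ ≡ ∣ P′? ∩ c ∣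
      unchanged {c} ¬r = trans (count-∖ P? (c ≋?_) closed (≋-∼-closed c) p)
        (trans (cong (λ i → ∣ P′? ∩ c ∣ + size H * i) (𝟙-no (c ≋? a) ¬r))
          (trans (cong (∣ P′? ∩ c ∣ +_) (ℕ.*-zeroʳ (size H))) (ℕ.+-identityʳ _)))
      balanced′ : Balanced P′?
      balanced′ (pc , ¬u) = trans (sym (unchanged (far pc ¬u))) (trans (balanced pc) (unchanged (far⁻¹ pc ¬u)))
      even′ : EvenIfNoInvolution P′?
      even′ (pc , ¬u) r noInv = subst (2 * size H ∣_) (unchanged (far pc ¬u)) (even pc r noInv)

  match : (P? : Decidable P) → Closed P → Balanced P? → EvenIfNoInvolution P? → Matching P
  match P? closed balanced even = match-acc P? closed balanced even (<-wellFounded _)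

  match-complement : (∀ {x} → x ≋ x ⁻¹ → ¬ 2 * size H ∣ count (x ≋?_) → ∃[ t ] x ≋ t × t ∙ t ≡ ε) →
                     Matching (λ x → ¬ H ∋ x)
  match-complement involution = match ∁H? (λ ¬a u b → ¬a (∼-⊆ b (∼-sym u))) balanced even
    where
    ∁H? : Decidable (λ x → ¬ H ∋ x)
    ∁H? x = ¬? (mem? H x)
    ∁-closed : ∀ {a b} → ¬ H ∋ a → a ≋ b → ¬ H ∋ b
    ∁-closed {a} {b} ¬a (h , h∈ , u) b∈ = ¬a (subst (H ∋_)
      (solve 3 (λ a b h → h ⊕ b ⊕ (a ⁻ ⊕ (h ⊕ b)) ⁻ ⊜ a) refl a b h) (H.∙∈ (H.∙∈ h∈ b∈) (H.⁻¹∈ u)))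
    ∩≡ : ∀ {a} → ¬ H ∋ a → ∣ ∁H? ∩ a ∣ ≡ count (a ≋?_)
    ∩≡ {a} ¬a = count-cong (λ b → ∁H? b ×-dec a ≋? b) (a ≋?_) (λ _ → proj₂) (λ _ r → ∁-closed ¬a r , r)
    balanced : Balanced ∁H?
    balanced {a} ¬a = begin
      ∣ ∁H? ∩ a ∣                  ≡⟨ ∩≡ ¬a ⟩
      count (a ≋?_)
        ≡⟨ count-cong (a ≋?_) (λ b → a ⁻¹ ≋? b ⁻¹) (λ _ → ≋-⁻¹) (λ b r → subst (a ≋_) (⁻¹-involutive b) (≋-flip r)) ⟩
      count (λ b → a ⁻¹ ≋? b ⁻¹)   ≡⟨ count-⁻¹ (a ⁻¹ ≋?_) ⟩
      count (a ⁻¹ ≋?_)             ≡⟨ ∩≡ (λ a⁻¹∈ → ¬a (subst (H ∋_) (⁻¹-involutive a) (H.⁻¹∈ a⁻¹∈))) ⟨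
      ∣ ∁H? ∩ a ⁻¹ ∣               ∎
      where open ≡-Reasoning
    even : EvenIfNoInvolution ∁H?
    even {a} ¬a r noInv = subst (2 * size H ∣_) (sym (∩≡ ¬a)) (decidable-stable (2 * size H ∣? count (a ≋?_))
      λ odd → let (t , s , sq) = involution r odd in noInv t s sq)

-- Extraspecial groups

xor-false⇒≡ : ∀ a b → a xor b ≡ false → a ≡ b
xor-false⇒≡ false b eq = sym eq
xor-false⇒≡ true true _ = refl

xor-interchange : ∀ a b a′ b′ → (a xor b) xor (a′ xor b′) ≡ (a xor a′) xor (b xor b′)
xor-interchange false b false b′ = refl
xor-interchange false b true  b′ = sym (not-distribʳ-xor b b′)
xor-interchange true  b false b′ = sym (not-distribˡ-xor b b′)
xor-interchange true  b true  b′ = xor-annihilates-not b b′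

record Extraspecial {n : ℕ} (𝔾 : FinGroup n) : Set where
  open FinGroup 𝔾
  field
    z         : Fin n
    z≢ε       : ¬ z ≡ ε
    z²≡ε      : z ∙ z ≡ ε
    z-central : ∀ x → z ∙ x ≡ x ∙ z
    central⇒Z : ∀ {x} → (∀ y → x ∙ y ≡ y ∙ x) → x ≡ ε ⊎ x ≡ z
    commute   : ∀ x y → x ∙ y ≡ y ∙ x ⊎ x ∙ y ≡ z ∙ (y ∙ x)
    square    : ∀ x → x ∙ x ≡ ε ⊎ x ∙ x ≡ z

module Quadratic {n : ℕ} (𝔾 : FinGroup n) (ext : Extraspecial 𝔾) where
  open FinGroup 𝔾
  open Extraspecial ext
  open Theory 𝔾
  open GroupSolver group using (solve; _⊜_; _⊕_)
  open GroupProperties group using (∙-cancelʳ; inverseʳ-unique)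
  open Sub using (size; mem?)

  z^ : Bool → Fin n
  z^ false = ε
  z^ true  = z

  z^-injective : ∀ a b → z^ a ≡ z^ b → a ≡ b
  z^-injective false false _  = refl
  z^-injective true  true  _  = refl
  z^-injective false true  eq = contradiction (sym eq) z≢ε
  z^-injective true  false eq = contradiction eq z≢ε

  z^-xor : ∀ a b → z^ (a xor b) ≡ z^ a ∙ z^ b
  z^-xor false b     = sym (identityˡ _)
  z^-xor true  false = sym (identityʳ _)
  z^-xor true  true  = sym z²≡ε

  z^-central : ∀ b x → z^ b ∙ x ≡ x ∙ z^ b
  z^-central false x = trans (identityˡ x) (sym (identityʳ x))
  z^-central true  x = z-central x

  z^-swap : ∀ b x y → x ∙ (z^ b ∙ y) ≡ z^ b ∙ (x ∙ y)
  z^-swap b x y = trans (sym (assoc _ _ _)) (trans (cong (_∙ y) (sym (z^-central b x))) (assoc _ _ _))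

  commutator : ∀ x y → ∃[ b ] x ∙ y ≡ z^ b ∙ (y ∙ x)
  commutator x y with commute x y
  ... | inj₁ eq = false , trans eq (sym (identityˡ _))
  ... | inj₂ eq = true , eq

  squaring : ∀ x → ∃[ b ] x ∙ x ≡ z^ b
  squaring x with square x
  ... | inj₁ eq = false , eq
  ... | inj₂ eq = true , eq

  -- The commutator form and the squaring form, with values in ⟨z⟩ written additively.
  c : Fin n → Fin n → Bool
  c x y = proj₁ (commutator x y)

  s : Fin n → Bool
  s x = proj₁ (squaring x)

  c-law : ∀ x y → x ∙ y ≡ z^ (c x y) ∙ (y ∙ x)
  c-law x y = proj₂ (commutator x y)

  s-law : ∀ x → x ∙ x ≡ z^ (s x)
  s-law x = proj₂ (squaring x)

  c-unique : ∀ {x y} b → x ∙ y ≡ z^ b ∙ (y ∙ x) → c x y ≡ b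
  c-unique {x} {y} b eq = z^-injective _ b (∙-cancelʳ (y ∙ x) _ _ (trans (sym (c-law x y)) eq))

  s-unique : ∀ {x} b → x ∙ x ≡ z^ b → s x ≡ b
  s-unique {x} b eq = z^-injective _ b (trans (sym (s-law x)) eq)

  c-commute : ∀ {x y} → x ∙ y ≡ y ∙ x → c x y ≡ false
  c-commute eq = c-unique false (trans eq (sym (identityˡ _)))

  commute-c : ∀ {x y} → c x y ≡ false → x ∙ y ≡ y ∙ x
  commute-c {x} {y} eq = trans (c-law x y) (trans (cong (λ b → z^ b ∙ (y ∙ x)) eq) (identityˡ _))

  c-sym : ∀ x y → c x y ≡ c y x
  c-sym x y = sym (c-unique (c x y) (begin
    y ∙ x                                  ≡⟨ identityˡ _ ⟨
    ε ∙ (y ∙ x)                            ≡⟨ cong (λ b → z^ b ∙ (y ∙ x)) (xor-same (c x y)) ⟨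
    z^ (c x y xor c x y) ∙ (y ∙ x)         ≡⟨ cong (_∙ (y ∙ x)) (z^-xor (c x y) (c x y)) ⟩
    z^ (c x y) ∙ z^ (c x y) ∙ (y ∙ x)      ≡⟨ assoc _ _ _ ⟩
    z^ (c x y) ∙ (z^ (c x y) ∙ (y ∙ x))    ≡⟨ cong (z^ (c x y) ∙_) (c-law x y) ⟨
    z^ (c x y) ∙ (x ∙ y)                   ∎))
    where open ≡-Reasoning

  c-∙ˡ : ∀ x y w → c (x ∙ y) w ≡ c x w xor c y w
  c-∙ˡ x y w = c-unique (c x w xor c y w) (begin
    x ∙ y ∙ w                                ≡⟨ assoc x y w ⟩
    x ∙ (y ∙ w)                              ≡⟨ cong (x ∙_) (c-law y w) ⟩
    x ∙ (z^ (c y w) ∙ (w ∙ y))               ≡⟨ z^-swap (c y w) x (w ∙ y) ⟩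
    z^ (c y w) ∙ (x ∙ (w ∙ y))               ≡⟨ cong (z^ (c y w) ∙_) (assoc x w y) ⟨
    z^ (c y w) ∙ (x ∙ w ∙ y)                 ≡⟨ cong (λ u → z^ (c y w) ∙ (u ∙ y)) (c-law x w) ⟩
    z^ (c y w) ∙ (z^ (c x w) ∙ (w ∙ x) ∙ y)
      ≡⟨ solve 5 (λ a b w x y → a ⊕ (b ⊕ (w ⊕ x) ⊕ y) ⊜ a ⊕ b ⊕ (w ⊕ (x ⊕ y))) refl (z^ (c y w)) (z^ (c x w)) w x y ⟩
    z^ (c y w) ∙ z^ (c x w) ∙ (w ∙ (x ∙ y))  ≡⟨ cong (_∙ (w ∙ (x ∙ y))) (z^-central (c y w) _) ⟩
    z^ (c x w) ∙ z^ (c y w) ∙ (w ∙ (x ∙ y))  ≡⟨ cong (_∙ (w ∙ (x ∙ y))) (z^-xor (c x w) (c y w)) ⟨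
    z^ (c x w xor c y w) ∙ (w ∙ (x ∙ y))     ∎)
    where open ≡-Reasoning

  c-∙ʳ : ∀ w x y → c w (x ∙ y) ≡ c w x xor c w y
  c-∙ʳ w x y = trans (c-sym w _) (trans (c-∙ˡ x y w) (cong₂ _xor_ (c-sym x w) (c-sym y w)))

  c-self : ∀ x → c x x ≡ false
  c-self x = c-commute refl

  c-εˡ : ∀ x → c ε x ≡ false
  c-εˡ x = c-commute (trans (identityˡ x) (sym (identityʳ x)))

  c-zˡ : ∀ x → c z x ≡ false
  c-zˡ x = c-commute (z-central x)

  s-ε : s ε ≡ false
  s-ε = s-unique false (identityˡ ε)

  s-z : s z ≡ false
  s-z = s-unique false z²≡ε

  s-∙ : ∀ x y → s (x ∙ y) ≡ (s x xor s y) xor c x y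
  s-∙ x y = s-unique _ (begin
    x ∙ y ∙ (x ∙ y)                          ≡⟨ solve 2 (λ x y → x ⊕ y ⊕ (x ⊕ y) ⊜ x ⊕ (y ⊕ x) ⊕ y) refl x y ⟩
    x ∙ (y ∙ x) ∙ y                          ≡⟨ cong (λ u → x ∙ u ∙ y) (c-law y x) ⟩
    x ∙ (z^ (c y x) ∙ (x ∙ y)) ∙ y           ≡⟨ cong (_∙ y) (z^-swap (c y x) x _) ⟩
    z^ (c y x) ∙ (x ∙ (x ∙ y)) ∙ y
      ≡⟨ solve 3 (λ a x y → a ⊕ (x ⊕ (x ⊕ y)) ⊕ y ⊜ a ⊕ ((x ⊕ x) ⊕ (y ⊕ y))) refl (z^ (c y x)) x y ⟩
    z^ (c y x) ∙ ((x ∙ x) ∙ (y ∙ y))         ≡⟨ cong₂ (λ u v → z^ (c y x) ∙ (u ∙ v)) (s-law x) (s-law y) ⟩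
    z^ (c y x) ∙ (z^ (s x) ∙ z^ (s y))       ≡⟨ cong₂ (λ b u → z^ b ∙ u) (c-sym y x) (sym (z^-xor (s x) (s y))) ⟩
    z^ (c x y) ∙ z^ (s x xor s y)            ≡⟨ z^-central (c x y) _ ⟩
    z^ (s x xor s y) ∙ z^ (c x y)            ≡⟨ z^-xor (s x xor s y) (c x y) ⟨
    z^ ((s x xor s y) xor c x y)             ∎)
    where open ≡-Reasoning

  central⇒false : ∀ {x} → x ≡ ε ⊎ x ≡ z → ∀ y → c y x ≡ false
  central⇒false (inj₁ refl) y = trans (c-sym y ε) (c-εˡ y)
  central⇒false (inj₂ refl) y = trans (c-sym y z) (c-zˡ y)

  nondegenerate : ∀ {x} → (∀ y → c x y ≡ false) → x ≡ ε ⊎ x ≡ z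
  nondegenerate h = central⇒Z (λ y → commute-c (h y))

  z∈? : ∀ x → Dec (x ≡ ε ⊎ x ≡ z)
  z∈? x = x ≟ ε ⊎-dec x ≟ z

  |Z|≡2 : count z∈? ≡ 2
  |Z|≡2 = trans (count-⊎ z∈? (_≟ ε) (_≟ z) (λ _ → id) (λ _ → inj₁) (λ _ → inj₂) (λ { _ refl eq → z≢ε (sym eq) }))
    (cong₂ _+_ (count-≟ ε) (count-≟ z))

  involution⇒⁻¹ : ∀ {x} → s x ≡ false → x ⁻¹ ≡ x
  involution⇒⁻¹ {x} eq = sym (inverseʳ-unique x x (trans (s-law x) (cong z^ eq)))

  Additive : Sub 𝔾 → (Fin n → Bool) → Set
  Additive Q χ = ∀ {x y} → Q ∋ x → Q ∋ y → χ (x ∙ y) ≡ χ x xor χ y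

  -- Translation by q₀ exchanges the two fibres of χ.
  half : (Q : Sub 𝔾) (χ : Fin n → Bool) → Additive Q χ → ∀ {q₀} → Q ∋ q₀ → χ q₀ ≡ true →
         ∀ b → 2 * count (λ q → mem? Q q ×-dec (χ q ≟ᵇ b)) ≡ size Q
  half Q χ hom {q₀} q₀∈ χq₀ b = begin
    2 * count Qb?            ≡⟨ cong (count Qb? +_) (ℕ.+-identityʳ (count Qb?)) ⟩
    count Qb? + count Qb?    ≡⟨ cong (count Qb? +_) (count-∙ˡ Qb? q₀) ⟨
    count Qb? + count (λ q → Qb? (q₀ ∙ q))  ≡⟨ cong (count Qb? +_) (count-cong (λ q → Qb? (q₀ ∙ q)) _
      (λ q (q₀q∈ , eq) → let q∈ = subst (Q ∋_) (x⁻¹∙xy q₀ q) (Sub.∙∈ Q (Sub.⁻¹∈ Q q₀∈) q₀q∈) in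
         q∈ , λ eq′ → not-¬ (sym eq′) (trans (sym eq) (trans (hom q₀∈ q∈) (cong (_xor χ q) χq₀))))
      (λ q (q∈ , ne) → Sub.∙∈ Q q₀∈ q∈ , trans (hom q₀∈ q∈)
        (trans (cong (_xor χ q) χq₀) (sym (¬-not (λ eq → ne (sym eq))))))) ⟩
    count Qb? + count (λ q → mem? Q q ×-dec ¬? (χ q ≟ᵇ b)) ≡⟨ count-split (mem? Q) (λ q → χ q ≟ᵇ b) ⟨
    size Q                   ∎
    where
    open ≡-Reasoning
    Qb? = λ q → mem? Q q ×-dec (χ q ≟ᵇ b)

  whole-sub : Sub 𝔾
  whole-sub = record { mem = λ _ → ⊤ ; mem? = λ _ → yes tt ; ε∈ = tt ; ∙∈ = λ _ _ → tt ; ⁻¹∈ = λ _ → tt }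

  |whole| : size whole-sub ≡ n
  |whole| = count-all (mem? whole-sub) (λ _ → tt)

  module _ (Q : Sub 𝔾) (z∈Q : Q ∋ z) where

    private
      Z⊆Q : ∀ {x} → x ≡ ε ⊎ x ≡ z → Q ∋ x
      Z⊆Q (inj₁ refl) = Sub.ε∈ Q
      Z⊆Q (inj₂ refl) = z∈Q

    module _ (χ : Fin n → Bool) (hom : Additive Q χ) (χz : χ z ≡ false) where

      Represents : Fin n → Set
      Represents x = ∀ q → Q ∋ q → c x q ≡ χ q

      represents? : Decidable Represents
      represents? x = all? (λ q → mem? Q q →-dec (c x q ≟ᵇ χ q))

      -- Double counting of the pairs (x , q) with c x q = χ q.
      orthogonality : size Q * count represents? ≡ 2 * n
      orthogonality = ℕ.+-cancelˡ-≡ (n * size Q) _ _ (begin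
        n * size Q + size Q * count represents?                  ≡⟨ sum-affine (size Q) (size Q) represents? ⟨
        sum (λ x → size Q + size Q * 𝟙 (represents? x))          ≡⟨ sum-cong-≗ row ⟨
        sum (λ x → 2 * count (R? x))                             ≡⟨ sum-* 2 (λ x → count (R? x)) ⟩
        2 * sum (λ x → count (R? x))                             ≡⟨ cong (2 *_) (count-swap R?) ⟩
        2 * sum (λ q → count (λ x → R? x q))                     ≡⟨ sum-* 2 (λ q → count (λ x → R? x q)) ⟨
        sum (λ q → 2 * count (λ x → R? x q))                     ≡⟨ sum-cong-≗ column ⟩
        sum (λ q → n * 𝟙 (mem? Q q) + n * 𝟙 (z∈? q))
          ≡⟨ ∑-distrib-+ (λ q → n * 𝟙 (mem? Q q)) (λ q → n * 𝟙 (z∈? q)) ⟩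
        sum (λ q → n * 𝟙 (mem? Q q)) + sum (λ q → n * 𝟙 (z∈? q)) ≡⟨ cong₂ _+_ (sum-*𝟙 n (mem? Q)) (sum-*𝟙 n z∈?) ⟩
        n * size Q + n * count z∈?                               ≡⟨ cong (λ k → n * size Q + n * k) |Z|≡2 ⟩
        n * size Q + n * 2                                       ≡⟨ cong (n * size Q +_) (ℕ.*-comm n 2) ⟩
        n * size Q + 2 * n                                       ∎)
        where
        open ≡-Reasoning
        R? : ∀ x q → Dec (Q ∋ q × c x q ≡ χ q)
        R? x q = mem? Q q ×-dec (c x q ≟ᵇ χ q)
        sum-*𝟙 : ∀ a {P : Pred (Fin n) 0ℓ} (P? : Decidable P) → sum (λ i → a * 𝟙 (P? i)) ≡ a * count P?
        sum-*𝟙 a P? = trans (sum-* a (𝟙 ∘ P?)) (cong (a *_) (sym (count≡sum P?)))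
        sum-affine : ∀ a b {P : Pred (Fin n) 0ℓ} (P? : Decidable P) → sum
          (λ i → a + b * 𝟙 (P? i)) ≡ n * a + b * count P?
        sum-affine a b P? = trans (∑-distrib-+ (λ _ → a) (λ i → b * 𝟙 (P? i))) (cong₂ _+_ (sum-const n a) (sum-*𝟙 b P?))
        -- The map c(x,·) + χ is additive on Q, so it vanishes on all of Q or on exactly half of it.
        row : ∀ x → 2 * count (R? x) ≡ size Q + size Q * 𝟙 (represents? x)
        row x with represents? x
        ... | yes r = begin
          2 * count (R? x)      ≡⟨ cong (2 *_) (count-cong (R? x) (mem? Q) (λ _ → proj₁) (λ q q∈ → q∈ , r q q∈)) ⟩
          2 * size Q            ≡⟨ cong (size Q +_) (trans (ℕ.+-identityʳ _) (sym (ℕ.*-identityʳ _))) ⟩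
          size Q + size Q * 1   ∎
        ... | no ¬r with any? (λ q → mem? Q q ×-dec ¬? (c x q ≟ᵇ χ q))
        ...   | no ∄q = contradiction (λ q q∈ → decidable-stable (c x q ≟ᵇ χ q) (λ ne → ∄q (q , q∈ , ne))) ¬r
        ...   | yes (q₀ , q₀∈ , ne) = begin
          2 * count (R? x)      ≡⟨ cong (2 *_) (count-cong (R? x) (λ q → mem? Q q ×-dec (χ′ q ≟ᵇ false))
                                     (λ q (q∈ , eq) → q∈ , trans (cong (_xor χ q) eq) (xor-same (χ q)))
                                     (λ q (q∈ , eq) → q∈ , xor-false⇒≡ _ _ eq)) ⟩
          2 * count (λ q → mem? Q q ×-dec (χ′ q ≟ᵇ false))
            ≡⟨ half Q χ′ hom′ q₀∈ (¬-not λ eq → ne (xor-false⇒≡ _ _ eq)) false ⟩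
          size Q                ≡⟨ ℕ.+-identityʳ _ ⟨
          size Q + 0            ≡⟨ cong (size Q +_) (ℕ.*-zeroʳ (size Q)) ⟨
          size Q + size Q * 0   ∎
          where
          χ′ : Fin n → Bool
          χ′ q = c x q xor χ q
          hom′ : Additive Q χ′
          hom′ {q} {q′} q∈ q′∈ = trans (cong₂ _xor_ (c-∙ʳ x q q′) (hom q∈ q′∈)) (xor-interchange (c x q) _ _ _)
        -- For q in ⟨z⟩ both c(x,q) and χ(q) vanish and every x qualifies. For any other q in Q,
        -- nondegeneracy makes c(·,q) nonzero, so exactly half of all x qualify.
        column : ∀ q → 2 * count (λ x → R? x q) ≡ n * 𝟙 (mem? Q q) + n * 𝟙 (z∈? q)
        column q with mem? Q q | z∈? q
        ... | no ¬q | yes q∈Z = contradiction (Z⊆Q q∈Z) ¬q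
        ... | no ¬q | no  _   = trans
          (cong (2 *_) (count-none (λ x → no ¬q ×-dec (c x q ≟ᵇ χ q)) (λ _ p → ¬q (proj₁ p))))
                                      (sym (cong₂ _+_ (ℕ.*-zeroʳ n) (ℕ.*-zeroʳ n)))
        ... | yes q∈ | yes q∈Z = trans
          (cong (2 *_) (count-all (λ x → yes q∈ ×-dec (c x q ≟ᵇ χ q))
            (λ x → q∈ , trans (central⇒false q∈Z x) (sym (χZ q∈Z)))))
                                  (cong₂ _+_ (sym (ℕ.*-identityʳ n)) (trans (ℕ.+-identityʳ n) (sym (ℕ.*-identityʳ n))))
          where
          χε : χ ε ≡ false
          χε = trans (cong χ (sym (identityˡ ε))) (trans (hom (Sub.ε∈ Q) (Sub.ε∈ Q)) (xor-same (χ ε)))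
          χZ : ∀ {x} → x ≡ ε ⊎ x ≡ z → χ x ≡ false
          χZ (inj₁ refl) = χε
          χZ (inj₂ refl) = χz
        ... | yes q∈ | no q∉Z with any? (λ x → c x q ≟ᵇ true)
        ...   | no ∄x = contradiction (nondegenerate (λ y → trans (c-sym q y) (¬-not (λ eq → ∄x (y , eq))))) q∉Z
        ...   | yes (x₀ , eq) = trans
          (cong (2 *_) (count-cong (λ x → yes q∈ ×-dec (c x q ≟ᵇ χ q)) (λ x → mem? whole-sub x ×-dec (c x q ≟ᵇ χ q))
            (λ _ (_ , eq) → tt , eq) (λ _ (_ , eq) → q∈ , eq)))
          (trans (half whole-sub (λ x → c x q) (λ {x} {y} _ _ → c-∙ˡ x y q) tt eq (χ q))
          (trans |whole| (trans (sym (ℕ.+-identityʳ n)) (cong₂ _+_ (sym (ℕ.*-identityʳ n)) (sym (ℕ.*-zeroʳ n))))))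

      character : ∃[ x ] (∀ q → Q ∋ q → c x q ≡ χ q)
      character = count-witness represents? λ eq → ℕ.m<n⇒n≢0 (ℕ.*-mono-< {0} {2} {0} {n} (s≤s z≤n) n>0)
          (trans (sym orthogonality) (trans (cong (size Q *_) eq) (ℕ.*-zeroʳ (size Q))))
        where
        n>0 : 0 < n
        n>0 = subst (0 <_) |whole| (count-pos (mem? whole-sub) {ε} tt)

  centralizer : Sub 𝔾 → Sub 𝔾
  centralizer Q = record
    { mem  = λ x → ∀ q → Q ∋ q → c x q ≡ false
    ; mem? = λ x → all? (λ q → mem? Q q →-dec (c x q ≟ᵇ false))
    ; ε∈   = λ q _ → c-εˡ q
    ; ∙∈   = λ {x} {y} x∈ y∈ q q∈ → trans (c-∙ˡ x y q) (cong₂ _xor_ (x∈ q q∈) (y∈ q q∈))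
    ; ⁻¹∈  = λ {x} x∈ q q∈ → trans (sym (trans (c-∙ˡ x (x ⁻¹) q) (cong (_xor c (x ⁻¹) q) (x∈ q q∈))))
                               (trans (cong (λ y → c y q) (inverseʳ x)) (c-εˡ q))
    }

  |centralizer| : (Q : Sub 𝔾) → Q ∋ z → size Q * size (centralizer Q) ≡ 2 * n
  |centralizer| Q z∈Q = orthogonality Q z∈Q (λ _ → false) (λ _ _ → refl) refl

  -- Q ≤ CC(Q) is clear, and `|centralizer|` applied to Q and to C(Q) gives both the same order.
  double-centralizer : (Q : Sub 𝔾) → Q ∋ z → ∀ {x} → centralizer (centralizer Q) ∋ x → Q ∋ x
  double-centralizer Q z∈Q {x} = count-⊆-≥ (mem? Q) (mem? CC) (λ q q∈ y y∈ → trans (c-sym q y) (y∈ q q∈))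
      (ℕ.≤-reflexive (ℕ.*-cancelˡ-≡ (size CC) (size Q) (size C) (begin
        size C * size CC   ≡⟨ |centralizer| C (λ q _ → c-zˡ q) ⟩
        2 * n              ≡⟨ |centralizer| Q z∈Q ⟨
        size Q * size C    ≡⟨ ℕ.*-comm (size Q) _ ⟩
        size C * size Q    ∎))) x
    where
    open ≡-Reasoning
    C  = centralizer Q
    CC = centralizer C
    instance _ = size-pos C

-- Obstructions to lifting and totally singular subgroups

module Singular {n : ℕ} (𝔾 : FinGroup n) (ext : Extraspecial 𝔾) where
  open FinGroup 𝔾
  open Extraspecial ext
  open Theory 𝔾
  open GroupSolver group using (solve; _⊜_; _⊕_; _⁻; e)
  open Sub using (size; mem?)
  open Quadratic 𝔾 ext

  -- Condition (★) with x ranging over all of R instead of N₂; the two agree when N₂ = R.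
  Lifts : Sub 𝔾 → Set
  Lifts Q = ∀ x → Q ∋ (x ∙ x) → ∃[ q ] Q ∋ q × s (x ∙ q) ≡ false

  Abelian : Sub 𝔾 → Set
  Abelian Q = ∀ {x y} → Q ∋ x → Q ∋ y → c x y ≡ false

  -- Stronger than maximality under inclusion: `maximal` and `isotropic` together say E = C(E), so E
  -- is a totally singular subspace of half the dimension in R/⟨z⟩. Its existence separates the
  -- central powers of D₈ from the other type of extraspecial group.
  record IsMaximalSingular (E : Sub 𝔾) : Set where
    field
      z∈       : E ∋ z
      singular : ∀ {x} → E ∋ x → s x ≡ false
      maximal  : ∀ {u} → (∀ x → E ∋ x → c u x ≡ false) → E ∋ u

    isotropic : Abelian E
    isotropic {x} {y} x∈ y∈ = trans (cong₂ (λ a b → (a xor b) xor c x y) (sym (singular x∈)) (sym (singular y∈)))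
      (trans (sym (s-∙ x y)) (singular (Sub.∙∈ E x∈ y∈)))

  -- If s(xq) = 1 for all q in Q, then q = 1 gives s(x) = 1, and expanding s(xq) gives the rest.
  lifts-or-obstructed : ∀ Q x → (∃[ q ] Q ∋ q × s (x ∙ q) ≡ false) ⊎ (s x ≡ true × (∀ q → Q ∋ q → c x q ≡ s q))
  lifts-or-obstructed Q x with any? (λ q → mem? Q q ×-dec (s (x ∙ q) ≟ᵇ false))
  ... | yes w = inj₁ w
  ... | no ∄q = inj₂ (sx , λ q q∈ → sym (xor-false⇒≡ (s q) (c x q) (not-injective
        (trans (not-distribˡ-xor (s q) (c x q))
          (trans (cong (λ b → (b xor s q) xor c x q) (sym sx))
            (trans (sym (s-∙ x q)) (¬-not λ eq → ∄q (q , q∈ , eq))))))))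
    where
    sx : s x ≡ true
    sx = trans (cong s (sym (identityʳ x))) (¬-not λ eq → ∄q (ε , Sub.ε∈ Q , eq))

  -- An obstruction makes s agree on Q with the additive map c(x,·), so the polar form c would
  -- vanish on Q.
  nonabelian⇒lifts : ∀ Q {q₁ q₂} → Q ∋ q₁ → Q ∋ q₂ → c q₁ q₂ ≡ true → Lifts Q
  nonabelian⇒lifts Q {q₁} {q₂} q₁∈ q₂∈ c≡true x _ with lifts-or-obstructed Q x
  ... | inj₁ w = w
  ... | inj₂ (_ , cx≡s) = contradiction (begin
      false                        ≡⟨ xor-same (s q₁ xor s q₂) ⟨
      S xor S                      ≡⟨ cong (S xor_) (cong₂ _xor_ (cx≡s q₁ q₁∈) (cx≡s q₂ q₂∈)) ⟨
      S xor (c x q₁ xor c x q₂)    ≡⟨ cong (S xor_) (c-∙ʳ x q₁ q₂) ⟨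
      S xor c x (q₁ ∙ q₂)          ≡⟨ cong (S xor_) (cx≡s _ (Sub.∙∈ Q q₁∈ q₂∈)) ⟩
      S xor s (q₁ ∙ q₂)            ≡⟨ cong (S xor_) (s-∙ q₁ q₂) ⟩
      S xor (S xor c q₁ q₂)        ≡⟨ xor-assoc S S _ ⟨
      (S xor S) xor c q₁ q₂        ≡⟨ cong₂ _xor_ (xor-same S) c≡true ⟩
      true                         ∎) λ ()
    where
    open ≡-Reasoning
    S = s q₁ xor s q₂

  -- Squares lie in {1, z}, so x² ∈ Q already means x² = 1, and q = 1 works.
  z∉⇒lifts : ∀ Q → ¬ Q ∋ z → Lifts Q
  z∉⇒lifts Q z∉Q x x²∈ with square x
  ... | inj₁ eq = ε , Sub.ε∈ Q , trans (cong s (identityʳ x)) (s-unique false eq)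
  ... | inj₂ eq = contradiction (subst (Q ∋_) eq x²∈) z∉Q

  x²∈ : ∀ Q → Q ∋ z → ∀ x → Q ∋ (x ∙ x)
  x²∈ Q z∈Q x with square x
  ... | inj₁ eq = subst (Q ∋_) (sym eq) (Sub.ε∈ Q)
  ... | inj₂ eq = subst (Q ∋_) (sym eq) z∈Q

  module _ (Q : Sub 𝔾) (z∈Q : Q ∋ z) (abelian : Abelian Q) where

    s-additive : Additive Q s
    s-additive {x} {y} x∈ y∈ = trans (s-∙ x y) (trans (cong ((s x xor s y) xor_) (abelian x∈ y∈)) (xor-identityʳ _))

    module Necessity (lifts : Lifts Q) where
      private
        -- On the abelian Q the form s is additive with s(z) = 0, so it is a character and some x₀
        -- represents it.
        x₀ : Fin n
        x₀ = proj₁ (character Q z∈Q s s-additive s-z)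

        cx₀ : ∀ q → Q ∋ q → c x₀ q ≡ s q
        cx₀ = proj₂ (character Q z∈Q s s-additive s-z)

        obstruction⇒s : ∀ x → (∀ q → Q ∋ q → c x q ≡ s q) → s x ≡ false
        obstruction⇒s x cx≡s with lifts x (x²∈ Q z∈Q x)
        ... | q , q∈ , eq = begin
          s x                          ≡⟨ xor-identityʳ (s x) ⟨
          s x xor false                ≡⟨ cong (s x xor_) (xor-same (s q)) ⟨
          s x xor (s q xor s q)        ≡⟨ xor-assoc (s x) _ _ ⟨
          (s x xor s q) xor s q        ≡⟨ cong ((s x xor s q) xor_) (cx≡s q q∈) ⟨
          (s x xor s q) xor c x q      ≡⟨ s-∙ x q ⟨
          s (x ∙ q)                    ≡⟨ eq ⟩
          false                        ∎
          where open ≡-Reasoning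

        sx₀ : s x₀ ≡ false
        sx₀ = obstruction⇒s x₀ cx₀

        -- x₀y represents s on Q just as x₀ does, so s(x₀y) = s(x₀) = 0; expanding s(x₀y) leaves the
        -- claim.
        s-centralizer : ∀ {y} → centralizer Q ∋ y → s y ≡ c x₀ y
        s-centralizer {y} y∈ = xor-false⇒≡ _ _
          (trans (cong (λ b → (b xor s y) xor c x₀ y) (sym sx₀)) (trans (sym (s-∙ x₀ y))
          (obstruction⇒s (x₀ ∙ y) (λ q q∈ → trans (c-∙ˡ x₀ y q)
            (trans (cong₂ _xor_ (cx₀ q q∈) (y∈ q q∈)) (xor-identityʳ _))))))

      -- By `s-centralizer`, s is additive on C(Q), so c vanishes there and y ∈ CC(Q).
      self-centralizing : ∀ {y} → centralizer Q ∋ y → Q ∋ y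
      self-centralizing {y} y∈ = double-centralizer Q z∈Q (λ w w∈ → let S = c x₀ y xor c x₀ w in begin
          c y w                                 ≡⟨ cong (_xor c y w) (xor-same S) ⟨
          (S xor S) xor c y w                   ≡⟨ xor-assoc S S _ ⟩
          S xor (S xor c y w)
            ≡⟨ cong (λ b → S xor (b xor c y w)) (cong₂ _xor_ (s-centralizer y∈) (s-centralizer w∈)) ⟨
          S xor ((s y xor s w) xor c y w)       ≡⟨ cong (S xor_) (s-∙ y w) ⟨
          S xor s (y ∙ w)                       ≡⟨ cong (S xor_) (s-centralizer (Sub.∙∈ (centralizer Q) y∈ w∈)) ⟩
          S xor c x₀ (y ∙ w)                    ≡⟨ cong (S xor_) (c-∙ʳ x₀ y w) ⟩
          S xor S                               ≡⟨ xor-same S ⟩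
          false                                 ∎)
        where open ≡-Reasoning

      |Q|²≡2n : size Q * size Q ≡ 2 * n
      |Q|²≡2n = trans (cong (size Q *_)
        (count-cong (mem? Q) (mem? (centralizer Q)) (λ q q∈ q′ q′∈ → abelian q∈ q′∈) (λ _ → self-centralizing)))
        (|centralizer| Q z∈Q)

      private
        Q₀ : Fin n → Set
        Q₀ x = Q ∋ x × s x ≡ false

        Q₀-∙ : ∀ {x y} → Q₀ x → Q₀ y → Q₀ (x ∙ y)
        Q₀-∙ (x∈ , sx) (y∈ , sy) = Sub.∙∈ Q x∈ y∈ , trans (s-additive x∈ y∈) (cong₂ _xor_ sx sy)

        cx₀-Q₀ : ∀ {x} → Q₀ x → c x₀ x ≡ false
        cx₀-Q₀ (x∈ , sx) = trans (cx₀ _ x∈) sx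

        x₀² : x₀ ∙ x₀ ≡ ε
        x₀² = trans (s-law x₀) (cong z^ sx₀)

        x₀x₀y : ∀ y → x₀ ∙ (x₀ ∙ y) ≡ y
        x₀x₀y y = trans (sym (assoc _ _ _)) (trans (cong (_∙ y) x₀²) (identityˡ y))

        cx₀-x₀∙ : ∀ {x} → c x₀ (x₀ ∙ x) ≡ c x₀ x
        cx₀-x₀∙ {x} = trans (c-∙ʳ x₀ x₀ x) (cong (_xor c x₀ x) (c-self x₀))

        -- This is Q₀ ∪ x₀Q₀, as x₀² = 1. If s is nonzero on Q, then Q₀ has index 2 in Q and x₀ lies
        -- outside Q, so the union has order |Q| again; otherwise x₀ ∈ C(Q) = Q and the union is Q.
        E∋ : Fin n → Set
        E∋ x = Q₀ x ⊎ Q₀ (x₀ ∙ x)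

        E-cx₀ : ∀ {x} → E∋ x → c x₀ x ≡ false
        E-cx₀ (inj₁ q) = cx₀-Q₀ q
        E-cx₀ (inj₂ q) = trans (sym cx₀-x₀∙) (cx₀-Q₀ q)

        E-singular : ∀ {x} → E∋ x → s x ≡ false
        E-singular (inj₁ (_ , sx)) = sx
        E-singular {x} (inj₂ q@(_ , s₀)) = trans (cong s (sym (x₀x₀y x))) (trans (s-∙ x₀ (x₀ ∙ x))
          (trans (cong₂ _xor_ (cong₂ _xor_ sx₀ s₀) (cx₀-Q₀ q)) refl))

        commutes : ∀ {x} → E∋ x → x ∙ x₀ ≡ x₀ ∙ x
        commutes {x} x∈ = commute-c (trans (c-sym x x₀) (E-cx₀ x∈))

        E-∙ : ∀ {x y} → E∋ x → E∋ y → E∋ (x ∙ y)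
        E-∙ (inj₁ p) (inj₁ q) = inj₁ (Q₀-∙ p q)
        E-∙ {x} {y} (inj₁ p) (inj₂ q) = inj₂ (subst Q₀
          (trans (sym (assoc _ _ _)) (trans (cong (_∙ y) (commutes (inj₁ p))) (assoc _ _ _))) (Q₀-∙ p q))
        E-∙ (inj₂ p) (inj₁ q) = inj₂ (subst Q₀ (assoc _ _ _) (Q₀-∙ p q))
        E-∙ {x} {y} (inj₂ p) (inj₂ q) = inj₁
          (subst Q₀ (trans (solve 3 (λ a x y → a ⊕ x ⊕ (a ⊕ y) ⊜ a ⊕ (x ⊕ a) ⊕ y) refl x₀ x y)
          (trans (cong (λ u → x₀ ∙ u ∙ y) (commutes (inj₂ p))) (cong (_∙ y) (x₀x₀y x)))) (Q₀-∙ p q))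

      E : Sub 𝔾
      E = record
        { mem  = E∋
        ; mem? = λ x → (mem? Q x ×-dec (s x ≟ᵇ false)) ⊎-dec (mem? Q (x₀ ∙ x) ×-dec (s (x₀ ∙ x) ≟ᵇ false))
        ; ε∈   = inj₁ (Sub.ε∈ Q , s-ε)
        ; ∙∈   = E-∙
        ; ⁻¹∈  = λ x∈ → subst E∋ (sym (involution⇒⁻¹ (E-singular x∈))) x∈
        }

      E-maximal : ∀ {u} → (∀ x → E ∋ x → c u x ≡ false) → E ∋ u
      E-maximal {u} h with any? (λ q → mem? Q q ×-dec (s q ≟ᵇ true))
      ... | no ∄q = inj₁ (u∈Q , s-false u u∈Q)
        where
        s-false : ∀ q → Q ∋ q → s q ≡ false
        s-false q q∈ = ¬-not λ eq → ∄q (q , q∈ , eq)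
        u∈Q : Q ∋ u
        u∈Q = self-centralizing (λ q q∈ → h q (inj₁ (q∈ , s-false q q∈)))
      ... | yes (q₁ , q₁∈ , sq₁) = split (c u q₁) refl
        where
        -- Q₀ and q₁ generate Q
        extend-to-Q : ∀ {v} → (∀ x → Q₀ x → c v x ≡ false) → c v q₁ ≡ false → Q ∋ v
        extend-to-Q {v} h₀ h₁ = self-centralizing λ q q∈ → case-s q q∈ (s q) refl
          where
          case-s : ∀ q → Q ∋ q → ∀ b → s q ≡ b → c v q ≡ false
          case-s q q∈ false sq = h₀ q (q∈ , sq)
          case-s q q∈ true  sq = trans (sym (xor-identityʳ _))
            (trans (cong (c v q xor_) (sym h₁)) (trans (sym (c-∙ʳ v q q₁))
            (h₀ (q ∙ q₁) (Sub.∙∈ Q q∈ q₁∈ , trans (s-additive q∈ q₁∈) (cong₂ _xor_ sq sq₁)))))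
        cx₀u : c x₀ u ≡ false
        cx₀u = trans (c-sym x₀ u) (h x₀ (inj₂ (subst Q₀ (sym x₀²) (Sub.ε∈ Q , s-ε))))
        -- c(x₀,q₁) = s(q₁) = 1, so exactly one of u and x₀u commutes with q₁. That one centralises
        -- Q and so lies in Q, where s equals c(x₀,·), which vanishes on it.
        split : ∀ b → c u q₁ ≡ b → E∋ u
        split false eq = inj₁ (u∈Q , trans (sym (cx₀ u u∈Q)) cx₀u)
          where u∈Q = extend-to-Q (λ x x∈ → h x (inj₁ x∈)) eq
        split true  eq = inj₂ (x₀u∈Q , trans (sym (cx₀ _ x₀u∈Q)) (trans cx₀-x₀∙ cx₀u))
          where
          x₀u∈Q = extend-to-Q {x₀ ∙ u} (λ x x∈ → trans (c-∙ˡ x₀ u x) (cong₂ _xor_ (cx₀-Q₀ x∈) (h x (inj₁ x∈))))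
                    (trans (c-∙ˡ x₀ u q₁) (cong₂ _xor_ (trans (cx₀ q₁ q₁∈) sq₁) eq))

      maximalSingular : IsMaximalSingular E
      maximalSingular = record { z∈ = inj₁ (z∈Q , s-z) ; singular = E-singular ; maximal = E-maximal }

    -- An obstruction x satisfies c x q = s q on Q, so it centralises Q ∩ E and lies in QE;
    -- writing x = qe gives x² = 1.
    sufficiency : size Q * size Q ≡ 2 * n → ∀ {E} → IsMaximalSingular E → Lifts Q
    sufficiency |Q|²≡2n {E} maxE x _ with lifts-or-obstructed Q x
    ... | inj₁ w = w
    ... | inj₂ (sx , cx≡s) with double-centralizer QE
      (ε , Sub.ε∈ Q , subst (E ∋_) (solve 1 (λ x → x ⊜ e ⁻ ⊕ x) refl z) z∈) x∈CC
      where
      open IsMaximalSingular maxE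
      QE : Sub 𝔾
      QE = record
        { mem  = λ x → ∃[ q ] Q ∋ q × E ∋ (q ⁻¹ ∙ x)
        ; mem? = λ x → any? (λ q → mem? Q q ×-dec mem? E (q ⁻¹ ∙ x))
        ; ε∈   = ε , Sub.ε∈ Q , subst (E ∋_) (sym (inverseˡ ε)) (Sub.ε∈ E)
        ; ∙∈   = λ {x} {y} (q , q∈ , u) (q′ , q′∈ , v) → q ∙ q′ , Sub.∙∈ Q q∈ q′∈ ,
            E-up-to-z (c (q ⁻¹ ∙ x) (q′ ⁻¹)) (E-eq x y q q′) (Sub.∙∈ E u v)
        ; ⁻¹∈  = λ {x} (q , q∈ , u) → q ⁻¹ , Sub.⁻¹∈ Q q∈ , E-up-to-z (c q (x ⁻¹)) (E-eq⁻¹ x q) (Sub.⁻¹∈ E u)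
        }
        where
        -- Reordering factors costs only a power of z, and z ∈ E; this makes QE a subgroup.
        E-up-to-z : ∀ b {x y} → y ≡ z^ b ∙ x → E ∋ x → E ∋ y
        E-up-to-z false eq x∈ = subst (E ∋_) (sym eq) (Sub.∙∈ E (Sub.ε∈ E) x∈)
        E-up-to-z true  eq x∈ = subst (E ∋_) (sym eq) (Sub.∙∈ E z∈ x∈)
        E-eq : ∀ x y q q′ → (q ∙ q′) ⁻¹ ∙ (x ∙ y) ≡ z^ (c (q ⁻¹ ∙ x) (q′ ⁻¹)) ∙ (q ⁻¹ ∙ x ∙ (q′ ⁻¹ ∙ y))
        E-eq x y q q′ = begin
          (q ∙ q′) ⁻¹ ∙ (x ∙ y)
            ≡⟨ solve 4 (λ x y q r → (q ⊕ r) ⁻ ⊕ (x ⊕ y) ⊜ r ⁻ ⊕ (q ⁻ ⊕ x) ⊕ y) refl x y q q′ ⟩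
          q′ ⁻¹ ∙ (q ⁻¹ ∙ x) ∙ y             ≡⟨ cong (_∙ y) (c-law (q′ ⁻¹) (q ⁻¹ ∙ x)) ⟩
          z^ (c (q′ ⁻¹) (q ⁻¹ ∙ x)) ∙ (q ⁻¹ ∙ x ∙ q′ ⁻¹) ∙ y
            ≡⟨ cong (λ b → z^ b ∙ (q ⁻¹ ∙ x ∙ q′ ⁻¹) ∙ y) (c-sym (q′ ⁻¹) (q ⁻¹ ∙ x)) ⟩
          z^ (c (q ⁻¹ ∙ x) (q′ ⁻¹)) ∙ (q ⁻¹ ∙ x ∙ q′ ⁻¹) ∙ y
            ≡⟨ solve 4 (λ w x y r → w ⊕ (x ⊕ r) ⊕ y ⊜ w ⊕ (x ⊕ (r ⊕ y))) refl _ (q ⁻¹ ∙ x) y (q′ ⁻¹) ⟩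
          z^ (c (q ⁻¹ ∙ x) (q′ ⁻¹)) ∙ (q ⁻¹ ∙ x ∙ (q′ ⁻¹ ∙ y))  ∎
          where open ≡-Reasoning
        E-eq⁻¹ : ∀ x q → q ⁻¹ ⁻¹ ∙ x ⁻¹ ≡ z^ (c q (x ⁻¹)) ∙ (q ⁻¹ ∙ x) ⁻¹
        E-eq⁻¹ x q = begin
          q ⁻¹ ⁻¹ ∙ x ⁻¹                ≡⟨ solve 2 (λ x q → q ⁻ ⁻ ⊕ x ⁻ ⊜ q ⊕ x ⁻) refl x q ⟩
          q ∙ x ⁻¹                      ≡⟨ c-law q (x ⁻¹) ⟩
          z^ (c q (x ⁻¹)) ∙ (x ⁻¹ ∙ q)
            ≡⟨ cong (z^ (c q (x ⁻¹)) ∙_) (solve 2 (λ x q → x ⁻ ⊕ q ⊜ (q ⁻ ⊕ x) ⁻) refl x q) ⟩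
          z^ (c q (x ⁻¹)) ∙ (q ⁻¹ ∙ x) ⁻¹ ∎
          where open ≡-Reasoning
      instance _ = size-pos Q
      CQ⊆Q : ∀ y → centralizer Q ∋ y → Q ∋ y
      CQ⊆Q = count-⊆-≥ (mem? Q) (mem? (centralizer Q)) (λ q q∈ q′ q′∈ → abelian q∈ q′∈)
        (ℕ.≤-reflexive (ℕ.*-cancelˡ-≡ _ _ (size Q) (trans (|centralizer| Q z∈Q) (sym |Q|²≡2n))))
      -- Whatever centralises QE lies in C(Q) = Q and in C(E) = E, so c(x,y) = s(y) = 0.
      x∈CC : centralizer (centralizer QE) ∋ x
      x∈CC y y∈ = trans (cx≡s y (CQ⊆Q y λ q q∈ → y∈ q (q , q∈ , subst (E ∋_) (sym (inverseˡ q)) (Sub.ε∈ E))))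
        (singular (maximal λ x x∈ → y∈ x (ε , Sub.ε∈ Q , subst (E ∋_) (solve 1 (λ x → x ⊜ e ⁻ ⊕ x) refl x) x∈)))
    ... | q , q∈ , u = contradiction (trans (sym sx) sx≡false) λ ()
      where
      open IsMaximalSingular maxE
      w = q ⁻¹ ∙ x
      -- With x = qw and s(w) = 0 one gets s(x) = s(q) + c(q,w) = s(q) + c(q,x) = s(q) + s(q), using
      -- c(q,q) = 0.
      sx≡false : s x ≡ false
      sx≡false = begin
        s x                           ≡⟨ cong s (x∙x⁻¹y q x) ⟨
        s (q ∙ w)                     ≡⟨ s-∙ q w ⟩
        (s q xor s w) xor c q w       ≡⟨ cong (λ b → (s q xor b) xor c q w) (singular u) ⟩
        (s q xor false) xor c q w     ≡⟨ cong₂ _xor_ (xor-identityʳ (s q)) (sym (cong (_xor c q w) (c-self q))) ⟩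
        s q xor (c q q xor c q w)     ≡⟨ cong (s q xor_) (c-∙ʳ q q w) ⟨
        s q xor c q (q ∙ w)           ≡⟨ cong (λ v → s q xor c q v) (x∙x⁻¹y q x) ⟩
        s q xor c q x                 ≡⟨ cong (s q xor_) (trans (c-sym q x) (cx≡s q q∈)) ⟩
        s q xor s q                   ≡⟨ xor-same (s q) ⟩
        false                         ∎
        where open ≡-Reasoning

-- Central products of D₈

-- (a , i , j) stands for zᵃeⁱfʲ in D₈ = ⟨e , f⟩ with e² = f² = 1 and fe = zef; thus r = ef and s = f.
module D₈Coordinates where
  open D₈ public using () renaming (Carrier to D₈; _∙_ to _·_; ε to ε₈; _⁻¹ to inv)

  Triple : Set
  Triple = Bool × Bool × Bool

  infixl 7 _⊛_
  -- The term j ∧ i′ is the power of z picked up when fʲ moves past the second factor's power of e.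
  _⊛_ : Triple → Triple → Triple
  (a , i , j) ⊛ (a′ , i′ , j′) = (a xor a′) xor (j ∧ i′) , i xor i′ , j xor j′

  coords : D₈ → Triple
  coords (zero                 , false) = false , false , false
  coords (suc zero             , false) = false , true  , true
  coords (suc (suc zero)       , false) = true  , false , false
  coords (suc (suc (suc zero)) , false) = true  , true  , true
  coords (zero                 , true)  = false , false , true
  coords (suc zero             , true)  = false , true  , false
  coords (suc (suc zero)       , true)  = true  , false , true
  coords (suc (suc (suc zero)) , true)  = true  , true  , false

  fromCoords : Triple → D₈
  fromCoords (false , false , false) = zero                 , false
  fromCoords (false , true  , true)  = suc zero             , false
  fromCoords (true  , false , false) = suc (suc zero)       , false
  fromCoords (true  , true  , true)  = suc (suc (suc zero)) , false
  fromCoords (false , false , true)  = zero                 , true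
  fromCoords (false , true  , false) = suc zero             , true
  fromCoords (true  , false , true)  = suc (suc zero)       , true
  fromCoords (true  , true  , false) = suc (suc (suc zero)) , true

  fromCoords-coords : ∀ x → fromCoords (coords x) ≡ x
  fromCoords-coords (zero                 , false) = refl
  fromCoords-coords (suc zero             , false) = refl
  fromCoords-coords (suc (suc zero)       , false) = refl
  fromCoords-coords (suc (suc (suc zero)) , false) = refl
  fromCoords-coords (zero                 , true)  = refl
  fromCoords-coords (suc zero             , true)  = refl
  fromCoords-coords (suc (suc zero)       , true)  = refl
  fromCoords-coords (suc (suc (suc zero)) , true)  = refl

  coords-fromCoords : ∀ t → coords (fromCoords t) ≡ t
  coords-fromCoords (false , false , false) = refl
  coords-fromCoords (false , true  , true)  = refl
  coords-fromCoords (true  , false , false) = refl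
  coords-fromCoords (true  , true  , true)  = refl
  coords-fromCoords (false , false , true)  = refl
  coords-fromCoords (false , true  , false) = refl
  coords-fromCoords (true  , false , true)  = refl
  coords-fromCoords (true  , true  , false) = refl

  coords-injective : ∀ {x y} → coords x ≡ coords y → x ≡ y
  coords-injective {x} {y} eq = trans (sym (fromCoords-coords x)) (trans (cong fromCoords eq) (fromCoords-coords y))

  _≟ᵗ_ : (t u : Triple) → Dec (t ≡ u)
  _≟ᵗ_ = ≡-dec _≟ᵇ_ (≡-dec _≟ᵇ_ _≟ᵇ_)

  coords-· : ∀ x y → coords (x · y) ≡ coords x ⊛ coords y
  coords-· (j , false) (k , false) = from-yes
    (all? λ j → all? λ k → coords ((j , false) · (k , false)) ≟ᵗ (coords (j , false) ⊛ coords (k , false))) j k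
  coords-· (j , false) (k , true)  = from-yes
    (all? λ j → all? λ k → coords ((j , false) · (k , true))  ≟ᵗ (coords (j , false) ⊛ coords (k , true)))  j k
  coords-· (j , true)  (k , false) = from-yes
    (all? λ j → all? λ k → coords ((j , true)  · (k , false)) ≟ᵗ (coords (j , true)  ⊛ coords (k , false))) j k
  coords-· (j , true)  (k , true)  = from-yes
    (all? λ j → all? λ k → coords ((j , true)  · (k , true))  ≟ᵗ (coords (j , true)  ⊛ coords (k , true)))  j k

  coords-zcomm : ∀ a t → (a , false , false) ⊛ t ≡ t ⊛ (a , false , false)
  coords-zcomm a (a′ , i , j) = cong₂ _,_
    (cong₂ _xor_ (xor-comm a a′) (sym (∧-zeroʳ j)))
    (cong₂ _,_ (sym (xor-identityʳ i)) (sym (xor-identityʳ j)))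

  central⁺ : ∀ {x a} → coords x ≡ (a , false , false) → IsCentral D₈.group x
  central⁺ {x} {a} eq y = coords-injective (begin
    coords (x · y)                     ≡⟨ coords-· x y ⟩
    coords x ⊛ coords y                ≡⟨ cong (_⊛ coords y) eq ⟩
    (a , false , false) ⊛ coords y     ≡⟨ coords-zcomm a (coords y) ⟩
    coords y ⊛ (a , false , false)     ≡⟨ cong (coords y ⊛_) eq ⟨
    coords y ⊛ coords x                ≡⟨ coords-· y x ⟨
    coords (y · x)                     ∎)
    where open ≡-Reasoning

  commutes-e : ∀ a i j → (a , i , j) ⊛ (false , true , false) ≡ (false , true , false) ⊛ (a , i , j) → j ≡ false
  commutes-e a     i false _ = refl
  commutes-e false i true ()
  commutes-e true  i true ()

  commutes-f : ∀ a i j → (a , i , j) ⊛ (false , false , true) ≡ (false , false , true) ⊛ (a , i , j) → i ≡ false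
  commutes-f a     false j     _ = refl
  commutes-f false true  false ()
  commutes-f false true  true  ()
  commutes-f true  true  false ()
  commutes-f true  true  true  ()

  -- Vanishes exactly on ⟨z , e⟩, a Klein four-group that is its own centraliser and also the
  -- centraliser of e.
  fCoord : D₈ → Bool
  fCoord x = proj₂ (proj₂ (coords x))

  commutes-e⇒fCoord : ∀ {x} → x · fromCoords (false , true , false) ≡ fromCoords
    (false , true , false) · x → fCoord x ≡ false
  commutes-e⇒fCoord {x} eq = commutes-e (proj₁ (coords x)) _ _
    (trans (sym (coords-· x (fromCoords (false , true , false))))
      (trans (cong coords eq) (coords-· (fromCoords (false , true , false)) x)))

  central⁻ : ∀ {x} → IsCentral D₈.group x → ∃[ a ] coords x ≡ (a , false , false)
  central⁻ {x} cx = proj₁ (coords x) , cong₂ (λ i j → proj₁ (coords x) , i , j)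
    (commutes-f (proj₁ (coords x)) _ _ (trans (sym (coords-· x f)) (trans (cong coords (cx f)) (coords-· f x))))
    (commutes-e⇒fCoord {x} (cx (fromCoords (false , true , false))))
    where f = fromCoords (false , false , true)

-- Hyperbolic pairs and orthogonal splitting

module Frames {n : ℕ} (𝔾 : FinGroup n) (ext : Extraspecial 𝔾) where
  open FinGroup 𝔾
  open Extraspecial ext
  open Theory 𝔾
  open GroupSolver group using (solve; _⊜_; _⊕_)
  open Sub using (size; mem?)
  open Quadratic 𝔾 ext
  open Singular 𝔾 ext
  open D₈Coordinates

  pow : Fin n → Bool → Fin n
  pow x false = ε
  pow x true  = x

  c-pow : ∀ x b y → c (pow x b) y ≡ b ∧ c x y
  c-pow x false y = c-εˡ y
  c-pow x true  y = refl

  pow-xor : ∀ {x} → s x ≡ false → ∀ a b → pow x a ∙ pow x b ≡ pow x (a xor b)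
  pow-xor sx false b     = identityˡ _
  pow-xor sx true  false = identityʳ _
  pow-xor {x} sx true true = trans (s-law x) (cong z^ sx)

  c-z^ : ∀ a y → c (z^ a) y ≡ false
  c-z^ false y = c-εˡ y
  c-z^ true  y = c-zˡ y

  c-⁻¹ˡ : ∀ x y → c (x ⁻¹) y ≡ c x y
  c-⁻¹ˡ x y = xor-false⇒≡ _ _ (trans (sym (c-∙ˡ (x ⁻¹) x y)) (trans (cong (λ w → c w y) (inverseˡ x)) (c-εˡ y)))

  perp : Fin n → Sub 𝔾 → Sub 𝔾
  perp x S = record
    { mem  = λ u → S ∋ u × c x u ≡ false
    ; mem? = λ u → mem? S u ×-dec (c x u ≟ᵇ false)
    ; ε∈   = Sub.ε∈ S , trans (c-sym x ε) (c-εˡ x)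
    ; ∙∈   = λ {u} {v} (u∈ , cu) (v∈ , cv) → Sub.∙∈ S u∈ v∈ , trans (c-∙ʳ x u v) (cong₂ _xor_ cu cv)
    ; ⁻¹∈  = λ {u} (u∈ , cu) → Sub.⁻¹∈ S u∈ , trans (c-sym x (u ⁻¹)) (trans (c-⁻¹ˡ u x) (trans (c-sym u x) cu))
    }

  |perp| : ∀ S {x y} → S ∋ y → c x y ≡ true → 2 * size (perp x S) ≡ size S
  |perp| S {x} y∈ cxy = half S (c x) (λ {u} {v} _ _ → c-∙ʳ x u v) y∈ cxy false

  -- Two involutions with commutator z: they generate a copy of D₈ with centre ⟨z⟩.
  record HyperbolicPair (S : Sub 𝔾) : Set where
    field
      e f   : Fin n
      e∈    : S ∋ e
      f∈    : S ∋ f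
      se    : s e ≡ false
      sf    : s f ≡ false
      cef   : c e f ≡ true

  module Plane {S : Sub 𝔾} (z∈S : S ∋ z) (pair : HyperbolicPair S) where
    open HyperbolicPair pair

    complement : Sub 𝔾
    complement = perp f (perp e S)

    |S|≡4|complement| : size S ≡ 4 * size complement
    |S|≡4|complement| = begin
      size S                          ≡⟨ |perp| S f∈ cef ⟨
      2 * size (perp e S)
        ≡⟨ cong (2 *_) (|perp| (perp e S) {f} {e} (e∈ , c-self e) (trans (c-sym f e) cef)) ⟨
      2 * (2 * size complement)       ≡⟨ ℕ.*-assoc 2 2 (size complement) ⟨
      4 * size complement             ∎
      where open ≡-Reasoning

    z∈complement : complement ∋ z
    z∈complement = (z∈S , trans (c-sym e z) (c-zˡ e)) , trans (c-sym f z) (c-zˡ f)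

    word : Triple → Fin n
    word (a , i , j) = z^ a ∙ (pow e i ∙ pow f j)

    swap : ∀ j i → pow f j ∙ pow e i ≡ z^ (j ∧ i) ∙ (pow e i ∙ pow f j)
    swap false i     = trans (identityˡ _) (trans (sym (identityʳ _)) (sym (identityˡ _)))
    swap true  false = trans (identityʳ f) (trans (sym (identityˡ f)) (sym (identityˡ _)))
    swap true  true  = trans (c-law f e) (cong (λ b → z^ b ∙ (e ∙ f)) (trans (c-sym f e) cef))

    word-⊛ : ∀ t u → word (t ⊛ u) ≡ word t ∙ word u
    word-⊛ (a , i , j) (a′ , i′ , j′) = sym (begin
      z^ a ∙ (eⁱ ∙ fʲ) ∙ (z^ a′ ∙ (eⁱ′ ∙ fʲ′))               ≡⟨ z^-swap a′ (z^ a ∙ (eⁱ ∙ fʲ)) (eⁱ′ ∙ fʲ′) ⟩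
      z^ a′ ∙ (z^ a ∙ (eⁱ ∙ fʲ) ∙ (eⁱ′ ∙ fʲ′))
        ≡⟨ solve 6 (λ b a x y x′ y′ → b ⊕ (a ⊕ (x ⊕ y) ⊕ (x′ ⊕ y′)) ⊜ b ⊕ a ⊕ (x ⊕ (y ⊕ x′) ⊕ y′)) refl (z^ a′)
          (z^ a) eⁱ fʲ eⁱ′ fʲ′ ⟩
      z^ a′ ∙ z^ a ∙ (eⁱ ∙ (fʲ ∙ eⁱ′) ∙ fʲ′)
        ≡⟨ cong₂ (λ u v → u ∙ (eⁱ ∙ v ∙ fʲ′)) (z^-central a′ (z^ a)) (swap j i′) ⟩
      z^ a ∙ z^ a′ ∙ (eⁱ ∙ (z^ (j ∧ i′) ∙ (eⁱ′ ∙ fʲ)) ∙ fʲ′)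
        ≡⟨ cong (λ u → z^ a ∙ z^ a′ ∙ (u ∙ fʲ′)) (z^-swap (j ∧ i′) eⁱ (eⁱ′ ∙ fʲ)) ⟩
      z^ a ∙ z^ a′ ∙ (z^ (j ∧ i′) ∙ (eⁱ ∙ (eⁱ′ ∙ fʲ)) ∙ fʲ′)
        ≡⟨ solve 7 (λ a b k x x′ y y′ → a ⊕ b ⊕ (k ⊕ (x ⊕ (x′ ⊕ y)) ⊕ y′) ⊜ a ⊕ b ⊕ k ⊕ ((x ⊕ x′) ⊕ (y ⊕ y′))) refl
          (z^ a) (z^ a′) (z^ (j ∧ i′)) eⁱ eⁱ′ fʲ fʲ′ ⟩
      z^ a ∙ z^ a′ ∙ z^ (j ∧ i′) ∙ ((eⁱ ∙ eⁱ′) ∙ (fʲ ∙ fʲ′))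
        ≡⟨ cong₂ _∙_ (trans (cong (_∙ z^ (j ∧ i′)) (sym (z^-xor a a′))) (sym (z^-xor (a xor a′) (j ∧ i′))))
                                                                  (cong₂ _∙_ (pow-xor se i i′) (pow-xor sf j j′)) ⟩
      word ((a , i , j) ⊛ (a′ , i′ , j′))                    ∎)
      where
      open ≡-Reasoning
      eⁱ  = pow e i
      eⁱ′ = pow e i′
      fʲ  = pow f j
      fʲ′ = pow f j′

    word-z : ∀ a → word (a , false , false) ≡ z^ a
    word-z a = trans (cong (z^ a ∙_) (identityˡ ε)) (identityʳ _)

    c-word : ∀ a i j y → c (word (a , i , j)) y ≡ (i ∧ c e y) xor (j ∧ c f y)
    c-word a i j y = trans (c-∙ˡ (z^ a) _ y) (trans (cong (_xor c (pow e i ∙ pow f j) y) (c-z^ a y))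
      (trans (c-∙ˡ (pow e i) (pow f j) y) (cong₂ _xor_ (c-pow e i y) (c-pow f j y))))

    c-word-e : ∀ a i j → c (word (a , i , j)) e ≡ j
    c-word-e a i j = trans (c-word a i j e) (trans (cong₂ _xor_ (trans (cong (i ∧_) (c-self e)) (∧-zeroʳ i))
      (trans (cong (j ∧_) (trans (c-sym f e) cef)) (∧-identityʳ j))) refl)

    c-word-f : ∀ a i j → c (word (a , i , j)) f ≡ i
    c-word-f a i j = trans (c-word a i j f) (trans (cong₂ _xor_ (trans (cong (i ∧_) cef) (∧-identityʳ i))
      (trans (cong (j ∧_) (c-self f)) (∧-zeroʳ j))) (xor-identityʳ i))

    c-word-complement : ∀ t {u} → complement ∋ u → c (word t) u ≡ false
    c-word-complement (a , i , j) {u} ((_ , ceu) , cfu) = trans (c-word a i j u)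
      (cong₂ _xor_ (trans (cong (i ∧_) ceu) (∧-zeroʳ i)) (trans (cong (j ∧_) cfu) (∧-zeroʳ j)))

    word∈ : ∀ t → S ∋ word t
    word∈ (a , i , j) = Sub.∙∈ S (z^∈ a) (Sub.∙∈ S (pow∈ e∈ i) (pow∈ f∈ j))
      where
      pow∈ : ∀ {x} → S ∋ x → ∀ b → S ∋ pow x b
      pow∈ x∈ false = Sub.ε∈ S
      pow∈ x∈ true  = x∈
      z^∈ : ∀ b → S ∋ z^ b
      z^∈ false = Sub.ε∈ S
      z^∈ true  = z∈S

    -- Since c(e,f) = 1, pairing u with f reads its exponent of e and pairing with e reads its
    -- exponent of f. Dividing by that word leaves an element commuting with both. The z-exponent is
    -- set to `false` because z belongs to the complement.
    decompose : ∀ {u} → S ∋ u → complement ∋ (word (false , c u f , c u e) ⁻¹ ∙ u)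
    decompose {u} u∈ = (Sub.∙∈ S (Sub.⁻¹∈ S (word∈ t)) u∈ ,
        trans (c-sym e _) (trans (c-∙ˡ (word t ⁻¹) u e)
          (trans (cong (_xor c u e) (trans (c-⁻¹ˡ (word t) e) (c-word-e false (c u f) (c u e)))) (xor-same (c u e))))) ,
        trans (c-sym f _) (trans (c-∙ˡ (word t ⁻¹) u f)
          (trans (cong (_xor c u f) (trans (c-⁻¹ˡ (word t) f) (c-word-f false (c u f) (c u e)))) (xor-same (c u f))))
      where t = false , c u f , c u e

  -- An orthogonal decomposition of S into k hyperbolic planes and ⟨z⟩.
  data Frame : ℕ → Sub 𝔾 → Set₁ where
    nil  : ∀ {S} → (∀ {u} → S ∋ u → u ≡ ε ⊎ u ≡ z) → Frame 0 S
    cons : ∀ {k S} (z∈S : S ∋ z) (pair : HyperbolicPair S) → Frame k (Plane.complement z∈S pair) → Frame (suc k) S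

  |frame| : ∀ {k S} → S ∋ z → Frame k S → size S ≡ 2 * 4 ^ k
  |frame| {S = S} z∈S (nil S⊆Z) = trans (count-cong (mem? S) z∈? (λ _ → S⊆Z) (λ { _ (inj₁ refl) → Sub.ε∈ S ; _ (inj₂ refl) → z∈S })) |Z|≡2
  |frame| {suc k} {S} _ (cons z∈S pair F) = trans |S|≡4|complement| (trans (cong (4 *_) (|frame| z∈complement F))
      (trans (sym (ℕ.*-assoc 4 2 (4 ^ k))) (ℕ.*-assoc 2 4 (4 ^ k))))
    where open Plane z∈S pair

  module Build (E : Sub 𝔾) (maxE : IsMaximalSingular E) where
    open IsMaximalSingular maxE

    private
      -- Two invariants pass to complements: c is nondegenerate on S modulo ⟨z⟩, and E ∩ S contains
      -- all of S that is orthogonal to it. If E ∩ S is only ⟨z⟩, the second gives S = ⟨z⟩;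
      -- otherwise E ∩ S supplies the e of a hyperbolic pair.
      build : (S : Sub 𝔾) → S ∋ z → (∀ {u} → S ∋ u → (∀ v → S ∋ v → c u v ≡ false) → u ≡ ε ⊎ u ≡ z) →
              (∀ {u} → S ∋ u → (∀ x → E ∋ x → S ∋ x → c u x ≡ false) → E ∋ u) →
              Acc _<_ (size S) → ∃[ k ] Frame k S
      build S z∈S nondeg maxS (acc rs) with any? (λ x → (mem? E x ×-dec mem? S x) ×-dec ¬? (z∈? x))
      ... | no ∄x = 0 , nil λ {u} u∈ → in-Z u∈ (maxS u∈ λ x x∈E x∈S → central⇒false (in-Z x∈S x∈E) u)
        where
        in-Z : ∀ {u} → S ∋ u → E ∋ u → u ≡ ε ⊎ u ≡ z
        in-Z {u} u∈S u∈E = decidable-stable (z∈? u) λ u∉Z → ∄x (u , (u∈E , u∈S) , u∉Z)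
      ... | yes (e , (e∈E , e∈S) , e∉Z) with any? (λ f → mem? S f ×-dec (c e f ≟ᵇ true))
      ...   | no ∄f = contradiction (nondeg e∈S λ v v∈ → ¬-not λ eq → ∄f (v , v∈ , eq)) e∉Z
      ...   | yes (f₀ , f₀∈ , cef₀) = suc (proj₁ rest) , cons z∈S pair (proj₂ rest)
        where
        -- A partner of e can be made singular: if s(f₀) = 1, then s(f₀e) = s(f₀) + s(e) + c(f₀,e) =
        -- 1 + 0 + 1 = 0.
        choose : ∀ b → s f₀ ≡ b → HyperbolicPair S
        choose false sf = record { e = e ; f = f₀ ; e∈ = e∈S ; f∈ = f₀∈ ; se = singular e∈E ; sf = sf ; cef = cef₀ }
        choose true  sf = record { e = e ; f = f₀ ∙ e ; e∈ = e∈S ; f∈ = Sub.∙∈ S f₀∈ e∈S ; se = singular e∈E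
          ; sf  = trans (s-∙ f₀ e) (cong₂ _xor_ (cong₂ _xor_ sf (singular e∈E)) (trans (c-sym f₀ e) cef₀))
          ; cef = trans (c-∙ʳ e f₀ e) (cong₂ _xor_ cef₀ (c-self e)) }
        same-e : ∀ b eq → HyperbolicPair.e (choose b eq) ≡ e
        same-e false _ = refl
        same-e true  _ = refl
        pair = choose (s f₀) refl
        open Plane z∈S pair
        open HyperbolicPair pair using (f) renaming (e to e′)
        e′∈E : E ∋ e′
        e′∈E = subst (E ∋_) (sym (same-e (s f₀) refl)) e∈E
        c-perp : ∀ {u} t → complement ∋ u → c u (word t) ≡ false
        c-perp {u} t u∈ = trans (c-sym u (word t)) (c-word-complement t u∈)
        nondeg′ : ∀ {u} → complement ∋ u → (∀ v → complement ∋ v → c u v ≡ false) → u ≡ ε ⊎ u ≡ z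
        nondeg′ {u} u∈ h = nondeg (proj₁ (proj₁ u∈)) λ v v∈ → let t = false , c v f , c v e′ in
          trans (cong (c u) (sym (x∙x⁻¹y (word t) v)))
            (trans (c-∙ʳ u (word t) (word t ⁻¹ ∙ v)) (cong₂ _xor_ (c-perp t u∈) (h _ (decompose v∈))))
        -- An x in E commutes with e′, so its component in the plane is a power of e′ and lies in E.
        -- Hence its component in the complement lies in E as well.
        max′ : ∀ {u} → complement ∋ u → (∀ x → E ∋ x → complement ∋ x → c u x ≡ false) → E ∋ u
        max′ {u} u∈@((u∈S , ce′u) , cfu) h = maxS u∈S λ x x∈E x∈S →
          let t = false , c x f , c x e′
              word≡ : word t ≡ pow e′ (c x f)
              word≡ = trans (cong (λ j → ε ∙ (pow e′ (c x f) ∙ pow f j)) (isotropic x∈E e′∈E))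
                (trans (identityˡ _) (identityʳ _))
          in trans (cong (c u) (sym (x∙x⁻¹y (word t) x))) (trans (c-∙ʳ u (word t) (word t ⁻¹ ∙ x))
               (cong₂ _xor_ (c-perp t u∈)
                 (h _ (Sub.∙∈ E (Sub.⁻¹∈ E (subst (E ∋_) (sym word≡) (pow∈E (c x f)))) x∈E) (decompose x∈S))))
          where
          pow∈E : ∀ b → E ∋ pow e′ b
          pow∈E false = Sub.ε∈ E
          pow∈E true  = e′∈E
        smaller : size complement < size S
        smaller = subst (size complement <_) (sym |S|≡4|complement|)
          (ℕ.m<m+n (size complement)
            (ℕ.<-≤-trans (count-pos (mem? complement) (Sub.ε∈ complement)) (ℕ.m≤m+n (size complement) _)))
        rest : ∃[ k ] Frame k complement
        rest = build complement z∈complement nondeg′ max′ (rs smaller)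

    frame : ∃[ k ] Frame k whole-sub
    frame = build whole-sub tt (λ _ h → nondegenerate (λ y → h y tt)) (λ _ h → maximal (λ x x∈ → h x x∈ tt))
      (<-wellFounded _)

module _ {c₁ ℓ₁ c₂ ℓ₂} (G : Group c₁ ℓ₁) (H : Group c₂ ℓ₂) where
  private
    module G = Group G
    module H = Group H
  open GroupProperties H using (identityʳ-unique; inverseʳ-unique)

  mk≅ : (f : G.Carrier → H.Carrier) → (∀ {x y} → x G.≈ y → f x H.≈ f y) →
        (∀ x y → f (x G.∙ y) H.≈ f x H.∙ f y) → (∀ {x y} → f x H.≈ f y → x G.≈ y) →
        (∀ y → ∃[ x ] f x H.≈ y) → G ≅ H
  mk≅ f f-cong homo inj surj = f , record
    { isGroupMonomorphism = record
      { isGroupHomomorphism = record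
        { isMonoidHomomorphism = record
          { isMagmaHomomorphism = record { isRelHomomorphism = record { cong = f-cong } ; homo = homo }
          ; ε-homo = f-ε }
        ; ⁻¹-homo = λ x → inverseʳ-unique (f x) (f (x G.⁻¹))
            (H.trans (H.sym (homo x (x G.⁻¹))) (H.trans (f-cong (G.inverseʳ x)) f-ε)) }
      ; injective = inj }
    ; surjective = λ y → proj₁ (surj y) , λ z≈x → H.trans (f-cong z≈x) (proj₂ (surj y)) }
    where
    f-ε : f G.ε H.≈ H.ε
    f-ε = identityʳ-unique (f G.ε) (f G.ε) (H.trans (H.sym (homo G.ε G.ε)) (f-cong (G.identityˡ G.ε)))

≅-trans : ∀ {c₁ ℓ₁ c₂ ℓ₂ c₃ ℓ₃} (G : Group c₁ ℓ₁) (H : Group c₂ ℓ₂) (K : Group c₃ ℓ₃) → G ≅ H → H ≅ K → G ≅ K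
≅-trans G H K (f , f-iso) (g , g-iso) = g ∘ f , isGroupIsomorphism (Group.trans K) f-iso g-iso

open MonoidSum (Group.monoid D₈.group) using () renaming (sum to prod; sum-cong-≗ to prod-cong)

prod-single : ∀ {m} (f : Fin m → D₈.Carrier) i → (∀ k → ¬ k ≡ i → f k ≡ D₈.ε) → prod f ≡ f i
prod-single {suc m} f zero h = trans
  (cong (D₈._∙_ (f zero)) (trans (prod-cong (λ k → h (suc k) λ ())) (prod-ε D₈.group m)))
                                     (D₈.idʳ (f zero))
prod-single {suc m} f (suc i) h = trans
  (cong₂ D₈._∙_ (h zero λ ()) (prod-single (f ∘ suc) i (λ k ne → h (suc k) (ne ∘ suc-injective))))
                                        (D₈.idˡ (f (suc i)))

-- From frames to central powers of D₈ and back

module CentralProduct {n : ℕ} (𝔾 : FinGroup n) (ext : Extraspecial 𝔾) where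
  open FinGroup 𝔾
  open Extraspecial ext
  open Theory 𝔾
  open Sub using (size; mem?)
  open Quadratic 𝔾 ext
  open Singular 𝔾 ext
  open Frames 𝔾 ext
  open D₈Coordinates

  embed : ∀ {k S} → Frame k S → (Fin k → D₈) → Fin n
  embed (nil _)           g = ε
  embed (cons z∈S pair F) g = word (coords (g zero)) ∙ embed F (g ∘ suc)
    where open Plane z∈S pair

  embed∈ : ∀ {k S} (F : Frame k S) g → S ∋ embed F g
  embed∈ {S = S} (nil _)           g = Sub.ε∈ S
  embed∈ {S = S} (cons z∈S pair F) g = Sub.∙∈ S (word∈ (coords (g zero))) (proj₁ (proj₁ (embed∈ F (g ∘ suc))))
    where open Plane z∈S pair

  embed-cong : ∀ {k S} (F : Frame k S) {g h} → (∀ i → g i ≡ h i) → embed F g ≡ embed F h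
  embed-cong (nil _)           eq = refl
  embed-cong (cons z∈S pair F) eq = cong₂ (λ x → word (coords x) ∙_) (eq zero) (embed-cong F (eq ∘ suc))
    where open Plane z∈S pair

  embed-homo : ∀ {k S} (F : Frame k S) g h → embed F (λ i → g i · h i) ≡ embed F g ∙ embed F h
  embed-homo (nil _)           g h = sym (identityˡ ε)
  embed-homo (cons z∈S pair F) g h = begin
    word (coords (g₀ · h₀)) ∙ embed F (λ i → g (suc i) · h (suc i))
      ≡⟨ cong₂ _∙_ (trans (cong word (coords-· g₀ h₀)) (word-⊛ (coords g₀) (coords h₀)))
        (embed-homo F (g ∘ suc) (h ∘ suc)) ⟩
    word (coords g₀) ∙ word (coords h₀) ∙ (G ∙ H)
      ≡⟨ solve 4 (λ a b c d → a ⊕ b ⊕ (c ⊕ d) ⊜ a ⊕ (b ⊕ c) ⊕ d) refl (word (coords g₀)) (word (coords h₀)) G H ⟩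
    word (coords g₀) ∙ (word (coords h₀) ∙ G) ∙ H
      ≡⟨ cong (λ u → word (coords g₀) ∙ u ∙ H) (commute-c (c-word-complement (coords h₀) (embed∈ F (g ∘ suc)))) ⟩
    word (coords g₀) ∙ (G ∙ word (coords h₀)) ∙ H
      ≡⟨ solve 4 (λ a b c d → a ⊕ (c ⊕ b) ⊕ d ⊜ a ⊕ c ⊕ (b ⊕ d)) refl (word (coords g₀)) (word (coords h₀)) G H ⟩
    word (coords g₀) ∙ G ∙ (word (coords h₀) ∙ H)     ∎
    where
    open ≡-Reasoning
    open GroupSolver group using (solve; _⊜_; _⊕_)
    open Plane z∈S pair
    g₀ = g zero
    h₀ = h zero
    G  = embed F (g ∘ suc)
    H  = embed F (h ∘ suc)

  -- Commuting with e and f of a plane kills the exponents of f and e in that component, because the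
  -- remaining factors commute with both.
  embed-central : ∀ {k S} (F : Frame k S) g → (∀ y → c (embed F g) y ≡ false) → ∀ i → ∃[ a ] coords (g i) ≡
    (a , false , false)
  embed-central (cons {k} z∈S pair F) g central = λ { zero → a , coords≡ ; (suc i) → embed-central F (g ∘ suc) rest i }
    where
    open Plane z∈S pair
    open HyperbolicPair pair using (e; f)
    w = word (coords (g zero))
    G = embed F (g ∘ suc)
    G∈ : complement ∋ G
    G∈ = embed∈ F (g ∘ suc)
    a = proj₁ (coords (g zero))
    c-w : ∀ y → c G y ≡ false → c w y ≡ false
    c-w y eq = trans (sym (xor-identityʳ _)) (trans (cong (c w y xor_) (sym eq)) (trans (sym (c-∙ˡ w G y)) (central y)))
    coords≡ : coords (g zero) ≡ (a , false , false)
    coords≡ = cong₂ (λ i j → a , i , j)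
      (trans (sym (c-word-f a _ (proj₂ (proj₂ (coords (g zero)))))) (c-w f (trans (c-sym G f) (proj₂ G∈))))
      (trans (sym (c-word-e a (proj₁ (proj₂ (coords (g zero)))) _)) (c-w e (trans (c-sym G e) (proj₂ (proj₁ G∈)))))
    rest : ∀ y → c G y ≡ false
    rest y = trans (cong (_xor c G y)
      (sym (trans (cong (λ v → c v y) (trans (cong word coords≡) (word-z a))) (c-z^ a y))))
      (trans (sym (c-∙ˡ w G y)) (central y))

  -- A central tuple goes to the power of z given by its product in D₈. With `embed-central` this
  -- identifies the kernel of `embed` with `CentralKernel`.
  embed-of-central : ∀ {k S} (F : Frame k S) g → (∀ i → ∃[ a ] coords (g i) ≡ (a , false , false)) →
                     ∃[ a ] coords (prod g) ≡ (a , false , false) × embed F g ≡ z^ a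
  embed-of-central (nil _) g central = false , refl , refl
  embed-of-central (cons z∈S pair F) g central with central zero | embed-of-central F (g ∘ suc) (central ∘ suc)
  ... | a , eq | b , eqs , eqv = a xor b ,
        trans (coords-· (g zero) (prod (g ∘ suc)))
          (trans (cong₂ _⊛_ eq eqs) (cong (_, (false , false)) (xor-identityʳ (a xor b)))) ,
        trans (cong₂ _∙_ (trans (cong word eq) (word-z a)) eqv) (sym (z^-xor a b))
    where open Plane z∈S pair

  -- An empty frame has trivial image and misses z. Once there is a plane, the z-exponent left over
  -- by the later planes is absorbed into its coordinates; this is where m ≥ 1 enters.
  embed-onto-up-to-z : ∀ {k S} (F : Frame k S) {u} → S ∋ u → ∃[ b ] ∃[ g ] embed F g ∙ z^ b ≡ u
  embed-onto : ∀ {k S} (F : Frame (suc k) S) {u} → S ∋ u → ∃[ g ] embed F g ≡ u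

  embed-onto-up-to-z (nil S⊆Z) u∈ with S⊆Z u∈
  ... | inj₁ refl = false , (λ ()) , identityˡ ε
  ... | inj₂ refl = true  , (λ ()) , identityˡ z
  embed-onto-up-to-z F@(cons _ _ _) u∈ with embed-onto F u∈
  ... | g , eq = false , g , trans (identityʳ _) eq

  embed-onto {k} (cons z∈S pair F) {u} u∈ with embed-onto-up-to-z F (Plane.decompose z∈S pair u∈)
  ... | b , g′ , eq = g , (begin
      word (coords (fromCoords (b , i , j))) ∙ embed F g′
        ≡⟨ cong (λ t → word t ∙ embed F g′) (coords-fromCoords (b , i , j)) ⟩
      z^ b ∙ (pow e i ∙ pow f j) ∙ embed F g′              ≡⟨ cong (λ v → z^ b ∙ v ∙ embed F g′) (sym (identityˡ _)) ⟩
      z^ b ∙ w ∙ embed F g′                                ≡⟨ assoc _ _ _ ⟩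
      z^ b ∙ (w ∙ embed F g′)                              ≡⟨ z^-central b _ ⟩
      w ∙ embed F g′ ∙ z^ b                                ≡⟨ assoc _ _ _ ⟩
      w ∙ (embed F g′ ∙ z^ b)                              ≡⟨ cong (w ∙_) eq ⟩
      w ∙ (w ⁻¹ ∙ u)                                       ≡⟨ x∙x⁻¹y w u ⟩
      u                                                    ∎)
    where
    open ≡-Reasoning
    open Plane z∈S pair
    open HyperbolicPair pair using (e; f)
    i = c u f
    j = c u e
    w = word (false , i , j)
    g : Fin (suc k) → D₈
    g zero    = fromCoords (b , i , j)
    g (suc l) = g′ l

  -- The map picks preimages under `embed`. Tuples with equal image differ by an element of
  -- `CentralKernel`, which is equality in the central power, so the choice is harmless.
  frame⇒≅ : ∀ {m} → 1 ≤ⁿ m → Frame m whole-sub → group ≅ G[ m ,1]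
  frame⇒≅ {suc m} _ F = mk≅ group G[ suc m ,1] f (λ { {x} refl → Group.refl G[ suc m ,1] {f x} })
    (λ x y → reflects (f (x ∙ y)) (λ i → f x i · f y i)
      (trans (embed-f (x ∙ y)) (sym (trans (embed-homo F (f x) (f y)) (cong₂ _∙_ (embed-f x) (embed-f y))))))
    (λ {x} {y} eq → trans (sym (embed-f x)) (trans (respects (f x) (f y) eq) (embed-f y)))
    (λ g → embed F g , reflects (f (embed F g)) g (embed-f (embed F g)))
    where
    f : Fin n → Fin (suc m) → D₈
    f u = proj₁ (embed-onto F {u} tt)
    embed-f : ∀ u → embed F (f u) ≡ u
    embed-f u = proj₂ (embed-onto F {u} tt)
    _/_ : (g h : Fin (suc m) → D₈) → Fin (suc m) → D₈
    (g / h) i = g i · inv (h i)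
    quotient-eq : ∀ g h → embed F (g / h) ∙ embed F h ≡ embed F g
    quotient-eq g h = trans (sym (embed-homo F (g / h) h)) (embed-cong F λ i → begin
      (g i · inv (h i)) · h i    ≡⟨ Group.assoc D₈.group (g i) (inv (h i)) (h i) ⟩
      g i · (inv (h i) · h i)    ≡⟨ cong (g i ·_) (D₈.invˡ (h i)) ⟩
      g i · ε₈                   ≡⟨ D₈.idʳ (g i) ⟩
      g i                        ∎)
      where open ≡-Reasoning
    reflects : ∀ g h → embed F g ≡ embed F h → CentralKernel D₈.group (suc m) (g / h)
    reflects g h eq = (λ i → central⁺ (proj₂ (central i))) , coords-injective
      (trans (proj₁ (proj₂ value)) (cong (_, (false , false)) a≡false))
      where
      trivial : embed F (g / h) ≡ ε
      trivial = GroupProperties.identityˡ-unique group _ _ (trans (quotient-eq g h) eq)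
      central = embed-central F (g / h) (λ y → trans (cong (λ v → c v y) trivial) (c-εˡ y))
      value = embed-of-central F (g / h) central
      a≡false : proj₁ value ≡ false
      a≡false = z^-injective _ false (trans (sym (proj₂ (proj₂ value))) trivial)
    respects : ∀ g h → CentralKernel D₈.group (suc m) (g / h) → embed F g ≡ embed F h
    respects g h (cent , p) = trans (sym (quotient-eq g h)) (trans (cong (_∙ embed F h) trivial) (identityˡ _))
      where
      value = embed-of-central F (g / h) (λ i → central⁻ (cent i))
      trivial : embed F (g / h) ≡ ε
      trivial = trans (proj₂ (proj₂ value)) (cong z^ (cong proj₁ (trans (sym (proj₁ (proj₂ value))) (cong coords p))))

  maximalSingular⇒≅ : ∀ {m} → 1 ≤ⁿ m → n ≡ 2 ^ (2 * m + 1) → ∀ {E} → IsMaximalSingular E → group ≅ G[ m ,1]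
  maximalSingular⇒≅ {m} 1≤m n≡ {E} maxE with Build.frame E maxE
  ... | k , F = frame⇒≅ 1≤m (subst (λ k → Frame k whole-sub) k≡m F)
    where
    open ≡-Reasoning
    4^k≡4^m : 4 ^ k ≡ 4 ^ m
    4^k≡4^m = ℕ.*-cancelˡ-≡ _ _ 2 (begin
      2 * 4 ^ k           ≡⟨ |frame| tt F ⟨
      size whole-sub      ≡⟨ |whole| ⟩
      n                   ≡⟨ n≡ ⟩
      2 ^ (2 * m + 1)     ≡⟨ cong (2 ^_) (ℕ.+-comm (2 * m) 1) ⟩
      2 * 2 ^ (2 * m)     ≡⟨ cong (2 *_) (ℕ.^-*-assoc 2 2 m) ⟨
      2 * 4 ^ m           ∎)
    k≡m : k ≡ m
    k≡m = ^-injectiveʳ k m 4^k≡4^m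
      where
      ^-injectiveʳ : ∀ k m → 4 ^ k ≡ 4 ^ m → k ≡ m
      ^-injectiveʳ k m eq with ℕ.<-cmp k m
      ... | tri< lt _ _ = contradiction eq (ℕ.<⇒≢ (ℕ.^-monoʳ-< 4 (s≤s (s≤s z≤n)) lt))
      ... | tri≈ _ e _  = e
      ... | tri> _ _ gt = contradiction (sym eq) (ℕ.<⇒≢ (ℕ.^-monoʳ-< 4 (s≤s (s≤s z≤n)) gt))

  module FromIso {m} (iso : group ≅ G[ m ,1]) where
    open GroupMorphisms (Group.rawGroup group) (Group.rawGroup G[ m ,1]) using (IsGroupIsomorphism)
    private
      α : Fin n → Fin m → D₈
      α = proj₁ iso
      module α = IsGroupIsomorphism (proj₂ iso)
      module Gm = Group G[ m ,1]

      fCoord-· : ∀ x y → fCoord (x · y) ≡ fCoord x xor fCoord y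
      fCoord-· x y = cong (λ t → proj₂ (proj₂ t)) (coords-· x y)

      ≈⇒fCoord : ∀ {g h : Fin m → D₈} → g Gm.≈ h → ∀ i → fCoord (g i) ≡ fCoord (h i)
      ≈⇒fCoord {g} {h} (cent , _) i = begin
        fCoord (g i)
          ≡⟨ cong fCoord (trans (sym (D₈.idʳ (g i))) (cong (g i ·_) (sym (D₈.invˡ (h i))))) ⟩
        fCoord (g i · (inv (h i) · h i))           ≡⟨ cong fCoord (Group.assoc D₈.group (g i) (inv (h i)) (h i)) ⟨
        fCoord ((g i · inv (h i)) · h i)           ≡⟨ fCoord-· (g i · inv (h i)) (h i) ⟩
        fCoord (g i · inv (h i)) xor fCoord (h i)
          ≡⟨ cong (_xor fCoord (h i)) (cong (λ t → proj₂ (proj₂ t)) (proj₂ (central⁻ (cent i)))) ⟩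
        fCoord (h i)                               ∎
        where open ≡-Reasoning

      pointwise⇒≈ : ∀ {g h : Fin m → D₈} → (∀ i → g i ≡ h i) → g Gm.≈ h
      pointwise⇒≈ {g} {h} eq = IsNormalSubgroup.resp (centralKernel-isNormal D₈.group m)
        (λ i → sym (trans (cong (_· inv (h i)) (eq i)) (D₈.invʳ (h i))))
          (IsNormalSubgroup.ε-closed (centralKernel-isNormal D₈.group m))

      J : Fin m → Fin n → Bool
      J i u = fCoord (α u i)

      J-∙ : ∀ i u v → J i (u ∙ v) ≡ J i u xor J i v
      J-∙ i u v = trans (≈⇒fCoord {α (u ∙ v)} {α u Gm.∙ α v} (α.∙-homo u v) i) (fCoord-· (α u i) (α v i))

      J-ε : ∀ i → J i ε ≡ false
      J-ε i = ≈⇒fCoord {α ε} {Gm.ε} α.ε-homo i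

    -- The preimage of the product of the four-groups ⟨z , e⟩ of all factors. It respects equality
    -- in the central power because `fCoord` is additive and vanishes on the centre of D₈.
    E : Sub 𝔾
    E = record
      { mem  = λ u → ∀ i → J i u ≡ false
      ; mem? = λ u → all? (λ i → J i u ≟ᵇ false)
      ; ε∈   = J-ε
      ; ∙∈   = λ {u} {v} u∈ v∈ i → trans (J-∙ i u v) (cong₂ _xor_ (u∈ i) (v∈ i))
      ; ⁻¹∈  = λ {u} u∈ i → trans (sym (trans (J-∙ i u (u ⁻¹)) (cong (_xor J i (u ⁻¹)) (u∈ i)))) (trans (cong (J i) (inverseʳ u)) (J-ε i))
      }

    private
      E-singular : ∀ {u} → E ∋ u → s u ≡ false
      E-singular {u} u∈ = s-unique false (α.injective (begin
          α (u ∙ u)       ≈⟨ α.∙-homo u u ⟩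
          α u Gm.∙ α u    ≈⟨ pointwise⇒≈ {α u Gm.∙ α u} {Gm.ε} square-trivial ⟩
          Gm.ε            ≈⟨ α.ε-homo ⟨
          α ε             ∎))
        where
        open SetoidReasoning Gm.setoid
        square-coords : ∀ t → proj₂ (proj₂ t) ≡ false → t ⊛ t ≡ (false , false , false)
        square-coords (a , i , .false) refl = cong₂ _,_ (trans (xor-identityʳ (a xor a)) (xor-same a))
          (cong (_, false) (xor-same i))
        square-trivial : ∀ i → α u i · α u i ≡ ε₈
        square-trivial i = coords-injective (trans (coords-· (α u i) (α u i)) (square-coords (coords (α u i)) (u∈ i)))

      single : Fin m → D₈ → Fin m → D₈
      single i t k with k ≟ i
      ... | yes _ = t
      ... | no  _ = ε₈

      single-≡ : ∀ i t → single i t i ≡ t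
      single-≡ i t with i ≟ i
      ... | yes _ = refl
      ... | no ne = contradiction refl ne

      single-≢ : ∀ i t k → ¬ k ≡ i → single i t k ≡ ε₈
      single-≢ i t k ne with k ≟ i
      ... | yes eq = contradiction eq ne
      ... | no  _  = refl

      -- Commuting in the central power holds only up to `CentralKernel`. Away from slot i the two
      -- products agree, so the requirement that the product of all discrepancies be 1 makes slot i
      -- agree too.
      commutes-with-single : ∀ (g : Fin m → D₈) i t → (λ k → g k · single i t k) Gm.≈
        (λ k → single i t k · g k) → g i · t ≡ t · g i
      commutes-with-single g i t (_ , p) = subst (λ x → g i · x ≡ x · g i) (single-≡ i t)
        (Group.trans D₈.group (sym (D₈.idʳ (a i))) (trans (cong (a i ·_) (sym (D₈.invˡ (b i))))
          (trans (sym (Group.assoc D₈.group (a i) (inv (b i)) (b i))) (trans (cong (_· b i) at-i) (D₈.idˡ (b i))))))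
        where
        a b : Fin m → D₈
        a k = g k · single i t k
        b k = single i t k · g k
        off : ∀ k → ¬ k ≡ i → a k · inv (b k) ≡ ε₈
        off k ne = trans (cong₂ (λ x y → x · inv y) (trans (cong (g k ·_) (single-≢ i t k ne)) (D₈.idʳ (g k)))
          (trans (cong (_· g k) (single-≢ i t k ne)) (D₈.idˡ (g k)))) (D₈.invʳ (g k))
        at-i : a i · inv (b i) ≡ ε₈
        at-i = trans (sym (prod-single (λ k → a k · inv (b k)) i off)) p

      E-maximal : ∀ {u} → (∀ x → E ∋ x → c u x ≡ false) → E ∋ u
      E-maximal {u} h i = commutes-e⇒fCoord {α u i} (commutes-with-single (α u) i t (begin
          α u Gm.∙ single i t   ≈⟨ Gm.∙-cong {α u} {α u} {single i t} {α x} (Gm.refl {α u})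
            (Gm.sym {α x} {single i t} αx≈) ⟩
          α u Gm.∙ α x          ≈⟨ α.∙-homo u x ⟨
          α (u ∙ x)             ≈⟨ α.⟦⟧-cong (commute-c (h x x∈)) ⟩
          α (x ∙ u)             ≈⟨ α.∙-homo x u ⟩
          α x Gm.∙ α u          ≈⟨ Gm.∙-cong {α x} {single i t} {α u} {α u} αx≈ (Gm.refl {α u}) ⟩
          single i t Gm.∙ α u   ∎))
        where
        open SetoidReasoning Gm.setoid
        t = fromCoords (false , true , false)
        x = proj₁ (α.surjective (single i t))
        αx≈ : α x Gm.≈ single i t
        αx≈ = proj₂ (α.surjective (single i t)) refl
        x∈ : E ∋ x
        x∈ k = trans (≈⇒fCoord {α x} {single i t} αx≈ k) (fCoord-single k)
          where
          fCoord-single : ∀ k → fCoord (single i t k) ≡ false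
          fCoord-single k with k ≟ i
          ... | yes _ = refl
          ... | no  _ = refl

    maximalSingular : IsMaximalSingular E
    maximalSingular = record { z∈ = E-maximal (λ x _ → c-zˡ x) ; singular = E-singular ; maximal = E-maximal }

-- Transport to Fin n

subset : {P : Pred (Fin n) 0ℓ} → Decidable P → Subset n
subset P? = tabulate (does ∘ P?)

∈-subset⁺ : (P? : Decidable P) → ∀ {i} → P i → i ∈ˢ subset P?
∈-subset⁺ P? {i} p = lookup⇒[]= i _ (trans (lookup∘tabulate (does ∘ P?) i) (dec-true (P? i) p))

∈-subset⁻ : (P? : Decidable P) → ∀ {i} → i ∈ˢ subset P? → P i
∈-subset⁻ P? {i} i∈ with P? i | trans (sym (lookup∘tabulate (does ∘ P?) i)) ([]=⇒lookup i∈)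
... | yes p | _  = p
... | no  _ | ()

count-∈ : (A : Subset n) → count (_∈? A) ≡ Subset.∣ A ∣
count-∈ []            = refl
count-∈ (inside  ∷ A) = cong suc
  (trans (count-cong (λ i → suc i ∈? (inside ∷ A)) (_∈? A) (λ _ → drop-there) (λ _ → there)) (count-∈ A))
count-∈ (outside ∷ A) = trans (count-cong (λ i → suc i ∈? (outside ∷ A)) (_∈? A) (λ _ → drop-there) (λ _ → there))
  (count-∈ A)

count≡1⇒unique : (P? : Decidable P) → count P? ≡ 1 → ∀ {a b} → P a → P b → b ≡ a
count≡1⇒unique P? eq {a} {b} pa pb =
  count-⊆-≥ (_≟ a) P? (λ { _ refl → pa }) (ℕ.≤-reflexive (trans eq (sym (count-≟ a)))) b pb

module Indexing {c ℓ} (G : FiniteGroup c ℓ) where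
  private
    module G = FiniteGroup G
  open G public using (index; element; index-element; element-index; index-injective)

  index-cong : ∀ {x y} → x G.≈ y → index x ≡ index y
  index-cong = Inverse.to-cong G.enum

  abstract
    -- Abstract, so that later terms meet the operations only through `index-∙`, `index-⁻¹` and
    -- `index-ε`.
    finGroup : FinGroup G.order
    finGroup = record
      { _∙_     = λ i j → index (element i G.∙ element j)
      ; ε       = index G.ε
      ; _⁻¹     = λ i → index (element i G.⁻¹)
      ; isGroup = record
        { isMonoid = record
          { isSemigroup = record
            { isMagma = record { isEquivalence = isEquivalence ; ∙-cong = cong₂ _ }
            ; assoc   = λ i j k → index-cong (G.trans (G.∙-congʳ (element-index _))
                          (G.trans (G.assoc _ _ _) (G.∙-congˡ (G.sym (element-index _)))))
            }
          ; identity = (λ i → trans (index-cong (G.trans (G.∙-congʳ (element-index _)) (G.identityˡ _)))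
            (index-element i)) ,
                       (λ i → trans (index-cong (G.trans (G.∙-congˡ (element-index _)) (G.identityʳ _)))
                         (index-element i))
          }
        ; inverse = (λ i → index-cong (G.trans (G.∙-congʳ (element-index _)) (G.inverseˡ _))) ,
                    (λ i → index-cong (G.trans (G.∙-congˡ (element-index _)) (G.inverseʳ _)))
        ; ⁻¹-cong = cong (λ i → index (element i G.⁻¹))
        }
      }

  open FinGroup finGroup

  abstract
    index-∙ : ∀ x y → index (x G.∙ y) ≡ index x ∙ index y
    index-∙ x y = index-cong (G.∙-cong (G.sym (element-index x)) (G.sym (element-index y)))

    index-⁻¹ : ∀ x → index (x G.⁻¹) ≡ index x ⁻¹
    index-⁻¹ x = index-cong (G.⁻¹-cong (G.sym (element-index x)))

    index-ε : index G.ε ≡ ε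
    index-ε = refl

  index-element-∙ : ∀ i j → index (element i G.∙ element j) ≡ i ∙ j
  index-element-∙ i j = trans (index-∙ _ _) (cong₂ _∙_ (index-element i) (index-element j))

  index-// : ∀ x y → index (x G.∙ y G.⁻¹) ≡ index x ∙ index y ⁻¹
  index-// x y = trans (index-∙ x (y G.⁻¹)) (cong (index x ∙_) (index-⁻¹ y))

  element-≅ : group ≅ G.group
  element-≅ = mk≅ group G.group element (λ { refl → G.refl }) (λ i j → index-injective (trans (index-element _) (sym (index-element-∙ i j))))
    (λ {i} {j} eq → trans (sym (index-element i)) (trans (index-cong eq) (index-element j))) (λ x → index x , element-index x)

  index-≅ : G.group ≅ group
  index-≅ = mk≅ G.group group index index-cong index-∙ index-injective (λ i → element i , index-element i)

  toSub : Subgroup G → Sub finGroup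
  toSub H = record
    { mem  = _∈ˢ members H
    ; mem? = _∈? members H
    ; ε∈   = subst (_∈ˢ members H) index-ε H.ε-closed
    ; ∙∈   = λ {i} {j} i∈ j∈ → subst (_∈ˢ members H) (index-element-∙ i j) (H.∙-closed (in-H i∈) (in-H j∈))
    ; ⁻¹∈  = λ {i} i∈ → subst (_∈ˢ members H) (trans (index-⁻¹ _) (cong _⁻¹ (index-element i))) (H.⁻¹-closed (in-H i∈))
    }
    where
    module H = Subgroup H
    in-H : ∀ {i} → i ∈ˢ members H → index (element i) ∈ˢ members H
    in-H {i} = subst (_∈ˢ members H) (sym (index-element i))

  fromSub : Sub finGroup → Subgroup G
  fromSub U = record
    { members   = subset mem?
    ; ε-closed  = ∈-subset⁺ mem? (subst mem (sym index-ε) ε∈)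
    ; ∙-closed  = λ {x} {y} x∈ y∈ → ∈-subset⁺ mem? (subst mem (sym (index-∙ x y)) (∙∈ (∈-subset⁻ mem? x∈) (∈-subset⁻ mem? y∈)))
    ; ⁻¹-closed = λ {x} x∈ → ∈-subset⁺ mem? (subst mem (sym (index-⁻¹ x)) (⁻¹∈ (∈-subset⁻ mem? x∈)))
    }
    where open Sub U

  size≡∥∥ : (H : Subgroup G) → Sub.size (toSub H) ≡ ∥ H ∥
  size≡∥∥ H = count-∈ (members H)

-- Perfect codes, transversals and matchings

module _ {c ℓ} (G : FiniteGroup c ℓ) where
  private
    module G = FiniteGroup G
  open Indexing G
  open FinGroup finGroup
  open Theory finGroup
  open Codes finGroup
  open GroupSolver group using (solve; _⊜_; _⊕_; _⁻; e)

  -- A codeword y is within distance 1 of x iff xy⁻¹ ∈ {1} ∪ S. So the code condition factors each x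
  -- uniquely as ty with t in {1} ∪ S and y in H.
  perfectCode⇒transversal : (H : Subgroup G) → IsPerfectCodeOf G H → Transversal (toSub H)
  perfectCode⇒transversal H (conn , _ , code) = record
    { T         = T
    ; ⁻¹-closed = λ { (inj₁ refl) → inj₁ (solve 0 (e ⁻ ⊜ e) refl) ; (inj₂ s) → inj₂ (S-⁻¹ s) }
    ; rep       = λ i → i ∙ dom i ⁻¹
    ; rep∈      = rep∈
    ; ∼rep      = λ i → subst (toSub H ∋_) (sym (x⁻¹∙xy i _))
      (Sub.⁻¹∈ (toSub H) (proj₁ (proj₁ (proj₂ (code (element i))))))
    ; unique    = λ {i} {t} t∈ u → trans (solve 2 (λ i t → t ⊜ i ⊕ (t ⁻ ⊕ i) ⁻) refl i t) (cong (λ y → i ∙ y ⁻¹) (sym (dom-unique t∈ u)))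
    }
    where
    open ConnectionSet conn
    T : Fin G.order → Set
    T i = i ≡ ε ⊎ i ∈ˢ S
    S-⁻¹ : ∀ {i} → i ∈ˢ S → i ⁻¹ ∈ˢ S
    S-⁻¹ {i} i∈ = subst (_∈ˢ S) (trans (index-⁻¹ _) (cong _⁻¹ (index-element i)))
      (⁻¹-closed (subst (_∈ˢ S) (sym (index-element i)) i∈))
    dom : Fin G.order → Fin G.order
    dom i = index (proj₁ (code (element i)))
    rep∈ : ∀ i → T (i ∙ dom i ⁻¹)
    rep∈ i with proj₂ (proj₁ (proj₂ (code (element i))))
    ... | inj₁ eq = inj₁ (trans (cong (λ y → i ∙ y ⁻¹) (trans (sym (index-cong eq)) (index-element i))) (inverseʳ i))
    ... | inj₂ s = inj₂ (subst (_∈ˢ S) (solve 2 (λ i y → (y ⊕ i ⁻) ⁻ ⊜ i ⊕ y ⁻) refl i (dom i))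
          (S-⁻¹ (subst (_∈ˢ S) (trans (index-// _ (element i)) (cong (λ j → dom i ∙ j ⁻¹) (index-element i))) s)))
    dom-unique : ∀ {i t} → T t → toSub H ∋ (i ⁻¹ ∙ t) → dom i ≡ t ⁻¹ ∙ i
    dom-unique {i} {t} t∈ u = trans (index-cong (proj₂ (proj₂ (code (element i))) (y∈ , dist t∈))) (index-element _)
      where
      y∈ : index (element (t ⁻¹ ∙ i)) ∈ˢ members H
      y∈ = subst (_∈ˢ members H) (trans (solve 2 (λ i t → (i ⁻ ⊕ t) ⁻ ⊜ t ⁻ ⊕ i) refl i t) (sym (index-element _)))
        (Sub.⁻¹∈ (toSub H) u)
      dist : T t → element i G.≈ element (t ⁻¹ ∙ i) ⊎ index (element (t ⁻¹ ∙ i) G.∙ element i G.⁻¹) ∈ˢ S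
      dist (inj₁ refl) = inj₁ (Inverse.from-cong G.enum (solve 1 (λ i → i ⊜ e ⁻ ⊕ i) refl i))
      dist (inj₂ s) = inj₂ (subst (_∈ˢ S) (trans (solve 2 (λ i t → t ⁻ ⊜ t ⁻ ⊕ i ⊕ i ⁻) refl i t)
        (sym (trans (index-// _ _) (cong₂ (λ a b → a ∙ b ⁻¹) (index-element _) (index-element i))))) (S-⁻¹ s))

  -- For x outside H the codeword is s⁻¹x, where s represents xH. As `S` avoids H, no two elements
  -- of H are adjacent.
  matching⇒perfectCode : (H : Subgroup G) → Matchings.Matching finGroup (toSub H)
    (λ x → ¬ toSub H ∋ x) → IsPerfectCodeOf G H
  matching⇒perfectCode H M = conn , independent , code
    where
    module M = Matchings.Matching M
    module h = Sub (toSub H)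
    S∉H : ∀ {i} → i ∈ˢ subset M.S? → ¬ i ∈ˢ members H
    S∉H = M.S⊆P ∘ ∈-subset⁻ M.S?
    conn : ConnectionSet G
    conn = record
      { S         = subset M.S?
      ; ε∉S       = λ ε∈S → S∉H ε∈S (Subgroup.ε-closed H)
      ; ⁻¹-closed = λ {x} s → ∈-subset⁺ M.S? (subst M.S (sym (index-⁻¹ x)) (M.⁻¹-closed (∈-subset⁻ M.S? s)))
      }
    independent : ∀ {x y} → index x ∈ˢ members H → index y ∈ˢ members H → ¬ index (y G.∙ x G.⁻¹) ∈ˢ subset M.S?
    independent {x} {y} x∈ y∈ s = S∉H s (subst (_∈ˢ members H) (sym (index-// y x)) (h.∙∈ y∈ (h.⁻¹∈ x∈)))
    code : ∀ x → ∃! G._≈_ λ y → index y ∈ˢ members H × DistanceAtMost1 (Cay G conn) x y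
    code x with index x ∈? members H
    ... | yes x∈ = x , (x∈ , inj₁ G.refl) , λ
      { (_ , inj₁ eq) → eq ; (y∈ , inj₂ s) → contradiction s (independent x∈ y∈) }
    ... | no x∉ with M.rep x∉
    ...   | s , s∈ , u , uniq = element (s ⁻¹ ∙ i) ,
        (subst (_∈ˢ members H) (trans (solve 2 (λ i s → (i ⁻ ⊕ s) ⁻ ⊜ s ⁻ ⊕ i) refl i s) (sym (index-element _)))
          (h.⁻¹∈ u) ,
         inj₂ (∈-subset⁺ M.S? (subst M.S (trans (solve 2 (λ i s → s ⁻ ⊜ s ⁻ ⊕ i ⊕ i ⁻) refl i s)
           (sym (trans (index-// _ x) (cong (λ a → a ∙ i ⁻¹) (index-element _))))) (M.⁻¹-closed s∈)))) ,
        λ { (y∈ , inj₁ eq) → contradiction (subst (_∈ˢ members H) (sym (index-cong eq)) y∈) x∉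
          ; {y} (y∈ , inj₂ s′) → index-injective
            (trans (index-element _) (sym (y≡ y y∈ (subst M.S (index-// y x) (∈-subset⁻ M.S? s′))))) }
      where
      i = index x
      y≡ : ∀ y → index y ∈ˢ members H → M.S (index y ∙ i ⁻¹) → index y ≡ s ⁻¹ ∙ i
      y≡ y y∈ t∈ = trans (solve 2 (λ i y → y ⊜ ((y ⊕ i ⁻) ⁻) ⁻ ⊕ i) refl i (index y)) (cong (λ t → t ⁻¹ ∙ i)
        (uniq (M.⁻¹-closed t∈) (subst (_∈ˢ members H) (solve 2 (λ i y → y ⁻ ⊜ i ⁻ ⊕ (y ⊕ i ⁻) ⁻) refl i (index y))
          (h.⁻¹∈ y∈))))

-- Extraspecial groups by elements

module _ {c ℓ} (X : FiniteGroup c ℓ) where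
  private
    module X = FiniteGroup X
  open Indexing X
  open FinGroup finGroup
  open GroupProperties group using (identityʳ-unique; x∙y⁻¹≈ε⇒x≈y; ε⁻¹≈ε)
  open GroupSolver group using (solve; _⊜_; _⊕_; _⁻)

  -- Stated for a subgroup Z that is given abstractly: the comprehension defining the centre must not be unfolded.
  extraspecial-from : (Z : Subgroup X) → ∥ Z ∥ ≡ 2 →
    (∀ {x} → IsCentral X.group x → index x ∈ˢ members Z) → (∀ {x} → index x ∈ˢ members Z → IsCentral X.group x) →
    (∀ x y → index ((x X.∙ y) X.∙ (y X.∙ x) X.⁻¹) ∈ˢ members Z) → (∀ x → index ((x X.∙ x) X.∙ X.ε X.⁻¹) ∈ˢ members Z) →
    Extraspecial finGroup
  extraspecial-from Z |Z|≡2 ∈Z⁺ ∈Z⁻ abelian exponent = record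
    { z         = z
    ; z≢ε       = z≢ε
    ; z²≡ε      = [ id , (λ eq → contradiction (identityʳ-unique z z eq) z≢ε) ]′ (Z⊆ (Sub.∙∈ (toSub Z) z∈ z∈))
    ; z-central = central⁻ z∈
    ; central⇒Z = Z⊆ ∘ central⁺
    ; commute   = λ x y → Sum.map (x∙y⁻¹≈ε⇒x≈y (x ∙ y) (y ∙ x))
      (λ eq → trans (move (x ∙ y) (y ∙ x)) (cong (_∙ (y ∙ x)) eq))
        (Z⊆ (subst (_∈ˢ members Z)
          (trans (index-// _ _) (cong₂ (λ u v → u ∙ v ⁻¹) (index-element-∙ x y) (index-element-∙ y x)))
            (abelian (element x) (element y))))
    ; square    = λ x → Z⊆ (subst (_∈ˢ members Z)
        (trans (index-// _ X.ε) (trans (cong₂ (λ u v → u ∙ v ⁻¹) (index-element-∙ x x) index-ε)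
          (trans (cong (x ∙ x ∙_) ε⁻¹≈ε) (identityʳ _)))) (exponent (element x)))
    }
    where
    central⁺ : ∀ {i} → (∀ j → i ∙ j ≡ j ∙ i) → i ∈ˢ members Z
    central⁺ {i} h = subst (_∈ˢ members Z) (index-element i)
      (∈Z⁺ (λ g → index-injective (trans (index-∙ (element i) g) (trans (cong (_∙ index g) (index-element i))
        (trans (h (index g)) (sym (trans (index-∙ g (element i)) (cong (index g ∙_) (index-element i)))))))))
    central⁻ : ∀ {i} → i ∈ˢ members Z → ∀ j → i ∙ j ≡ j ∙ i
    central⁻ {i} i∈ j = trans (sym (index-element-∙ i j))
      (trans (index-cong (∈Z⁻ (subst (_∈ˢ members Z) (sym (index-element i)) i∈) (element j))) (index-element-∙ j i))
    Z? : Decidable (_∈ˢ members Z)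
    Z? = _∈? members Z
    Z∖ε? : Decidable (λ i → i ∈ˢ members Z × ¬ i ≡ ε)
    Z∖ε? i = Z? i ×-dec ¬? (i ≟ ε)
    count≡1 : count Z∖ε? ≡ 1
    count≡1 = ℕ.+-cancelˡ-≡ 1 _ _ (begin
      1 + count Z∖ε?
        ≡⟨ cong (_+ count Z∖ε?) (count-unique (λ i → Z? i ×-dec i ≟ ε) ε (Sub.ε∈ (toSub Z) , refl) (λ _ → proj₂)) ⟨
      count (λ i → Z? i ×-dec i ≟ ε) + count Z∖ε?       ≡⟨ count-split Z? (_≟ ε) ⟨
      count Z?                                          ≡⟨ trans (size≡∥∥ Z) |Z|≡2 ⟩
      2                                                 ∎)
      where open ≡-Reasoning
    witness = count-witness Z∖ε? (λ eq → ℕ.0≢1+n (trans (sym eq) count≡1))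
    z = proj₁ witness
    z∈ = proj₁ (proj₂ witness)
    z≢ε = proj₂ (proj₂ witness)
    Z⊆ : ∀ {i} → i ∈ˢ members Z → i ≡ ε ⊎ i ≡ z
    Z⊆ {i} i∈ with i ≟ ε
    ... | yes eq = inj₁ eq
    ... | no ne  = inj₂ (count≡1⇒unique Z∖ε? count≡1 (z∈ , z≢ε) (i∈ , ne))
    move : ∀ a b → a ≡ a ∙ b ⁻¹ ∙ b
    move = solve 2 (λ a b → a ⊜ a ⊕ b ⁻ ⊕ b) refl

  extraspecial : IsExtraspecial X → Extraspecial finGroup
  extraspecial (_ , |Z|≡2 , (abelian , exponent) , _) = extraspecial-from (centre X) |Z|≡2 (∈⁺ X)
    (∈⁻ X) abelian exponent

≅-sym : ∀ {c₁ ℓ₁ c₂ ℓ₂} (G : Group c₁ ℓ₁) (H : Group c₂ ℓ₂) → G ≅ H → H ≅ G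
≅-sym G H (f , f-iso) = mk≅ H G g (λ {x} {y} eq → f.injective (H.trans (fg x) (H.trans eq (H.sym (fg y)))))
  (λ x y → f.injective (H.trans (fg (x H.∙ y)) (H.sym (H.trans (f.∙-homo (g x) (g y)) (H.∙-cong (fg x) (fg y))))))
  (λ {x} {y} eq → H.trans (H.sym (fg x)) (H.trans (f.⟦⟧-cong eq) (fg y)))
  (λ x → f x , f.injective (fg (f x)))
  where
  module G = Group G
  module H = Group H
  module f = GroupMorphisms.IsGroupIsomorphism f-iso
  g : H.Carrier → G.Carrier
  g y = proj₁ (f.surjective y)
  fg : ∀ y → f (g y) H.≈ y
  fg y = proj₂ (f.surjective y) G.refl

2^-∣ : ∀ {j k} → 2 ^ j < 2 ^ k → 2 * 2 ^ j ∣ 2 ^ k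
2^-∣ {j} {k} lt with ℕ.m≤n⇒∃[o]m+o≡n {suc j} {k} (ℕ.≰⇒> (λ k≤j → ℕ.<⇒≱ lt (ℕ.^-monoʳ-≤ 2 k≤j)))
... | o , refl = subst (2 * 2 ^ j ∣_) (sym (ℕ.^-distribˡ-+-* 2 (suc j) o)) (m∣m*n (2 ^ o))

-- Sylow conjugacy and restriction to a subgroup

module _ {c ℓ} (G : FiniteGroup c ℓ) where
  private
    module G = FiniteGroup G
  open Indexing G
  open FinGroup finGroup
  open Theory finGroup
  open Sub using (size; mem?)

  IsSylow⇒ : ∀ {P K : Subgroup G} → IsSylow 2 P K →
             (∀ {x} → toSub P ∋ x → toSub K ∋ x) × (∃[ k ] size (toSub P) ≡ 2 ^ k) ×
             size (toSub P) ∣ size (toSub K) × ¬ 2 * size (toSub P) ∣ size (toSub K)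
  IsSylow⇒ {P} {K} (P⊆K , k , ∥P∥≡2^k , ∣K , ∤K) = P⊆K , (k , eq) ,
      subst₂ _∣_ (sym eq) (sym (size≡∥∥ K)) ∣K , (λ d → ∤K (subst₂ _∣_ (cong (2 *_) eq) (size≡∥∥ K) d))
    where
    eq : size (toSub P) ≡ 2 ^ k
    eq = trans (size≡∥∥ P) ∥P∥≡2^k

  module Conjugate (S : Subgroup G) (a : Fin G.order) where
    open GroupSolver group using (solve; _⊜_; _⊕_; _⁻; e)
    private
      module S = Sub (toSub S)
      g = element a

    conjugateSub : Sub finGroup
    conjugateSub = record
      { mem  = λ x → toSub S ∋ (a ⁻¹ ∙ (x ∙ a))
      ; mem? = λ x → mem? (toSub S) (a ⁻¹ ∙ (x ∙ a))
      ; ε∈   = subst (toSub S ∋_) (solve 1 (λ a → e ⊜ a ⁻ ⊕ (e ⊕ a)) refl a) S.ε∈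
      ; ∙∈   = λ {x} {y} x∈ y∈ → subst (toSub S ∋_) (solve 3 (λ a x y → (a ⁻ ⊕ (x ⊕ a)) ⊕ (a ⁻ ⊕ (y ⊕ a)) ⊜ a ⁻ ⊕ (x ⊕ y ⊕ a)) refl a x y) (S.∙∈ x∈ y∈)
      ; ⁻¹∈  = λ {x} x∈ → subst (toSub S ∋_) (solve 2 (λ a x → (a ⁻ ⊕ (x ⊕ a)) ⁻ ⊜ a ⁻ ⊕ (x ⁻ ⊕ a)) refl a x) (S.⁻¹∈ x∈)
      }

    conjugate : Subgroup G
    conjugate = fromSub conjugateSub

    ∥conjugate∥ : ∥ conjugate ∥ ≡ ∥ S ∥
    ∥conjugate∥ = begin
      ∥ conjugate ∥           ≡⟨ size≡∥∥ conjugate ⟨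
      size (toSub conjugate)
        ≡⟨ count-cong (mem? (toSub conjugate)) (mem? conjugateSub) (λ _ → ∈-subset⁻ (mem? conjugateSub))
          (λ _ → ∈-subset⁺ (mem? conjugateSub)) ⟩
      size conjugateSub       ≡⟨ count-∙ʳ (λ x → mem? (toSub S) (a ⁻¹ ∙ x)) a ⟩
      count (λ x → mem? (toSub S) (a ⁻¹ ∙ x)) ≡⟨ count-∙ˡ (mem? (toSub S)) (a ⁻¹) ⟩
      size (toSub S)          ≡⟨ size≡∥∥ S ⟩
      ∥ S ∥                   ∎
      where open ≡-Reasoning

    conjugate-≅ : FiniteGroup.group ⟨ S ⟩ ≅ FiniteGroup.group ⟨ conjugate ⟩
    conjugate-≅ = mk≅ (FiniteGroup.group ⟨ S ⟩) (FiniteGroup.group ⟨ conjugate ⟩)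
      (λ (x , x∈) → g G.∙ x G.∙ g G.⁻¹ , ∈-subset⁺ (mem? conjugateSub) (subst (toSub S ∋_)
        (trans (solve 2 (λ a x → x ⊜ a ⁻ ⊕ (a ⊕ x ⊕ a ⁻ ⊕ a)) refl a (index x))
          (cong (λ y → a ⁻¹ ∙ (y ∙ a))
            (sym (trans (index-// (g G.∙ x) g)
              (cong₂ (λ u v → u ∙ v ⁻¹) (trans (index-∙ g x) (cong (_∙ index x) (index-element a)))
                (index-element a)))))) x∈))
      (λ eq → G.∙-congʳ (G.∙-congˡ eq))
      (λ (x , _) (y , _) → solveᴳ 3
        (λ g x y → g ⊕ᴳ (x ⊕ᴳ y) ⊕ᴳ g ⁻ᴳ ⊜ᴳ g ⊕ᴳ x ⊕ᴳ g ⁻ᴳ ⊕ᴳ (g ⊕ᴳ y ⊕ᴳ g ⁻ᴳ)) G.refl g x y)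
      (λ eq → ∙-cancelˡ g _ _ (∙-cancelʳ (g G.⁻¹) _ _ eq))
      (λ (y , y∈) → (g G.⁻¹ G.∙ (y G.∙ g) , subst (toSub S ∋_) (sym (trans (index-∙ (g G.⁻¹) (y G.∙ g))
          (cong₂ _∙_ (trans (index-⁻¹ g) (cong _⁻¹ (index-element a)))
            (trans (index-∙ y g) (cong (index y ∙_) (index-element a))))))
          (∈-subset⁻ (mem? conjugateSub) y∈)) ,
        solveᴳ 2 (λ g y → g ⊕ᴳ (g ⁻ᴳ ⊕ᴳ (y ⊕ᴳ g)) ⊕ᴳ g ⁻ᴳ ⊜ᴳ y) G.refl g y)
      where
      open GroupSolver G.group using () renaming (solve to solveᴳ; _⊜_ to _⊜ᴳ_; _⊕_ to _⊕ᴳ_; _⁻ to _⁻ᴳ)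
      open GroupProperties G.group using (∙-cancelˡ; ∙-cancelʳ)

  -- The 2-group P acts on the odd number of left cosets of S in G; a fixed coset aS means P ≤
  -- aSa⁻¹.
  two-group-in-conjugate : ∀ (P S : Subgroup G) {k} → size (toSub P) ≡ 2 ^ k → IsSylow 2 S (whole G) →
                           ∃[ a ] (∀ {x} → toSub P ∋ x → toSub S ∋ (a ⁻¹ ∙ (x ∙ a)))
  two-group-in-conjugate P S {k} |P|≡2^k S-sylow with any? fixed?
    where open DoubleCosets (toSub P) (toSub S)
  ... | yes (a , fix) = a , fix _
  ... | no ∄a = contradiction (subst (2 * size (toSub S) ∣_) (sym (count-none _ (λ a p → ∄a (a , proj₂ p)))) (_ ∣0))
      (fixed-odd {k = k} |P|≡2^k (mem? (toSub (whole G))) (λ _ _ → ∈⊤)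
        (proj₂ (proj₂ (proj₂ (IsSylow⇒ {S} {whole G} S-sylow)))))
    where open DoubleCosets (toSub P) (toSub S)

  conjugate-isSylow : ∀ S a → IsSylow 2 S (whole G) → IsSylow 2 (Conjugate.conjugate S a) (whole G)
  conjugate-isSylow S a (_ , k , eq , rest) = (λ _ → ∈⊤) , k , trans (Conjugate.∥conjugate∥ S a) eq , rest

  -- The form theory works in a group whose carrier is a whole `Fin`. `ι` embeds the indices of R
  -- into those of G, and `pull` restricts subgroups along it.
  module Restrict (R : Subgroup G) where
    private
      module ⟨R⟩ = FiniteGroup ⟨ R ⟩
    open Indexing (⟨ R ⟩) public using () renaming
      (finGroup to 𝔼; index-element-∙ to index-element-∙ᴱ; index-ε to index-εᴱ; index-⁻¹ to index-⁻¹ᴱ; element-index to element-indexᴱ)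
    private
      module 𝔼 = FinGroup 𝔼
      module 𝔼T = Theory 𝔼

    ι : Fin ∥ R ∥ → Fin G.order
    ι i = index (proj₁ (⟨R⟩.element i))

    ι-index : ∀ y → ι (⟨R⟩.index y) ≡ index (proj₁ y)
    ι-index y = index-cong (⟨R⟩.element-index y)

    ι-∙ : ∀ i j → ι (i 𝔼.∙ j) ≡ ι i ∙ ι j
    ι-∙ i j = trans (cong ι (sym (index-element-∙ᴱ i j)))
      (trans (ι-index (⟨R⟩.element i ⟨R⟩.∙ ⟨R⟩.element j)) (index-∙ _ _))

    ι-ε : ι 𝔼.ε ≡ ε
    ι-ε = trans (cong ι (sym index-εᴱ)) (trans (ι-index ⟨R⟩.ε) index-ε)

    ι-⁻¹ : ∀ i → ι (i 𝔼.⁻¹) ≡ ι i ⁻¹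
    ι-⁻¹ i = GroupProperties.inverseʳ-unique group (ι i) (ι (i 𝔼.⁻¹))
      (trans (sym (ι-∙ i (i 𝔼.⁻¹))) (trans (cong ι (𝔼.inverseʳ i)) ι-ε))

    ι-injective : ∀ {i j} → ι i ≡ ι j → i ≡ j
    ι-injective {i} {j} eq = trans (sym (⟨R⟩.index-element i))
      (trans (Inverse.to-cong ⟨R⟩.enum (index-injective eq)) (⟨R⟩.index-element j))

    ι∈R : ∀ i → toSub R ∋ ι i
    ι∈R i = proj₂ (⟨R⟩.element i)

    preimage : ∀ {x} → toSub R ∋ x → ∃[ i ] ι i ≡ x
    preimage {x} x∈ = ⟨R⟩.index y , trans (ι-index y) (index-element x)
      where y = element x , subst (_∈ˢ members R) (sym (index-element x)) x∈

    pull : Sub finGroup → Sub 𝔼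
    pull U = record
      { mem  = λ i → U ∋ ι i
      ; mem? = λ i → mem? U (ι i)
      ; ε∈   = subst (U ∋_) (sym ι-ε) (Sub.ε∈ U)
      ; ∙∈   = λ {i} {j} i∈ j∈ → subst (U ∋_) (sym (ι-∙ i j)) (Sub.∙∈ U i∈ j∈)
      ; ⁻¹∈  = λ {i} i∈ → subst (U ∋_) (sym (ι-⁻¹ i)) (Sub.⁻¹∈ U i∈)
      }

    |pull| : ∀ U → (∀ {x} → U ∋ x → toSub R ∋ x) → size (pull U) ≡ size U
    |pull| U U⊆R = trans (sym (ℕ.*-identityˡ _)) (trans
      (double-count (λ i x → mem? U (ι i) ×-dec x ≟ ι i) (mem? (pull U)) (mem? U) 1 1
        (λ { i _ (i∈ , refl) → i∈ , i∈ })
        (λ i i∈ → count-unique (λ x → mem? U (ι i) ×-dec x ≟ ι i) (ι i) (i∈ , refl) (λ _ → proj₂))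
        (λ x x∈ → let (i , ιi≡x) = preimage (U⊆R x∈) in
          count-unique (λ i → mem? U (ι i) ×-dec x ≟ ι i) i (subst (U ∋_) (sym ιi≡x) x∈ , sym ιi≡x)
            (λ j (_ , x≡ιj) → ι-injective (trans (sym x≡ιj) (sym ιi≡x)))))
      (ℕ.*-identityˡ _))

-- The criterion

module Criterion {ℓ₁ ℓ₂} (G : FiniteGroup ℓ₁ ℓ₂) (H G₂ H₂ N₂ N R : Subgroup G) where
  private
    module G = FiniteGroup G
  open Indexing G
  open FinGroup finGroup
  open Theory finGroup
  open Codes finGroup
  open Sub using (size; mem?)
  open Restrict G R

  private
    h q n₂ r : Sub finGroup
    h  = toSub H
    q  = toSub H₂
    n₂ = toSub N₂
    r  = toSub R

    group⟨_⟩ : Subgroup G → Group ℓ₁ ℓ₂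
    group⟨ K ⟩ = FiniteGroup.group ⟨ K ⟩

  open Normalising q

  Condition : ℕ → Set (ℓ₁ ⊔ ℓ₂)
  Condition m =
      ¬ (2 ∣ ∥ H ∥)
    ⊎ ¬ IsAbelian group⟨ H₂ ⟩
    ⊎ (IsAbelian group⟨ H₂ ⟩ × ∥ N₂ ∥ < ∥ G₂ ∥)
    ⊎ (IsAbelian group⟨ H₂ ⟩ × ∥ H₂ ∥ ^ 2 ≡ 2 * ∥ G₂ ∥ × group⟨ G₂ ⟩ ≅ G[ m ,1])

  module _ (N⇒ : ∀ {x} → toSub N ∋ x → Normalises x) (⇒N : ∀ {x} → Normalises x → toSub N ∋ x)
           (H₂-sylow : IsSylow 2 H₂ H) (N₂-sylow : IsSylow 2 N₂ N) (N₂⊆R : ∀ {x} → n₂ ∋ x → r ∋ x)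
           (ext : Extraspecial 𝔼) (∥R∥≡∥G₂∥ : ∥ R ∥ ≡ ∥ G₂ ∥)
           (G₂≅R : group⟨ G₂ ⟩ ≅ group⟨ R ⟩) where

    private
      module 𝔼 = FinGroup 𝔼
      module 𝔼T = Theory 𝔼
    open Quadratic 𝔼 ext
    open Singular 𝔼 ext
    open Extraspecial ext using (z; z≢ε)

    private
      H₂-facts = IsSylow⇒ G {H₂} {H} H₂-sylow
      N₂-facts = IsSylow⇒ G {N₂} {N} N₂-sylow
      K⊆H = proj₁ H₂-facts
      k = proj₁ (proj₁ (proj₂ H₂-facts))
      |q|≡2^k = proj₂ (proj₁ (proj₂ H₂-facts))
      |q|∣|h| = proj₁ (proj₂ (proj₂ H₂-facts))
      odd-index = proj₂ (proj₂ (proj₂ H₂-facts))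
      N₂⊆N = proj₁ N₂-facts
      j = proj₁ (proj₁ (proj₂ N₂-facts))
      |n₂|≡2^j = proj₂ (proj₁ (proj₂ N₂-facts))
      odd-index-N = proj₂ (proj₂ (proj₂ N₂-facts))

      Lifting : Set
      Lifting = LiftsInvolutions h q n₂ K⊆H |q|∣|h| odd-index

      perfectCode⇒lifting : IsPerfectCodeOf G H → Lifting
      perfectCode⇒lifting = transversal⇒lifts h q n₂ K⊆H |q|∣|h| odd-index
        (λ x∈ → N⇒ (N₂⊆N x∈)) ∘ perfectCode⇒transversal G H

      lifting⇒perfectCode : Lifting → IsPerfectCodeOf G H
      lifting⇒perfectCode lifts = matching⇒perfectCode G H (Matchings.match-complement finGroup h
        (lifts⇒involution h q n₂ K⊆H |q|∣|h| odd-index {k} |q|≡2^k (toSub N) N⇒ ⇒N N₂⊆N odd-index-N lifts))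

      K⊆R : ∀ {x} → q ∋ x → r ∋ x
      K⊆R x∈ = N₂⊆R (Q⊆N₂ h q n₂ K⊆H |q|∣|h| odd-index {k} |q|≡2^k (toSub N) N⇒ ⇒N N₂⊆N odd-index-N x∈)

      K : Sub 𝔼
      K = pull q

      |K| : size K ≡ ∥ H₂ ∥
      |K| = trans (|pull| q K⊆R) (size≡∥∥ H₂)

      s-false⇒ : ∀ i → s i ≡ false → ι i ∙ ι i ≡ ε
      s-false⇒ i eq = trans (sym (ι-∙ i i)) (trans (cong ι (trans (s-law i) (cong z^ eq))) ι-ε)

      s-false⇐ : ∀ i → ι i ∙ ι i ≡ ε → s i ≡ false
      s-false⇐ i eq = s-unique false (ι-injective (trans (ι-∙ i i) (trans eq (sym ι-ε))))

      lifts⇒lifting : Lifts K → Lifting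
      lifts⇒lifting lifts x x∈ x²∈ with preimage (N₂⊆R x∈)
      ... | i , refl with lifts i (subst (q ∋_) (sym (ι-∙ i i)) x²∈)
      ...   | y , y∈ , eq = ι y , y∈ , trans (cong₂ _∙_ (sym (ι-∙ i y)) (sym (ι-∙ i y))) (s-false⇒ (i 𝔼.∙ y) eq)

      lifting⇒lifts : (∀ {x} → r ∋ x → n₂ ∋ x) → Lifting → Lifts K
      lifting⇒lifts R⊆N₂ lifts i i²∈ with lifts (ι i) (R⊆N₂ (ι∈R i)) (subst (q ∋_) (ι-∙ i i) i²∈)
      ... | y , y∈ , eq with preimage (K⊆R y∈)
      ...   | l , refl = l , y∈ , s-false⇐ (i 𝔼.∙ l) (trans (cong₂ _∙_ (ι-∙ i l) (ι-∙ i l)) eq)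

      abelian⇒ : IsAbelian group⟨ H₂ ⟩ → Abelian K
      abelian⇒ ab {a} {b} a∈ b∈ = c-commute (ι-injective (trans (ι-∙ a b) (trans
          (trans (sym (index-element-∙ (ι a) (ι b)))
            (trans (index-cong (ab (carrier a∈) (carrier b∈))) (index-element-∙ (ι b) (ι a)))) (sym (ι-∙ b a)))))
        where
        carrier : ∀ {i} → K 𝔼T.∋ i → FiniteGroup.Carrier ⟨ H₂ ⟩
        carrier {i} i∈ = element (ι i) , subst (q ∋_) (sym (index-element (ι i))) i∈

      abelian⇐ : Abelian K → IsAbelian group⟨ H₂ ⟩
      abelian⇐ ab (x , x∈) (y , y∈) with preimage (K⊆R x∈) | preimage (K⊆R y∈)
      ... | a , eqa | b , eqb = index-injective (begin
        index (x G.∙ y)      ≡⟨ index-∙ x y ⟩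
        index x ∙ index y    ≡⟨ cong₂ _∙_ eqa eqb ⟨
        ι a ∙ ι b            ≡⟨ ι-∙ a b ⟨
        ι (a 𝔼.∙ b)          ≡⟨ cong ι (commute-c (ab (subst (q ∋_) (sym eqa) x∈) (subst (q ∋_) (sym eqb) y∈))) ⟩
        ι (b 𝔼.∙ a)          ≡⟨ ι-∙ b a ⟩
        ι b ∙ ι a            ≡⟨ cong₂ _∙_ eqb eqa ⟩
        index y ∙ index x    ≡⟨ index-∙ y x ⟨
        index (y G.∙ x)      ∎)
        where open ≡-Reasoning

      abelian? : Abelian K ⊎ (∃[ a ] ∃[ b ] K 𝔼T.∋ a × K 𝔼T.∋ b × c a b ≡ true)
      abelian? with any? (λ a → any? (λ b → mem? K a ×-dec (mem? K b ×-dec (c a b ≟ᵇ true))))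
      ... | yes w = inj₂ w
      ... | no ∄w = inj₁ λ {a} {b} a∈ b∈ → ¬-not λ eq → ∄w (a , b , a∈ , b∈ , eq)

      odd⇒z∉K : ¬ 2 ∣ ∥ H ∥ → ¬ K 𝔼T.∋ z
      odd⇒z∉K odd z∈ = z≢ε (count≡1⇒unique (mem? K) (|K|≡1 k |q|≡2^k) (Sub.ε∈ K) z∈)
        where
        |K|≡1 : ∀ k → size q ≡ 2 ^ k → size K ≡ 1
        |K|≡1 zero    eq = trans (|pull| q K⊆R) eq
        |K|≡1 (suc k) eq = contradiction (∣-trans (m∣m*n (2 ^ k)) (subst₂ _∣_ eq (size≡∥∥ H) |q|∣|h|)) odd

      -- A nontrivial normal subgroup of R contains z: a nontrivial element either is central, hence
      -- z, or has commutator z with some y.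
      normal⇒z∈K : 2 ∣ ∥ H ∥ → (∀ {x} → r ∋ x → n₂ ∋ x) → K 𝔼T.∋ z
      normal⇒z∈K even R⊆N₂ with any? (λ a → mem? K a ×-dec ¬? (a ≟ 𝔼.ε))
      ... | no ∄a = contradiction (subst (2 ∣_) (sym (size≡∥∥ H)) even)
          (subst (λ s → ¬ 2 * s ∣ size h) (trans (sym (|pull| q K⊆R))
            (count-unique (mem? K) 𝔼.ε (Sub.ε∈ K)
              (λ a a∈ → decidable-stable (a ≟ 𝔼.ε) λ ne → ∄a (a , a∈ , ne)))) odd-index)
      ... | yes (a , a∈ , a≢ε) with any? (λ y → c y a ≟ᵇ true)
      ...   | no ∄y = [ (λ eq → contradiction eq a≢ε) , (λ eq → subst (K 𝔼T.∋_) eq a∈) ]′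
                        (nondegenerate (λ y → trans (c-sym a y) (¬-not λ eq → ∄y (y , eq))))
      ...   | yes (y , cya) = subst (K 𝔼T.∋_) conj≡ (Sub.∙∈ K conj∈ (Sub.⁻¹∈ K a∈))
        where
        open GroupSolver 𝔼.group using (solve; _⊜_; _⊕_; _⁻)
        conj∈ : K 𝔼T.∋ (y 𝔼.∙ a 𝔼.∙ y 𝔼.⁻¹)
        conj∈ = subst (q ∋_) (sym (trans (ι-∙ _ _) (cong₂ _∙_ (ι-∙ y a) (ι-⁻¹ y))))
          (proj₂ (N⇒ (N₂⊆N (R⊆N₂ (ι∈R y))) (ι a)) a∈)
        conj≡ : y 𝔼.∙ a 𝔼.∙ y 𝔼.⁻¹ 𝔼.∙ a 𝔼.⁻¹ ≡ z
        conj≡ = trans (cong (λ u → u 𝔼.∙ y 𝔼.⁻¹ 𝔼.∙ a 𝔼.⁻¹) (trans (c-law y a) (cong (λ b → z^ b 𝔼.∙ (a 𝔼.∙ y)) cya)))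
          (solve 3 (λ z a y → z ⊕ (a ⊕ y) ⊕ y ⁻ ⊕ a ⁻ ⊜ z) refl z a y)

      -- Conjugation in R changes an element at most by a factor z, which lies in Q.
      z∈K⇒R⊆N : K 𝔼T.∋ z → ∀ {x} → r ∋ x → toSub N ∋ x
      z∈K⇒R⊆N z∈ {x} x∈ with preimage x∈
      ... | i , refl = ⇒N (fixed⇒normalises λ y y∈ → conj y y∈)
        where
        conj : ∀ y → q ∋ y → q ∋ (ι i ⁻¹ ∙ (y ∙ ι i))
        conj y y∈ with preimage (K⊆R y∈)
        ... | l , refl = subst (q ∋_) (begin
            ι (z^ (c l i) 𝔼.∙ l)                        ≡⟨ cong ι (𝔼T.x⁻¹∙xy i _) ⟨
            ι (i 𝔼.⁻¹ 𝔼.∙ (i 𝔼.∙ (z^ (c l i) 𝔼.∙ l)))   ≡⟨ cong (λ u → ι (i 𝔼.⁻¹ 𝔼.∙ u)) (z^-swap (c l i) i l) ⟩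
            ι (i 𝔼.⁻¹ 𝔼.∙ (z^ (c l i) 𝔼.∙ (i 𝔼.∙ l)))   ≡⟨ cong (λ u → ι (i 𝔼.⁻¹ 𝔼.∙ u)) (c-law l i) ⟨
            ι (i 𝔼.⁻¹ 𝔼.∙ (l 𝔼.∙ i))                    ≡⟨ ι-∙ _ _ ⟩
            ι (i 𝔼.⁻¹) ∙ ι (l 𝔼.∙ i)                    ≡⟨ cong₂ _∙_ (ι-⁻¹ i) (ι-∙ l i) ⟩
            ι i ⁻¹ ∙ (ι l ∙ ι i)                        ∎)
            (Sub.∙∈ K (z^∈ (c l i)) y∈)
          where
          open ≡-Reasoning
          z^∈ : ∀ b → K 𝔼T.∋ z^ b
          z^∈ false = Sub.ε∈ K
          z^∈ true  = z∈

      -- If z ∈ Q, then R ≤ N. As |R| is a larger power of 2 than |N₂|, this would make 2|N₂| divide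
      -- |N|.
      small⇒z∉K : (∃[ t ] ∥ R ∥ ≡ 2 ^ t) → ∥ N₂ ∥ < ∥ G₂ ∥ → ¬ K 𝔼T.∋ z
      small⇒z∉K (t , ∥R∥≡2^t) lt z∈ = odd-index-N
        (∣-trans (subst₂ _∣_ (cong (2 *_) (sym |n₂|≡2^j)) (trans (sym ∥R∥≡2^t) (sym (size≡∥∥ R)))
          (2^-∣ {j} {t} (subst₂ _<_ (trans (sym (size≡∥∥ N₂)) |n₂|≡2^j) (trans (sym ∥R∥≡∥G₂∥) ∥R∥≡2^t) lt)))
        (Cosets.lagrange r (mem? (toSub N)) (λ {a} {b} a∈ u → Cosets.∼-⊆ (toSub N) {a} {b} a∈ (z∈K⇒R⊆N z∈ u))))

    criterion : ∀ m → 1 ≤ⁿ m → ∥ R ∥ ≡ 2 ^ (2 * m + 1) → IsPerfectCodeOf G H ⇔ Condition m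
    criterion m 1≤m ∥R∥≡ = mk⇔ forward backward
      where
      square : ∀ x → x ^ 2 ≡ x * x
      square x = cong (x *_) (ℕ.*-identityʳ x)

      forward : IsPerfectCodeOf G H → Condition m
      forward perfect with 2 ∣? ∥ H ∥ | abelian? | ∥ N₂ ∥ ℕ.<? ∥ G₂ ∥
      ... | no odd | _ | _ = inj₁ odd
      ... | yes _ | inj₂ (a , b , a∈ , b∈ , cab) | _ = inj₂
        (inj₁ λ ab → contradiction (trans (sym cab) (abelian⇒ ab a∈ b∈)) λ ())
      ... | yes _ | inj₁ ab | yes lt = inj₂ (inj₂ (inj₁ (abelian⇐ ab , lt)))
      ... | yes even | inj₁ ab | no ≮ = inj₂ (inj₂ (inj₂ (abelian⇐ ab , order , iso)))
        where
        -- N₂ ≤ R is not smaller than R, so N₂ = R and Q is normal in R.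
        R⊆N₂ : ∀ {x} → r ∋ x → n₂ ∋ x
        R⊆N₂ {x} = count-⊆-≥ (mem? n₂) (mem? r) (λ _ → N₂⊆R)
          (subst₂ _≤ⁿ_ (sym (trans (size≡∥∥ R) ∥R∥≡∥G₂∥)) (sym (size≡∥∥ N₂)) (ℕ.≮⇒≥ ≮)) x
        z∈K : K 𝔼T.∋ z
        z∈K = normal⇒z∈K even R⊆N₂
        module Nec = Necessity K z∈K ab (lifting⇒lifts R⊆N₂ (perfectCode⇒lifting perfect))
        order : ∥ H₂ ∥ ^ 2 ≡ 2 * ∥ G₂ ∥
        order = trans (square ∥ H₂ ∥) (trans (subst (λ x → x * x ≡ 2 * ∥ R ∥) |K| Nec.|Q|²≡2n) (cong (2 *_) ∥R∥≡∥G₂∥))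
        iso : group⟨ G₂ ⟩ ≅ G[ m ,1]
        iso = ≅-trans group⟨ G₂ ⟩ group⟨ R ⟩ G[ m ,1] G₂≅R (≅-trans group⟨ R ⟩ 𝔼.group G[ m ,1] (Indexing.index-≅ ⟨ R ⟩)
                (CentralProduct.maximalSingular⇒≅ 𝔼 ext 1≤m ∥R∥≡ Nec.maximalSingular))

      backward : Condition m → IsPerfectCodeOf G H
      backward (inj₁ odd) = lifting⇒perfectCode (lifts⇒lifting (z∉⇒lifts K (odd⇒z∉K odd)))
      backward (inj₂ (inj₁ ¬ab)) with abelian?
      ... | inj₁ ab = contradiction (abelian⇐ ab) ¬ab
      ... | inj₂ (a , b , a∈ , b∈ , cab) = lifting⇒perfectCode (lifts⇒lifting (nonabelian⇒lifts K a∈ b∈ cab))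
      backward (inj₂ (inj₂ (inj₁ (_ , lt)))) = lifting⇒perfectCode
        (lifts⇒lifting (z∉⇒lifts K (small⇒z∉K (2 * m + 1 , ∥R∥≡) lt)))
      backward (inj₂ (inj₂ (inj₂ (ab , order , iso)))) with mem? K z
      ... | no z∉K = lifting⇒perfectCode (lifts⇒lifting (z∉⇒lifts K z∉K))
      -- The order condition amounts to C(Q) = Q, and the isomorphism supplies a maximal singular
      -- subgroup of R.
      ... | yes z∈K = lifting⇒perfectCode (lifts⇒lifting (sufficiency K z∈K (abelian⇒ ab)
          (trans (cong₂ _*_ |K| |K|) (trans (sym (square ∥ H₂ ∥)) (trans order (cong (2 *_) (sym ∥R∥≡∥G₂∥)))))
          (CentralProduct.FromIso.maximalSingular 𝔼 ext {m}
            (≅-trans 𝔼.group group⟨ R ⟩ G[ m ,1] (Indexing.element-≅ ⟨ R ⟩)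
              (≅-trans group⟨ R ⟩ group⟨ G₂ ⟩ G[ m ,1] (≅-sym group⟨ G₂ ⟩ group⟨ R ⟩ G₂≅R) iso)))))

-- Normalisers and the choice of R

module _ {c ℓ} (G : FiniteGroup c ℓ) (H₂ N : Subgroup G) where
  private
    module G = FiniteGroup G
  open Indexing G
  open FinGroup finGroup
  open Codes.Normalising finGroup (toSub H₂)
  open Normalizer H₂ using (Normalizes)

  private
    index-conj : ∀ g x → index (g G.∙ x G.∙ g G.⁻¹) ≡ index g ∙ index x ∙ index g ⁻¹
    index-conj g x = trans (index-// (g G.∙ x) g) (cong (_∙ index g ⁻¹) (index-∙ g x))

    index-conj-element : ∀ g x → index (element g G.∙ x G.∙ element g G.⁻¹) ≡ g ∙ index x ∙ g ⁻¹
    index-conj-element g x = trans (index-conj (element g) x) (cong (λ u → u ∙ index x ∙ u ⁻¹) (index-element g))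

    ∈-subst : ∀ {i j} → i ≡ j → i ∈ˢ members H₂ → j ∈ˢ members H₂
    ∈-subst = subst (_∈ˢ members H₂)

  normalizer⇒ : (∀ {g} → index g ∈ˢ members N → Normalizes g) → ∀ {g} → g ∈ˢ members N → Normalises g
  normalizer⇒ N⁻ {g} g∈ b =
      (λ u → ∈-subst (index-element b) (Equivalence.to (norm (element b)) (∈-subst (sym conj≡) u))) ,
      (λ u → ∈-subst conj≡ (Equivalence.from (norm (element b)) (∈-subst (sym (index-element b)) u)))
    where
    norm : Normalizes (element g)
    norm = N⁻ (subst (_∈ˢ members N) (sym (index-element g)) g∈)
    conj≡ : index (element g G.∙ element b G.∙ element g G.⁻¹) ≡ g ∙ b ∙ g ⁻¹
    conj≡ = trans (index-conj-element g (element b)) (cong (λ v → g ∙ v ∙ g ⁻¹) (index-element b))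

  ⇒normalizer : (∀ {g} → Normalizes g → index g ∈ˢ members N) → ∀ {g} → Normalises g → g ∈ˢ members N
  ⇒normalizer N⁺ {g} norm = subst (_∈ˢ members N) (index-element g) (N⁺ λ x → mk⇔
    (λ u → proj₁ (norm (index x)) (∈-subst (index-conj-element g x) u))
    (λ u → ∈-subst (sym (index-conj-element g x)) (proj₂ (norm (index x)) u)))

module _ {c ℓ} (G : FiniteGroup c ℓ) (S P : Subgroup G) {k} (|P|≡2^k : Sub.size (Indexing.toSub G P) ≡ 2 ^ k)
         (S-sylow : IsSylow 2 S (whole G)) where
  open Indexing G

  record ContainingSylow : Set (c ⊔ ℓ) where
    field
      R       : Subgroup G
      isSylow : IsSylow 2 R (whole G)
      P⊆R     : ∀ {x} → x ∈ˢ members P → x ∈ˢ members R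
      ∥R∥≡∥S∥ : ∥ R ∥ ≡ ∥ S ∥
      S≅R     : FiniteGroup.group ⟨ S ⟩ ≅ FiniteGroup.group ⟨ R ⟩

  abstract
    containingSylow : ContainingSylow
    containingSylow = record
      { R       = conjugate
      ; isSylow = conjugate-isSylow G S a S-sylow
      ; P⊆R     = λ x∈ → ∈-subset⁺ (Sub.mem? conjugateSub) (proj₂ conj x∈)
      ; ∥R∥≡∥S∥ = ∥conjugate∥
      ; S≅R     = conjugate-≅
      }
      where
      conj : ∃[ a ] (∀ {x} → Sub.mem (toSub P) x → Sub.mem (Conjugate.conjugateSub G S a) x)
      conj = two-group-in-conjugate G P S {k} |P|≡2^k S-sylow
      a : Fin (FiniteGroup.order G)
      a = proj₁ conj
      open Conjugate G S a

theorem1p3 : ∀ {c ℓ} (G : FiniteGroup c ℓ) (m : ℕ) → 1 ≤ⁿ m →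
    (∀ (P : Subgroup G) → IsSylow 2 P (whole G) → IsExtraspecial ⟨ P ⟩ × ∥ P ∥ ≡ 2 ^ (2 * m + 1)) →
    ∀ (H G₂ H₂ N₂ : Subgroup G) →
    IsSylow 2 G₂ (whole G) →
    IsSylow 2 H₂ H →
    IsSylow 2 N₂ (normalizer H₂) →
    IsPerfectCodeOf G H ⇔
    ( ¬ (2 ∣ ∥ H ∥)
    ⊎ ¬ IsAbelian (FiniteGroup.group ⟨ H₂ ⟩)
    ⊎ (IsAbelian (FiniteGroup.group ⟨ H₂ ⟩) × ∥ N₂ ∥ < ∥ G₂ ∥)
    ⊎ (IsAbelian (FiniteGroup.group ⟨ H₂ ⟩) × ∥ H₂ ∥ ^ 2 ≡ 2 * ∥ G₂ ∥ × FiniteGroup.group ⟨ G₂ ⟩ ≅ G[ m ,1]) )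
theorem1p3 G m 1≤m sylow H G₂ H₂ N₂ G₂-sylow H₂-sylow N₂-sylow@(_ , k , |N₂|≡2^k , _) =
  Criterion.criterion G H G₂ H₂ N₂ (normalizer H₂) R
    (normalizer⇒ G H₂ (normalizer H₂) (Normalizer.∈⁻ H₂)) (⇒normalizer G H₂ (normalizer H₂) (Normalizer.∈⁺ H₂))
    H₂-sylow N₂-sylow P⊆R (extraspecial ⟨ R ⟩ (proj₁ (sylow R isSylow))) ∥R∥≡∥S∥ S≅R m 1≤m (proj₂ (sylow R isSylow))
  where
  -- G₂ and N₂ are chosen independently, so N₂ need not lie in G₂. The forms live on a conjugate R
  -- of G₂ that contains N₂, and order and isomorphism type carry over to G₂.
  open ContainingSylow (containingSylow G G₂ N₂ {k} (trans (Indexing.size≡∥∥ G N₂) |N₂|≡2^k) G₂-sylow)
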